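{- Let $m$ be a positive integer. For any $(2m+2)$-connected graph $G$ and any distinct vertices $a_1,\ldots,a_m,b_1,b_2$ of $G$, there is a $b_1$-$b_2$ path $P$ in $G$ such that $\{a_1,\ldots,a_m\}\cap V(P)=\emptyset$ and $G-P$ is connected.
   Context: All graphs are finite and simple. $G-P$ denotes the graph obtained from $G$ by deleting the vertices of $P$ (and all incident edges). -}

module Defs where

open import Data.Nat using (ℕ; _<_)
open import Data.Fin using (Fin)
open import Data.List using (List; []; _∷_; length)
open import Data.List.Membership.Propositional using (_∈_)
open import Relation.Nullary using (¬_)
open import Level using (0ℓ; suc)

record Graph (n : ℕ) : Set₁ where
  field
    Adj    : Fin n → Fin n → Set
    sym    : ∀ {u v} → Adj u v → Adj v u
    irrefl : ∀ v → ¬ Adj v v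

module _ {n : ℕ} (G : Graph n) where
  open Graph G

  -- Reach X u v : there is a walk from u to v in G all of whose vertices
  -- after u avoid the vertex set X (u itself is assumed outside X by callers),
  -- i.e. u and v are joined by a walk in G - X.
  data Reach (X : Fin n → Set) : Fin n → Fin n → Set where
    here : ∀ {u} → Reach X u u
    step : ∀ {u w v} → Adj u w → ¬ X w → Reach X w v → Reach X u v

  ConnectedMinus : (Fin n → Set) → Set
  ConnectedMinus X = ∀ u v → ¬ X u → ¬ X v → Reach X u v

  -- G is k-connected: |V(G)| > k and deleting fewer than k vertices
  -- leaves the graph connected.  (A list of length < k represents a vertex
  -- set of size < k; duplicates only make it smaller.)
  KConnected : ℕ → Set
  KConnected k = k < n × (∀ (S : List (Fin n)) → length S < k → ConnectedMinus (_∈ S))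
    where open import Data.Product using (_×_)

  data IsWalk : Fin n → Fin n → List (Fin n) → Set where
    single : ∀ {v} → IsWalk v v (v ∷ [])
    cons   : ∀ {u w v vs} → Adj u w → IsWalk w v vs → IsWalk u v (u ∷ vs)

module Submission where

-- Colour the vertices with two colours. It is enough to find a colouring in which the aᵢ are
-- joined inside one colour class and b₁, b₂ inside the other: then let C be a maximal
-- connected set that contains the aᵢ and whose complement joins b₁ to b₂. Since G is
-- 3-connected, every other vertex outside C separates b₁ from b₂ there, so that the
-- complement of C is the vertex set of the required path.
--
-- The colouring is found for all "massed" graphs: a set X of at most α + 1 = m + 2 terminals,
-- more than α |U ∖ X| edges with an end outside X, and no such density behind fewer
-- than |X| vertices. In a minimal counterexample a set that can be coloured in every
-- way prescribed on its boundary, and is linked to X, yields a colouring. Hence no edge can be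
-- contracted without destroying density, and the neighbourhood of a vertex of small degree
-- is so dense that it is itself such a set.

-- Connectivity does not survive the deletion or contraction of an edge. Density does, unless a part
-- behind few vertices becomes too dense, and such a part can be put to use. The value α = m + 1
-- makes 2α the given connectivity; minimum degree 2α amounts to α edges per vertex.
--
-- For |X| = α + 1, density above α is not enough: one vertex joined to α + 1 independent terminals
-- meets α + 1 edges but joins only one colour. Hence the condition `Slack`. Replacing a rigid set
-- by a clique works because at most two terminals are labelled `false`: their class shrinks to a
-- path with at most two vertices in the clique.
--
-- In a minimal counterexample an edge count provides a vertex y outside X whose degree plus number
-- of neighbours in X is at most 2α + 1, or 2α in the joint case. As no edge at y can be contracted,
-- each neighbour of y shares about α neighbours with it, two terminals counting as adjacent.
-- Without such a y, either the counts conflict or two vertices outside X serve as hubs for the two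
-- colours.

open import Defs
open import Data.Bool using (Bool; true; false; T; _∧_; not) renaming (_≟_ to _≟ᵇ_)
open import Data.Empty using (⊥; ⊥-elim)
open import Data.Fin using (Fin; zero; suc) renaming (_≟_ to _≟ᶠ_)
open import Data.Fin.Properties using (any?; all?)
open import Data.Fin.Subset using (Subset)
open import Data.Fin.Subset.Properties using (anySubset?)
open import Data.List as List using (List; []; _∷_; _++_; length; filter; allFin)
open import Data.List.Membership.Propositional using () renaming (_∈_ to _∈ˡ_; _∉_ to _∉ˡ_)
open import Data.List.Membership.Propositional.Properties using (∈-filter⁺; ∈-filter⁻; ∈-allFin)
open import Data.List.Relation.Unary.All as All using (All; []; _∷_)
open import Data.List.Relation.Unary.AllPairs using ([]; _∷_)
open import Data.List.Relation.Unary.Any as Any using (Any; here; there)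
open import Data.List.Relation.Unary.Any.Properties using (++⁺ˡ; ++⁺ʳ)
open import Data.List.Relation.Unary.Unique.Propositional using (Unique)
open import Data.Nat using (ℕ; zero; suc; _+_; _*_; _≤_; _<_; z≤n; s≤s; _≤ᵇ_; _≤?_; _<?_)
open import Data.Nat.Properties
  using (≤-refl; ≤-trans; ≤-reflexive; ≤-antisym; ≤-pred; <⇒≤; <⇒≱; ≮⇒≥; ≰⇒>; <-irrefl; ≤ᵇ⇒≤; n≤1+n; m≤m+n; m≤n+m;
         +-mono-≤; *-mono-≤; *-monoʳ-≤; +-comm; +-suc; +-identityʳ; *-comm; *-identityʳ; *-zeroʳ; *-distribˡ-+; *-distribʳ-+;
         +-0-commutativeMonoid)
open import Data.Nat.Solver using (module +-*-Solver)
open import Data.Product using (Σ; ∃; _×_; _,_; proj₁; proj₂)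
open import Data.Sum using (_⊎_; inj₁; inj₂; [_,_]′)
open import Data.Unit using (⊤; tt)
open import Data.Vec using (Vec; []; _∷_; lookup; tabulate)
open import Data.Vec.Functional using (updateAt)
open import Data.Vec.Functional.Properties using (updateAt-updates; updateAt-minimal)
open import Data.Vec.Properties using (lookup∘tabulate)
open import Function using (_∘_; id; case_of_)
open import Function.Definitions using (Injective)
open import Relation.Binary.PropositionalEquality using (_≡_; _≢_; refl; sym; trans; cong; cong₂; subst; subst₂)
open import Relation.Nullary using (¬_; Dec; yes; no; does)
open import Relation.Nullary.Decidable using (_×-dec_; _⊎-dec_; _→-dec_; ¬?; map′)
open import Algebra.Properties.CommutativeMonoid.Sum +-0-commutativeMonoid using (sum; sum-cong-≗; ∑-distrib-+; ∑-comm)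
open +-*-Solver using (solve; _:=_; _:+_; _:*_; con)

-- Linear arithmetic

-- A system of inequalities is refuted by a nonnegative combination of them
-- in which every coefficient of the left side dominates.
data Lin (k : ℕ) : Set where
  var : Fin k → Lin k
  num : ℕ → Lin k
  _⊕_ : Lin k → Lin k → Lin k
  _⊛_ : ℕ → Lin k → Lin k

infixl 7 _⊕_
infixl 8 _⊛_

record Ineq (k : ℕ) : Set where
  constructor _·_≼_
  field
    weight : ℕ
    lhs rhs : Lin k

infix 6 _·_≼_ _≼_

pattern _≼_ l r = 1 · l ≼ r

module _ {k : ℕ} (ρ : Vec ℕ k) where

  ⟦_⟧ : Lin k → ℕ
  ⟦ var i ⟧ = lookup ρ i
  ⟦ num c ⟧ = c
  ⟦ a ⊕ b ⟧ = ⟦ a ⟧ + ⟦ b ⟧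
  ⟦ c ⊛ a ⟧ = c * ⟦ a ⟧

  All≼ : List (Ineq k) → Set
  All≼ [] = ⊤
  All≼ ((w · l ≼ r) ∷ hs) = (⟦ l ⟧ ≤ ⟦ r ⟧) × All≼ hs

coeff : ∀ {k} → Lin k → Fin k → ℕ
coeff (var i) j with i ≟ᶠ j
... | yes _ = 1
... | no _ = 0
coeff (num _) j = 0
coeff (a ⊕ b) j = coeff a j + coeff b j
coeff (c ⊛ a) j = c * coeff a j

const : ∀ {k} → Lin k → ℕ
const (var _) = 0
const (num c) = c
const (a ⊕ b) = const a + const b
const (c ⊛ a) = c * const a

dot : ∀ {k} → (Fin k → ℕ) → Vec ℕ k → ℕ
dot f [] = 0
dot f (x ∷ ρ) = f zero * x + dot (f ∘ suc) ρ

dot-zero : ∀ {k} (ρ : Vec ℕ k) → dot (λ _ → 0) ρ ≡ 0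
dot-zero [] = refl
dot-zero (x ∷ ρ) = dot-zero ρ

dot-+ : ∀ {k} (f g : Fin k → ℕ) ρ → dot (λ i → f i + g i) ρ ≡ dot f ρ + dot g ρ
dot-+ f g [] = refl
dot-+ f g (x ∷ ρ) rewrite dot-+ (f ∘ suc) (g ∘ suc) ρ =
  solve 5 (λ a b x p q → (a :+ b) :* x :+ (p :+ q) := (a :* x :+ p) :+ (b :* x :+ q)) refl
    (f zero) (g zero) x (dot (f ∘ suc) ρ) (dot (g ∘ suc) ρ)

dot-* : ∀ {k} c (f : Fin k → ℕ) ρ → dot (λ i → c * f i) ρ ≡ c * dot f ρ
dot-* c f [] = sym (*-zeroʳ c)
dot-* c f (x ∷ ρ) rewrite dot-* c (f ∘ suc) ρ =
  solve 4 (λ c a x p → c :* a :* x :+ c :* p := c :* (a :* x :+ p)) refl c (f zero) x (dot (f ∘ suc) ρ)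

dot-cong : ∀ {k} {f g : Fin k → ℕ} → (∀ i → f i ≡ g i) → ∀ ρ → dot f ρ ≡ dot g ρ
dot-cong e [] = refl
dot-cong e (x ∷ ρ) = cong₂ _+_ (cong (_* x) (e zero)) (dot-cong (e ∘ suc) ρ)

dot-mono : ∀ {k} {f g : Fin k → ℕ} → (∀ i → f i ≤ g i) → ∀ ρ → dot f ρ ≤ dot g ρ
dot-mono e [] = z≤n
dot-mono e (x ∷ ρ) = +-mono-≤ (*-mono-≤ (e zero) (≤-refl {x})) (dot-mono (e ∘ suc) ρ)

dot-var : ∀ {k} (i : Fin k) ρ → dot (coeff (var i)) ρ ≡ lookup ρ i
dot-var zero (x ∷ ρ) rewrite dot-cong {f = λ j → coeff (var zero) (suc j)} {g = λ _ → 0} (λ _ → refl) ρ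
                           | dot-zero ρ | +-identityʳ x = +-identityʳ x
dot-var (suc i) (x ∷ ρ) = trans (dot-cong aux ρ) (dot-var i ρ)
  where
  aux : ∀ j → coeff (var (suc i)) (suc j) ≡ coeff (var i) j
  aux j with i ≟ᶠ j
  ... | yes _ = refl
  ... | no _ = refl

⟦⟧-normal : ∀ {k} (ρ : Vec ℕ k) a → ⟦ ρ ⟧ a ≡ const a + dot (coeff a) ρ
⟦⟧-normal ρ (var i) = sym (dot-var i ρ)
⟦⟧-normal ρ (num c) = sym (trans (cong (c +_) (dot-zero ρ)) (+-identityʳ c))
⟦⟧-normal ρ (a ⊕ b) rewrite ⟦⟧-normal ρ a | ⟦⟧-normal ρ b | dot-+ (coeff a) (coeff b) ρ =
  solve 4 (λ a b c d → (a :+ b) :+ (c :+ d) := (a :+ c) :+ (b :+ d)) refl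
    (const a) (dot (coeff a) ρ) (const b) (dot (coeff b) ρ)
⟦⟧-normal ρ (c ⊛ a) rewrite ⟦⟧-normal ρ a | dot-* c (coeff a) ρ =
  *-distribˡ-+ c (const a) (dot (coeff a) ρ)

sumˡ sumʳ : ∀ {k} → List (Ineq k) → Lin k
sumˡ [] = num 0
sumˡ ((w · l ≼ r) ∷ hs) = w ⊛ l ⊕ sumˡ hs
sumʳ [] = num 0
sumʳ ((w · l ≼ r) ∷ hs) = w ⊛ r ⊕ sumʳ hs

sum-≼ : ∀ {k} (ρ : Vec ℕ k) hs → All≼ ρ hs → ⟦ ρ ⟧ (sumˡ hs) ≤ ⟦ ρ ⟧ (sumʳ hs)
sum-≼ ρ [] _ = z≤n
sum-≼ ρ ((w · l ≼ r) ∷ hs) (p , ps) = +-mono-≤ (*-monoʳ-≤ w p) (sum-≼ ρ hs ps)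

everyᵇ : ∀ {k} → (Fin k → Bool) → Bool
everyᵇ {zero} p = true
everyᵇ {suc k} p = p zero ∧ everyᵇ (p ∘ suc)

everyᵇ-sound : ∀ {k} (p : Fin k → Bool) → T (everyᵇ p) → ∀ i → T (p i)
everyᵇ-sound {suc k} p t i with p zero in eq
everyᵇ-sound {suc k} p t zero | true rewrite eq = tt
everyᵇ-sound {suc k} p t (suc i) | true = everyᵇ-sound (p ∘ suc) t i

refutes : ∀ {k} → List (Ineq k) → Bool
refutes hs = (suc (const (sumʳ hs)) ≤ᵇ const (sumˡ hs)) ∧ everyᵇ λ i → coeff (sumʳ hs) i ≤ᵇ coeff (sumˡ hs) i

∧-sound : ∀ a b → T (a ∧ b) → T a × T b
∧-sound true b t = tt , t

linarith : ∀ {k} (ρ : Vec ℕ k) hs → All≼ ρ hs → {T (refutes hs)} → ⊥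
linarith ρ hs ps {t} = <-irrefl refl (≤-trans lt (sum-≼ ρ hs ps))
  where
  ok = ∧-sound (suc (const (sumʳ hs)) ≤ᵇ const (sumˡ hs)) _ t
  lt : ⟦ ρ ⟧ (sumʳ hs) < ⟦ ρ ⟧ (sumˡ hs)
  lt = subst₂ _<_ (sym (⟦⟧-normal ρ (sumʳ hs))) (sym (⟦⟧-normal ρ (sumˡ hs)))
         (+-mono-≤ (≤ᵇ⇒≤ _ _ (proj₁ ok)) (dot-mono (λ i → ≤ᵇ⇒≤ _ _ (everyᵇ-sound _ (proj₂ ok) i)) ρ))

pattern v₀ = var zero
pattern v₁ = var (suc zero)
pattern v₂ = var (suc (suc zero))
pattern v₃ = var (suc (suc (suc zero)))
pattern v₄ = var (suc (suc (suc (suc zero))))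
pattern v₅ = var (suc (suc (suc (suc (suc zero)))))
pattern v₆ = var (suc (suc (suc (suc (suc (suc zero))))))
pattern v₇ = var (suc (suc (suc (suc (suc (suc (suc zero)))))))
pattern v₈ = var (suc (suc (suc (suc (suc (suc (suc (suc zero))))))))
pattern v₉ = var (suc (suc (suc (suc (suc (suc (suc (suc (suc zero)))))))))
pattern v₁₀ = var (suc (suc (suc (suc (suc (suc (suc (suc (suc (suc zero))))))))))

-- Sums, indicator functions and minima

sum-mono : ∀ {n} {f g : Fin n → ℕ} → (∀ i → f i ≤ g i) → sum f ≤ sum g
sum-mono {zero} h = z≤n
sum-mono {suc n} h = +-mono-≤ (h zero) (sum-mono (h ∘ suc))

sum-≥ : ∀ {n} (f : Fin n → ℕ) i → f i ≤ sum f
sum-≥ f zero = m≤m+n _ _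
sum-≥ f (suc i) = ≤-trans (sum-≥ (f ∘ suc) i) (m≤n+m _ (f zero))

sum-zero : ∀ n → sum {n} (λ _ → 0) ≡ 0
sum-zero zero = refl
sum-zero (suc n) = sum-zero n

sum-* : ∀ {n} c (f : Fin n → ℕ) → sum (λ i → c * f i) ≡ c * sum f
sum-* {zero} c f = sym (*-zeroʳ c)
sum-* {suc n} c f = trans (cong (c * f zero +_) (sum-* c (f ∘ suc))) (sym (*-distribˡ-+ c _ _))

sum-δ : ∀ {n} (x : Fin n) (g : Fin n → ℕ) (f : Fin n → ℕ) → f x ≡ g x → (∀ y → y ≢ x → f y ≡ 0) → sum f ≡ g x
sum-δ {suc n} zero g f e z = trans (cong₂ _+_ e (trans (sum-cong-≗ (λ i → z (suc i) λ ())) (sum-zero n))) (+-identityʳ _)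
sum-δ {suc n} (suc x) g f e z =
  trans (cong (_+ sum (f ∘ suc)) (z zero λ ())) (sum-δ x (g ∘ suc) (f ∘ suc) e λ y ne → z (suc y) λ { refl → ne refl })

χ : ∀ {ℓ} {P : Set ℓ} → Dec P → ℕ
χ (yes _) = 1
χ (no _) = 0

χ-mono : ∀ {a b} {A : Set a} {B : Set b} → (A → B) → (d : Dec A) (e : Dec B) → χ d ≤ χ e
χ-mono f (yes x) (yes _) = ≤-refl
χ-mono f (yes x) (no ¬b) = ⊥-elim (¬b (f x))
χ-mono f (no _) e = z≤n

χ-cover : ∀ {a b c} {A : Set a} {B : Set b} {D : Set c} →
          (A → B ⊎ D) → (d : Dec A) (e : Dec B) (g : Dec D) → χ d ≤ χ e + χ g
χ-cover f (no _) e g = z≤n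
χ-cover f (yes x) (yes _) g = s≤s z≤n
χ-cover f (yes x) (no _) (yes _) = ≤-refl
χ-cover f (yes x) (no ¬b) (no ¬c) = ⊥-elim ([ ¬b , ¬c ]′ (f x))

χ-pack : ∀ {a b c} {A : Set a} {B : Set b} {D : Set c} →
         (A → D) → (B → D) → (A → B → ⊥) → (d : Dec A) (e : Dec B) (g : Dec D) → χ d + χ e ≤ χ g
χ-pack f h ab (yes x) (yes y) g = ⊥-elim (ab x y)
χ-pack f h ab (yes x) (no _) g = χ-mono f (yes x) g
χ-pack f h ab (no _) e g = χ-mono h e g

χ-yes : ∀ {ℓ} {A : Set ℓ} (d : Dec A) → A → χ d ≡ 1
χ-yes (yes _) _ = refl
χ-yes (no ¬a) a = ⊥-elim (¬a a)

χ-no : ∀ {ℓ} {A : Set ℓ} (d : Dec A) → ¬ A → χ d ≡ 0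
χ-no (yes a) ¬a = ⊥-elim (¬a a)
χ-no (no _) _ = refl

-- Sparsity quantifies over all separations and is not decidable, so excluded middle is used with ⊥
-- as the goal. Nothing is lost, because `Sol?` decides whether a solution exists.
em : ∀ {ℓ} (A : Set ℓ) → (A ⊎ ¬ A → ⊥) → ⊥
em A k = k (inj₂ λ a → k (inj₁ a))

least : ∀ {ℓ ℓ′} {A : Set ℓ} {P : A → Set ℓ′} (size : A → ℕ) a → P a →
        (∀ a → P a → (∀ a′ → P a′ → size a ≤ size a′) → ⊥) → ⊥
least {A = A} {P} size a p k = go (size a) a p ≤-refl
  where
  go : ∀ j a → P a → size a ≤ j → ⊥
  down : ∀ j a → P a → size a < j → ⊥
  go j a p le = em (∀ a′ → P a′ → size a ≤ size a′) λ
    { (inj₁ m) → k a p m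
    ; (inj₂ nm) → nm λ a′ p′ → case size a ≤? size a′ of λ
        { (yes s) → s ; (no gt) → ⊥-elim (down j a′ p′ (≤-trans (≰⇒> gt) le)) } }
  down (suc j) a p lt = go j a p (≤-pred lt)

-- Counting

record DSet (n : ℕ) : Set₁ where
  constructor dset
  field
    mem : Fin n → Set
    dec : ∀ v → Dec (mem v)

open DSet public

infix 4 _∈_ _∉_ _⊆_

_∈_ _∉_ : ∀ {n} → Fin n → DSet n → Set
v ∈ P = mem P v
v ∉ P = ¬ v ∈ P

_⊆_ : ∀ {n} → DSet n → DSet n → Set
P ⊆ Q = ∀ {v} → v ∈ P → v ∈ Q

module _ {n : ℕ} where
  infixl 6 _∪_ _∖_
  infixl 7 _∩_

  _∪_ _∩_ _∖_ : DSet n → DSet n → DSet n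
  P ∪ Q = dset (λ v → v ∈ P ⊎ v ∈ Q) λ v → dec P v ⊎-dec dec Q v
  P ∩ Q = dset (λ v → v ∈ P × v ∈ Q) λ v → dec P v ×-dec dec Q v
  P ∖ Q = dset (λ v → v ∈ P × ¬ v ∈ Q) λ v → dec P v ×-dec ¬? (dec Q v)

  ⁅_⁆ : Fin n → DSet n
  ⁅ x ⁆ = dset (λ v → v ≡ x) (λ v → v ≟ᶠ x)

  χ# : DSet n → Fin n → ℕ
  χ# P v = χ (dec P v)

  # : DSet n → ℕ
  # P = sum (χ# P)

  #-mono : ∀ P Q → P ⊆ Q → # P ≤ # Q
  #-mono P Q h = sum-mono λ v → χ-mono h (dec P v) (dec Q v)

  #-cover : ∀ P Q R → P ⊆ Q ∪ R → # P ≤ # Q + # R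
  #-cover P Q R h = ≤-trans (sum-mono λ v → χ-cover h (dec P v) (dec Q v) (dec R v)) (≤-reflexive (∑-distrib-+ (χ# Q) (χ# R)))

  #-pack : ∀ P Q R → P ⊆ R → Q ⊆ R → (∀ {v} → v ∈ P → v ∈ Q → ⊥) → # P + # Q ≤ # R
  #-pack P Q R p q d = ≤-trans (≤-reflexive (sym (∑-distrib-+ (χ# P) (χ# Q)))) (sum-mono λ v → χ-pack p q d (dec P v) (dec Q v) (dec R v))

  #-⁅⁆ : ∀ x → # ⁅ x ⁆ ≡ 1
  #-⁅⁆ x = sum-δ x (λ _ → 1) _ (χ-yes (x ≟ᶠ x) refl) λ y ne → χ-no (y ≟ᶠ x) ne

  #-strict : ∀ P Q x → P ⊆ Q → x ∈ Q → x ∉ P → # P < # Q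
  #-strict P Q x h q np = subst (_≤ # Q) (cong (_+ # P) (#-⁅⁆ x)) (#-pack ⁅ x ⁆ P Q (λ { refl → q }) h λ { refl p → np p })

  #-insert : ∀ P x → # (P ∪ ⁅ x ⁆) ≤ 1 + # P
  #-insert P x = ≤-trans (#-cover (P ∪ ⁅ x ⁆) P ⁅ x ⁆ id) (≤-reflexive (trans (+-comm (# P) _) (cong (_+ # P) (#-⁅⁆ x))))

  #-one : ∀ P x → x ∈ P → 1 ≤ # P
  #-one P x p = subst (_≤ # P) (#-⁅⁆ x) (#-mono ⁅ x ⁆ P λ { refl → p })

  #-pair : ∀ P {x y} → x ∈ P → y ∈ P → x ≢ y → 2 ≤ # P
  #-pair P {x} {y} p q ne = subst₂ (λ i j → i + j ≤ # P) (#-⁅⁆ x) (#-⁅⁆ y)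
    (#-pack ⁅ x ⁆ ⁅ y ⁆ P (λ { refl → p }) (λ { refl → q }) λ { refl e → ne e })

  #-none : ∀ P → (∀ v → v ∉ P) → # P ≡ 0
  #-none P h = trans (sum-cong-≗ λ v → χ-no (dec P v) (h v)) (sum-zero n)

  #-subset : ∀ P Q → P ⊆ Q → # Q ≤ # P → Q ⊆ P
  #-subset P Q h le {v} q with dec P v
  ... | yes p = p
  ... | no np = ⊥-elim (<⇒≱ (#-strict P Q v h q np) le)

any-∈ : ∀ {n} (P : DSet n) → Dec (∃ λ v → v ∈ P)
any-∈ P = any? (dec P)

∖-empty : ∀ {n} (P Q : DSet n) → ¬ (∃ λ v → v ∈ P ∖ Q) → P ⊆ Q
∖-empty P Q none {v} p with dec Q v
... | yes q = q
... | no nq = ⊥-elim (none (v , p , nq))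

-- Counting edges

-- Only the entries above the diagonal are added, so that an edge of a symmetric relation counts
-- once and inequalities can be proved entry by entry.
half : ∀ {n} → (Fin n → Fin n → ℕ) → ℕ
half {zero} g = 0
half {suc n} g = sum (λ j → g zero (suc j)) + half (λ i j → g (suc i) (suc j))

half-mono : ∀ {n} {f g : Fin n → Fin n → ℕ} → (∀ i j → f i j ≤ g i j) → half f ≤ half g
half-mono {zero} h = z≤n
half-mono {suc n} h = +-mono-≤ (sum-mono λ j → h zero (suc j)) (half-mono λ i j → h (suc i) (suc j))

half-+ : ∀ {n} (f g : Fin n → Fin n → ℕ) → half (λ i j → f i j + g i j) ≡ half f + half g
half-+ {zero} f g = refl
half-+ {suc n} f g
  rewrite ∑-distrib-+ (λ j → f zero (suc j)) (λ j → g zero (suc j))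
        | half-+ (λ i j → f (suc i) (suc j)) (λ i j → g (suc i) (suc j)) =
  solve 4 (λ a b c d → (a :+ b) :+ (c :+ d) := (a :+ c) :+ (b :+ d)) refl
    (sum (λ j → f zero (suc j))) (sum (λ j → g zero (suc j)))
    (half (λ i j → f (suc i) (suc j))) (half (λ i j → g (suc i) (suc j)))

half-double : ∀ {n} (g : Fin n → Fin n → ℕ) → (∀ i j → g i j ≡ g j i) → (∀ i → g i i ≡ 0) →
              half g + half g ≡ sum (λ i → sum (g i))
half-double {zero} g s d = refl
half-double {suc n} g s d
  rewrite d zero
        | ∑-distrib-+ (λ i → g (suc i) zero) (λ i → sum (λ j → g (suc i) (suc j)))
        | sum-cong-≗ {n} {λ i → g (suc i) zero} {λ i → g zero (suc i)} (λ i → s (suc i) zero)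
        | sym (half-double (λ i j → g (suc i) (suc j)) (λ i j → s (suc i) (suc j)) (λ i → d (suc i))) =
  solve 2 (λ a h → (a :+ h) :+ (a :+ h) := a :+ (a :+ (h :+ h))) refl
    (sum (λ j → g zero (suc j))) (half (λ i j → g (suc i) (suc j)))

record DRel (n : ℕ) : Set₁ where
  constructor drel
  field
    rel  : Fin n → Fin n → Set
    rdec : ∀ a b → Dec (rel a b)

open DRel public

χ-cong : ∀ {A B : Set} → (A → B) → (B → A) → (d : Dec A) (e : Dec B) → χ d ≡ χ e
χ-cong f g d e = ≤-antisym (χ-mono f d e) (χ-mono g e d)

module _ {n : ℕ} where
  χᴿ : DRel n → Fin n → Fin n → ℕ
  χᴿ R a b = χ (rdec R a b)

  ε : DRel n → ℕ
  ε R = half (χᴿ R)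

  ε-mono : ∀ R S → (∀ {a b} → rel R a b → rel S a b) → ε R ≤ ε S
  ε-mono R S h = half-mono λ a b → χ-mono h (rdec R a b) (rdec S a b)

  ε-cover : ∀ R S S′ → (∀ {a b} → rel R a b → rel S a b ⊎ rel S′ a b) → ε R ≤ ε S + ε S′
  ε-cover R S S′ h = ≤-trans (half-mono λ a b → χ-cover h (rdec R a b) (rdec S a b) (rdec S′ a b))
                             (≤-reflexive (half-+ (χᴿ S) (χᴿ S′)))

  ε-pack : ∀ R R′ S → (∀ {a b} → rel R a b → rel S a b) → (∀ {a b} → rel R′ a b → rel S a b) →
           (∀ {a b} → rel R a b → rel R′ a b → ⊥) → ε R + ε R′ ≤ ε S
  ε-pack R R′ S p q d = ≤-trans (≤-reflexive (sym (half-+ (χᴿ R) (χᴿ R′))))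
                          (half-mono λ a b → χ-pack p q d (rdec R a b) (rdec R′ a b) (rdec S a b))

  ε-double : ∀ R → (∀ {a b} → rel R a b → rel R b a) → (∀ {a} → ¬ rel R a a) →
             ε R + ε R ≡ sum (λ a → sum (χᴿ R a))
  ε-double R s i = half-double (χᴿ R) (λ a b → χ-cong s s (rdec R a b) (rdec R b a)) (λ a → χ-no (rdec R a a) i)

  star : Fin n → DSet n → DRel n
  star x Q = drel (λ a b → (a ≡ x × b ∈ Q) ⊎ (b ≡ x × a ∈ Q))
                  (λ a b → (a ≟ᶠ x ×-dec dec Q b) ⊎-dec (b ≟ᶠ x ×-dec dec Q a))

  star-sym : ∀ {x Q a b} → rel (star x Q) a b → rel (star x Q) b a
  star-sym (inj₁ p) = inj₂ p
  star-sym (inj₂ p) = inj₁ p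

  -- Counting both orientations, x contributes |Q| as a row and |Q| as a column. This avoids
  -- comparing x with the vertices of Q in the order on which `half` depends.
  ε-star : ∀ x Q → x ∉ Q → ε (star x Q) ≡ # Q
  ε-star x Q nx = double-injective {ε (star x Q)} {# Q} (trans (ε-double (star x Q) (star-sym {x} {Q}) irr) total)
    where
    irr : ∀ {a} → ¬ rel (star x Q) a a
    irr (inj₁ (refl , q)) = nx q
    irr (inj₂ (refl , q)) = nx q
    double-injective : ∀ {a b} → a + a ≡ b + b → a ≡ b
    double-injective {a} {b} e = ≤-antisym (halve (≤-reflexive e)) (halve (≤-reflexive (sym e)))
      where
      halve : ∀ {a b} → a + a ≤ b + b → a ≤ b
      halve {a} {b} p = ≮⇒≥ λ lt → linarith (a ∷ b ∷ []) ((2 · num 1 ⊕ v₁ ≼ v₀) ∷ v₀ ⊕ v₀ ≼ v₁ ⊕ v₁ ∷ []) (lt , p , tt)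
    row₁ row₂ : Fin n → Fin n → ℕ
    row₁ a b = χ (a ≟ᶠ x ×-dec dec Q b)
    row₂ a b = χ (b ≟ᶠ x ×-dec dec Q a)
    split : ∀ a b → χᴿ (star x Q) a b ≡ row₁ a b + row₂ a b
    split a b = ≤-antisym (χ-cover id (rdec (star x Q) a b) d₁ d₂)
                          (χ-pack inj₁ inj₂ (λ { (refl , p) (refl , q) → nx p }) d₁ d₂ (rdec (star x Q) a b))
      where
      d₁ = a ≟ᶠ x ×-dec dec Q b
      d₂ = b ≟ᶠ x ×-dec dec Q a
    sum₁ : sum (λ a → sum (row₁ a)) ≡ # Q
    sum₁ = sum-δ x (λ _ → # Q) _
             (sum-cong-≗ λ b → χ-cong proj₂ (refl ,_) (x ≟ᶠ x ×-dec dec Q b) (dec Q b))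
             (λ y ne → trans (sum-cong-≗ λ b → χ-no (y ≟ᶠ x ×-dec dec Q b) λ p → ne (proj₁ p)) (sum-zero n))
    total : sum (λ a → sum (χᴿ (star x Q) a)) ≡ # Q + # Q
    total = trans (sum-cong-≗ λ a → trans (sum-cong-≗ (split a)) (∑-distrib-+ (row₁ a) (row₂ a)))
            (trans (∑-distrib-+ (λ a → sum (row₁ a)) (λ a → sum (row₂ a)))
            (cong₂ _+_ sum₁ (trans (∑-comm row₂) sum₁)))

-- Graphs with decidable adjacency and their density

record Gr (n : ℕ) : Set₁ where
  field
    E    : Fin n → Fin n → Set
    E?   : ∀ a b → Dec (E a b)
    esym : ∀ {a b} → E a b → E b a
    eirr : ∀ {a} → ¬ E a a

open Gr public

module _ {n : ℕ} where
  nbr : Gr n → DSet n → Fin n → DSet n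
  nbr G P z = dset (λ w → w ∈ P × E G z w) (λ w → dec P w ×-dec E? G z w)

  touching : DSet n → Gr n → DSet n → DRel n
  touching U G Z = drel (λ a b → (a ∈ U × b ∈ U) × (E G a b × (a ∈ Z ⊎ b ∈ Z)))
                        (λ a b → (dec U a ×-dec dec U b) ×-dec (E? G a b ×-dec (dec Z a ⊎-dec dec Z b)))

  ρ : DSet n → Gr n → DSet n → ℕ
  ρ U G Z = ε (touching U G Z)

  -- An edge inside Z is seen once from each end. An edge leaving Z is seen from one end only, but
  -- twice: its other end lies in U and also in U ∖ Z.
  ρ-degrees : ∀ U G Z → Z ⊆ U →
    ρ U G Z + ρ U G Z ≡ sum (λ z → χ# Z z * (# (nbr G U z) + # (nbr G (U ∖ Z) z)))
  ρ-degrees U G Z zu = trans (ε-double (touching U G Z) sy (λ p → eirr G (proj₁ (proj₂ p)))) total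
    where
    sy : ∀ {a b} → rel (touching U G Z) a b → rel (touching U G Z) b a
    sy ((p , q) , e , inj₁ z) = (q , p) , esym G e , inj₂ z
    sy ((p , q) , e , inj₂ z) = (q , p) , esym G e , inj₁ z
    row₁ row₂ : Fin n → Fin n → ℕ
    row₁ a b = χ# Z a * χ# (nbr G U a) b
    row₂ a b = χ# Z b * χ# (nbr G (U ∖ Z) b) a
    split : ∀ a b → χᴿ (touching U G Z) a b ≡ row₁ a b + row₂ a b
    split a b = go (dec Z a) (dec Z b)
      where
      one : ∀ {x y z} → x ≡ 1 → y ≡ z → x * y ≡ z
      one {y = y} refl refl = +-identityʳ y
      nil : ∀ {x y} → y ≡ 0 → x * y ≡ 0
      nil {x} refl = *-zeroʳ x
      none : ∀ {x} y → x ≡ 0 → x * y ≡ 0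
      none y refl = refl
      go : Dec (a ∈ Z) → Dec (b ∈ Z) → χᴿ (touching U G Z) a b ≡ row₁ a b + row₂ a b
      go (yes za) _ = sym (trans (cong₂ _+_
        (one (χ-yes (dec Z a) za) (χ-cong (λ p → (zu za , proj₁ p) , proj₂ p , inj₁ za) (λ p → proj₂ (proj₁ p) , proj₁ (proj₂ p))
                                          (dec (nbr G U a) b) (rdec (touching U G Z) a b)))
        (nil {χ# Z b} (χ-no (dec (nbr G (U ∖ Z) b) a) λ p → proj₂ (proj₁ p) za))) (+-identityʳ _))
      go (no za) (yes zb) = sym (cong₂ _+_ (none (χ# (nbr G U a) b) (χ-no (dec Z a) za))
        (one (χ-yes (dec Z b) zb) (χ-cong (λ p → (proj₁ (proj₁ p) , zu zb) , esym G (proj₂ p) , inj₂ zb)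
                                          (λ p → (proj₁ (proj₁ p) , za) , esym G (proj₁ (proj₂ p)))
                                          (dec (nbr G (U ∖ Z) b) a) (rdec (touching U G Z) a b))))
      go (no za) (no zb) = trans (χ-no (rdec (touching U G Z) a b) λ p → [ za , zb ]′ (proj₂ (proj₂ p)))
        (sym (cong₂ _+_ (none (χ# (nbr G U a) b) (χ-no (dec Z a) za)) (none (χ# (nbr G (U ∖ Z) b) a) (χ-no (dec Z b) zb))))
    total : sum (λ a → sum (χᴿ (touching U G Z) a)) ≡ sum (λ z → χ# Z z * (# (nbr G U z) + # (nbr G (U ∖ Z) z)))
    total = trans (sum-cong-≗ λ a → trans (sum-cong-≗ (split a)) (∑-distrib-+ (row₁ a) (row₂ a)))
           (trans (∑-distrib-+ (λ a → sum (row₁ a)) (λ a → sum (row₂ a)))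
           (trans (cong (sum (λ a → sum (row₁ a)) +_) (∑-comm row₂))
           (trans (sym (∑-distrib-+ (λ a → sum (row₁ a)) (λ b → sum (λ a → row₂ a b))))
           (sum-cong-≗ λ z → trans (cong₂ _+_ (sum-* (χ# Z z) (χ# (nbr G U z))) (sum-* (χ# Z z) (χ# (nbr G (U ∖ Z) z))))
              (sym (*-distribˡ-+ (χ# Z z) (# (nbr G U z)) (# (nbr G (U ∖ Z) z))))))))

-- Walks and colourings

module _ {n : ℕ} where

  infixr 5 _++ʷ_

  data Walk (G : Gr n) (P : DSet n) : Fin n → Fin n → Set where
    here : ∀ {x} → x ∈ P → Walk G P x x
    step : ∀ {x y z} → x ∈ P → E G x y → Walk G P y z → Walk G P x z

  walk-start : ∀ {G P x y} → Walk G P x y → x ∈ P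
  walk-start (here p) = p
  walk-start (step p _ _) = p

  walk-end : ∀ {G P x y} → Walk G P x y → y ∈ P
  walk-end (here p) = p
  walk-end (step _ _ w) = walk-end w

  _++ʷ_ : ∀ {G P x y z} → Walk G P x y → Walk G P y z → Walk G P x z
  here _ ++ʷ v = v
  step p e w ++ʷ v = step p e (w ++ʷ v)

  edge : ∀ {G P x y} → x ∈ P → y ∈ P → E G x y → Walk G P x y
  edge p q e = step p e (here q)

  reverseʷ : ∀ {G P x y} → Walk G P x y → Walk G P y x
  reverseʷ (here p) = here p
  reverseʷ {G} (step p e w) = reverseʷ w ++ʷ edge (walk-start w) p (esym G e)

  walk-bind : ∀ {G G′ P Q x y} → P ⊆ Q → (∀ {a b} → a ∈ P → b ∈ P → E G a b → Walk G′ Q a b) →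
              Walk G P x y → Walk G′ Q x y
  walk-bind pq f (here p) = here (pq p)
  walk-bind pq f (step p e w) = f p (walk-start w) e ++ʷ walk-bind pq f w

  walk-⊆ : ∀ {G P Q x y} → P ⊆ Q → Walk G P x y → Walk G Q x y
  walk-⊆ pq (here p) = here (pq p)
  walk-⊆ pq (step p e w) = step (pq p) e (walk-⊆ pq w)

  walk-closed : ∀ {G P x y} (Q : DSet n) → (∀ {a b} → a ∈ Q → b ∈ P → E G a b → b ∈ Q) →
                x ∈ Q → Walk G P x y → Walk G (P ∩ Q) x y
  walk-closed Q cl q (here p) = here (p , q)
  walk-closed Q cl q (step p e w) = step (p , q) e (walk-closed Q cl (cl q (walk-start w) e) w)

  last-exit : ∀ {G P} K {x y} → Walk G P x y →
              Walk G (P ∖ K) x y ⊎ (∃ λ t → t ∈ K × Walk G (P ∖ K ∪ ⁅ t ⁆) t y × t ∈ P)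
  last-exit K {x} (here p) with dec K x
  ... | yes k = inj₂ (x , k , here (inj₂ refl) , p)
  ... | no nk = inj₁ (here (p , nk))
  last-exit K {x} (step p e w) with last-exit K w
  ... | inj₂ r = inj₂ r
  ... | inj₁ w′ with dec K x
  ... | yes k = inj₂ (x , k , step (inj₂ refl) e (walk-⊆ inj₁ w′) , p)
  ... | no nk = inj₁ (step (p , nk) e w′)

  -- Cut at the last visit to x, the rest of the walk lives in a smaller set. This drives the
  -- recursion that decides `Walk` and the one that extracts a simple path.
  walk-unfold : ∀ {G P x y} → Walk G P x y → x ≡ y ⊎ (∃ λ z → E G x z × Walk G (P ∖ ⁅ x ⁆) z y)
  walk-unfold {G} {P} {x} {y} w = go w (last-exit ⁅ x ⁆ w)
    where
    go : Walk G P x y → Walk G (P ∖ ⁅ x ⁆) x y ⊎ (∃ λ t → t ∈ ⁅ x ⁆ × Walk G (P ∖ ⁅ x ⁆ ∪ ⁅ t ⁆) t y × t ∈ P) →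
         x ≡ y ⊎ (∃ λ z → E G x z × Walk G (P ∖ ⁅ x ⁆) z y)
    go w (inj₁ v) = ⊥-elim (proj₂ (walk-start v) refl)
    go w (inj₂ (.x , refl , v , _)) = strip v
      where
      Q = P ∖ ⁅ x ⁆ ∪ ⁅ x ⁆
      clean : ∀ {a} → Walk G Q a y → Walk G (P ∖ ⁅ x ⁆) a y ⊎ (x ≡ y ⊎ (∃ λ z → E G x z × Walk G (P ∖ ⁅ x ⁆) z y))
      clean (here (inj₁ p)) = inj₁ (here p)
      clean (here (inj₂ refl)) = inj₂ (inj₁ refl)
      clean (step p e u) with clean u
      ... | inj₂ r = inj₂ r
      clean (step (inj₁ p) e u) | inj₁ u′ = inj₁ (step p e u′)
      clean (step (inj₂ refl) e u) | inj₁ u′ = inj₂ (inj₂ (_ , e , u′))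
      strip : Walk G Q x y → x ≡ y ⊎ (∃ λ z → E G x z × Walk G (P ∖ ⁅ x ⁆) z y)
      strip u with clean u
      ... | inj₁ u′ = ⊥-elim (proj₂ (walk-start u′) refl)
      ... | inj₂ r = r

  walk? : ∀ G P x y → Dec (Walk G P x y)
  walk? G P x y = go (# P) P x y ≤-refl
    where
    go : ∀ k P x y → # P ≤ k → Dec (Walk G P x y)
    go k P x y le with dec P x
    ... | no np = no λ w → np (walk-start w)
    go zero P x y le | yes p = ⊥-elim (<⇒≱ (#-one P x p) le)
    go (suc k) P x y le | yes p with x ≟ᶠ y
    ... | yes refl = yes (here p)
    ... | no ne with any? (λ z → E? G x z ×-dec go k (P ∖ ⁅ x ⁆) z y (≤-pred (≤-trans (#-strict (P ∖ ⁅ x ⁆) P x proj₁ p λ q → proj₂ q refl) le)))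
    ... | yes (z , e , w) = yes (step p e (walk-⊆ proj₁ w))
    ... | no nw = no λ w → [ ne , nw ]′ (walk-unfold w)

  reach : Gr n → DSet n → Fin n → DSet n
  reach G P x = dset (Walk G P x) (walk? G P x)

  -- The label true stands for the vertices aᵢ, false for b₁ and b₂. A colouring solves a
  -- labelling f of S if equally labelled vertices of S are joined within their colour class.
  class : DSet n → (Fin n → Bool) → Bool → DSet n
  class B c β = dset (λ v → v ∈ B × c v ≡ β) (λ v → dec B v ×-dec c v ≟ᵇ β)

  Solves : DSet n → Gr n → DSet n → (Fin n → Bool) → (Fin n → Bool) → Set
  Solves B G S f c = (∀ x → x ∈ S → c x ≡ f x) ×
                     (∀ x y → x ∈ S → y ∈ S → f x ≡ f y → Walk G (class B c (f x)) x y)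

  record Sol (B : DSet n) (G : Gr n) (S : DSet n) (f : Fin n → Bool) : Set where
    constructor solution
    field
      colour : Fin n → Bool
      solves : Solves B G S f colour

  Sol? : ∀ B G S f → Dec (Sol B G S f)
  Sol? B G S f = map′ (λ { (s , p) → solution (lookup s) p })
                      (λ { (solution c p) → tabulate c , resp c p })
                      (anySubset? λ s → solves? (lookup s))
    where
    solves? : ∀ c → Dec (Solves B G S f c)
    solves? c = all? (λ x → imp (dec S x) (c x ≟ᵇ f x)) ×-dec
                all? (λ x → all? λ y → imp (dec S x) (imp (dec S y) (imp (f x ≟ᵇ f y) (walk? G (class B c (f x)) x y))))
      where
      imp : ∀ {A B : Set} → Dec A → Dec B → Dec (A → B)
      imp a b = a →-dec b
    resp : ∀ c → Solves B G S f c → Solves B G S f (lookup (tabulate c))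
    resp c (a , j) = (λ x s → trans (lookup∘tabulate c x) (a x s)) ,
      λ x y s t e → walk-⊆ (λ { {v} (b , k) → b , trans (lookup∘tabulate c v) k }) (j x y s t e)

  -- The vertices b₁ and b₂ may coincide or lie outside S, so the property passes to subsets and
  -- along linkages to other terminal sets.
  Lab : DSet n → (Fin n → Bool) → Set
  Lab S f = ∃ λ b₁ → ∃ λ b₂ → ∀ {x} → x ∈ S → f x ≡ false → x ≡ b₁ ⊎ x ≡ b₂

  Rigid : DSet n → Gr n → DSet n → Set
  Rigid B G S = ∀ f → Lab S f → Sol B G S f

  Clique : Gr n → DSet n → Set
  Clique G K = ∀ {a b} → a ∈ K → b ∈ K → a ≢ b → E G a b

  AtMost2 : DSet n → Set
  AtMost2 Q = ∃ λ s → ∃ λ t → ∀ {v} → v ∈ Q → v ≡ s ⊎ v ≡ t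

  -- A walk that starts in K jumps along a clique edge to its last vertex in K and avoids K from
  -- then on; one that starts outside K is first followed until it enters K.
  shortcut : ∀ {G P K x y} → Clique G K → Walk G P x y →
             Σ (DSet n) λ Q → Q ⊆ P × Walk G Q x y × AtMost2 (K ∩ Q)
  shortcut {x = x} cl (here p) = ⁅ x ⁆ , (λ { refl → p }) , here refl , x , x , λ q → inj₁ (proj₂ q)
  shortcut {P = P} {K} {x} cl (step p e w) with dec K x
  ... | no nk with shortcut {P = P} {K} cl w
  ... | Q , qp , v , s , t , h =
    Q ∪ ⁅ x ⁆ , (λ { (inj₁ q) → qp q ; (inj₂ refl) → p }) , step (inj₂ refl) e (walk-⊆ inj₁ v) ,
    s , t , λ { (k , inj₁ q) → h (k , q) ; (k , inj₂ refl) → ⊥-elim (nk k) }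
  shortcut {P = P} {K} {x} cl (step p e w) | yes k with last-exit K w
  ... | inj₁ v = P ∖ K ∪ ⁅ x ⁆ , (λ { (inj₁ q) → proj₁ q ; (inj₂ refl) → p }) , step (inj₂ refl) e (walk-⊆ inj₁ v) ,
    x , x , λ { (k , inj₁ q) → ⊥-elim (proj₂ q k) ; (_ , inj₂ r) → inj₁ r }
  ... | inj₂ (t , kt , v , tp) with x ≟ᶠ t
  ... | yes refl = P ∖ K ∪ ⁅ x ⁆ , (λ { (inj₁ q) → proj₁ q ; (inj₂ refl) → p }) , v ,
    x , x , λ { (k , inj₁ q) → ⊥-elim (proj₂ q k) ; (_ , inj₂ r) → inj₁ r }
  ... | no ne = P ∖ K ∪ ⁅ t ⁆ ∪ ⁅ x ⁆ , (λ { (inj₁ (inj₁ q)) → proj₁ q ; (inj₁ (inj₂ refl)) → tp ; (inj₂ refl) → p }) ,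
    step (inj₂ refl) (cl k kt ne) (walk-⊆ inj₁ v) ,
    x , t , λ { (k , inj₁ (inj₁ q)) → ⊥-elim (proj₂ q k) ; (_ , inj₁ (inj₂ r)) → inj₂ r ; (_ , inj₂ r) → inj₁ r }

  outside : DSet n → Fin n → Bool
  outside Q v = not (does (dec Q v))

  outside-true : ∀ Q {v} → v ∉ Q → outside Q v ≡ true
  outside-true Q {v} nq with dec Q v
  ... | yes q = ⊥-elim (nq q)
  ... | no _ = refl

  outside-false : ∀ Q {v} → v ∈ Q → outside Q v ≡ false
  outside-false Q {v} q with dec Q v
  ... | yes _ = refl
  ... | no nq = ⊥-elim (nq q)

  outside-false⁻ : ∀ Q {v} → outside Q v ≡ false → v ∈ Q
  outside-false⁻ Q {v} e with dec Q v
  ... | yes q = q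
  ... | no _ with () ← e

  -- The second colour class is replaced by a path that meets the clique K at most twice,
  -- so that the colouring labels K with at most two vertices false.
  normalise : ∀ {D G Y K} f → Clique G K → Lab Y f → Sol D G Y f →
              ∃ λ c → Solves D G Y f c × Lab K c
  normalise {D} {G} {Y} {K} f cl (b₁ , b₂ , lab) (solution c (agr , joi)) = finish core
    where
    F = dset (λ v → v ∈ Y × f v ≡ false) (λ v → dec Y v ×-dec f v ≟ᵇ false)
    Core = Σ (DSet n) λ Q → Q ⊆ class D c false × F ⊆ Q ×
             (∀ {x y} → x ∈ F → y ∈ F → Walk G Q x y) × AtMost2 (K ∩ Q)
    lone : ∀ b → (∀ {x} → x ∈ F → x ≡ b) → Core
    lone b h = F , (λ q → walk-start (subst (λ β → Walk G (class D c β) _ _) (proj₂ q) (joi _ _ (proj₁ q) (proj₁ q) refl))) , id ,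
      (λ { x∈ y∈ → subst (Walk G F _) (trans (h x∈) (sym (h y∈))) (here x∈) }) ,
      b , b , λ q → inj₁ (h (proj₂ q))
    core : Core
    core with dec F b₁ | dec F b₂
    ... | no n₁ | _ = lone b₂ λ q → [ (λ { refl → ⊥-elim (n₁ q) }) , id ]′ (lab (proj₁ q) (proj₂ q))
    ... | yes _ | no n₂ = lone b₁ λ q → [ id , (λ { refl → ⊥-elim (n₂ q) }) ]′ (lab (proj₁ q) (proj₂ q))
    ... | yes (y₁ , f₁) | yes (y₂ , f₂)
      with shortcut {P = class D c false} {K} cl (subst (λ β → Walk G (class D c β) b₁ b₂) f₁ (joi b₁ b₂ y₁ y₂ (trans f₁ (sym f₂))))
    ... | Q , qp , w , am = Q , qp , (λ q → ends (lab (proj₁ q) (proj₂ q))) ,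
      (λ x∈ y∈ → toB₁ (lab (proj₁ x∈) (proj₂ x∈)) ++ʷ reverseʷ (toB₁ (lab (proj₁ y∈) (proj₂ y∈)))) , am
      where
      ends : ∀ {v} → v ≡ b₁ ⊎ v ≡ b₂ → v ∈ Q
      ends (inj₁ refl) = walk-start w
      ends (inj₂ refl) = walk-end w
      toB₁ : ∀ {v} → v ≡ b₁ ⊎ v ≡ b₂ → Walk G Q v b₁
      toB₁ (inj₁ refl) = here (walk-start w)
      toB₁ (inj₂ refl) = reverseʷ w
    finish : Core → ∃ λ c → Solves D G Y f c × Lab K c
    finish (Q , qc , fq , joined , s , t , am) = outside Q , (agr′ , joi′) ,
      s , t , λ k e → am (k , outside-false⁻ Q e)
      where
      avoid : ∀ {v} → c v ≡ true → v ∉ Q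
      avoid e q with () ← trans (sym e) (proj₂ (qc q))
      agr′ : ∀ x → x ∈ Y → outside Q x ≡ f x
      agr′ x y with f x in e
      ... | true = outside-true Q (avoid (trans (agr x y) e))
      ... | false = outside-false Q (fq (y , e))
      joi′ : ∀ x y → x ∈ Y → y ∈ Y → f x ≡ f y → Walk G (class D (outside Q) (f x)) x y
      joi′ x y p q e with f x in ex | joi x y p q
      ... | true | w = walk-⊆ (λ r → proj₁ r , outside-true Q (avoid (proj₂ r))) (w e)
      ... | false | _ = walk-⊆ (λ r → proj₁ (qc r) , outside-false Q r) (joined (p , ex) (q , sym e))

  torso : Gr n → DSet n → Gr n
  torso G S = record
    { E = λ a b → E G a b ⊎ (a ≢ b × a ∈ S × b ∈ S)
    ; E? = λ a b → E? G a b ⊎-dec (¬? (a ≟ᶠ b) ×-dec dec S a ×-dec dec S b)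
    ; esym = λ { (inj₁ e) → inj₁ (esym G e) ; (inj₂ (ne , p , q)) → inj₂ ((λ e → ne (sym e)) , q , p) }
    ; eirr = λ { (inj₁ e) → eirr G e ; (inj₂ (ne , _)) → ne refl } }

  -- After `normalise` the colouring of the torso labels at most two vertices of S `false`, so the
  -- rigid set can answer it. An added edge of S is then replaced by a walk of the same colour
  -- through Z ∪ S.
  simulate : ∀ {D Z S G Y} f → Rigid (Z ∪ S) G S → (∀ {v} → v ∈ D → v ∉ Z) → S ⊆ D → Y ⊆ D → Lab Y f →
             Sol D (torso G S) Y f → Sol (D ∪ Z) G Y f
  simulate {D} {Z} {S} {G} {Y} f rig dz sd yd lab sol
    with normalise {D} {torso G S} {Y} {S} f (λ p q ne → inj₂ (ne , p , q)) lab sol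
  ... | c , (agr , joi) , labS with rig c labS
  ... | solution d (agrS , joiS) = solution e ((λ x y → trans (onD (yd y)) (agr x y)) , λ x y p q eq → lift {f x} (joi x y p q eq))
    where
    e : Fin n → Bool
    e v with dec Z v
    ... | yes _ = d v
    ... | no _ = c v
    onD : ∀ {v} → v ∈ D → e v ≡ c v
    onD {v} vd with dec Z v
    ... | yes z = ⊥-elim (dz vd z)
    ... | no _ = refl
    onB : ∀ {v} → v ∈ Z ∪ S → e v ≡ d v
    onB {v} vb with dec Z v
    ... | yes _ = refl
    onB (inj₁ z) | no nz = ⊥-elim (nz z)
    onB (inj₂ s) | no nz = sym (agrS _ s)
    lift : ∀ {β x y} → Walk (torso G S) (class D c β) x y → Walk G (class (D ∪ Z) e β) x y
    lift {β} = walk-bind (λ p → inj₁ (proj₁ p) , trans (onD (proj₁ p)) (proj₂ p)) conv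
      where
      conv : ∀ {a b} → a ∈ class D c β → b ∈ class D c β → E (torso G S) a b → Walk G (class (D ∪ Z) e β) a b
      conv p q (inj₁ g) = edge (inj₁ (proj₁ p) , trans (onD (proj₁ p)) (proj₂ p)) (inj₁ (proj₁ q) , trans (onD (proj₁ q)) (proj₂ q)) g
      conv {a} {b} p q (inj₂ (_ , sa , sb)) =
        walk-⊆ (λ { (bs , k) → [ inj₂ , (λ s → inj₁ (sd s)) ]′ bs , trans (onB bs) (trans k (proj₂ p)) })
          (joiS a b sa sb (trans (proj₂ p) (sym (proj₂ q))))

-- Disjoint paths

module _ {n : ℕ} where

  #-inj : ∀ (P Q : DSet n) (g : Fin n → Fin n) → (∀ {v} → v ∈ P → g v ∈ Q) →
          (∀ {u v} → u ∈ P → v ∈ P → g u ≡ g v → u ≡ v) → # P ≤ # Q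
  #-inj P Q g into inj = ≤-trans (sum-mono row) (≤-trans (≤-reflexive (∑-comm cell)) (sum-mono col))
    where
    fibre : Fin n → DSet n
    fibre w = dset (λ v → v ∈ P × w ≡ g v) (λ v → dec P v ×-dec w ≟ᶠ g v)
    cell : Fin n → Fin n → ℕ
    cell v w = χ# (fibre w) v
    row : ∀ v → χ# P v ≤ sum (cell v)
    row v = ≤-trans (χ-mono (λ p → p , refl) (dec P v) (dec (fibre (g v)) v)) (sum-≥ (cell v) (g v))
    col : ∀ w → # (fibre w) ≤ χ# Q w
    col w with any-∈ (fibre w)
    ... | no none = ≤-trans (≤-reflexive (#-none (fibre w) λ v p → none (v , p))) z≤n
    ... | yes (v , p , refl) = ≤-trans (#-mono (fibre w) ⁅ v ⁆ λ q → inj (proj₁ q) p (sym (proj₂ q)))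
                                 (≤-reflexive (trans (#-⁅⁆ v) (sym (χ-yes (dec Q (g v)) (into p)))))

  first-hit : ∀ {G : Gr n} {P} K {x y} → Walk G P x y →
              Walk G (P ∖ K) x y ⊎ (x ∈ K ⊎ (∃ λ s → ∃ λ t → Walk G (P ∖ K) x s × E G s t × t ∈ K × t ∈ P))
  first-hit K {x} (here p) with dec K x
  ... | yes k = inj₂ (inj₁ k)
  ... | no nk = inj₁ (here (p , nk))
  first-hit K {x} (step p e w) with dec K x | first-hit K w
  ... | yes k | _ = inj₂ (inj₁ k)
  ... | no nk | inj₁ v = inj₁ (step (p , nk) e v)
  ... | no nk | inj₂ (inj₁ k) = inj₂ (inj₂ (_ , _ , here (p , nk) , e , k , walk-start w))
  ... | no nk | inj₂ (inj₂ (s , t , v , r)) = inj₂ (inj₂ (s , t , step (p , nk) e v , r))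

  module _ (G : Gr n) where

    -- Disjoint paths from X to Y, given by the vertices on them and the source of the path
    -- through each of these.
    record Linkage (A X Y : DSet n) : Set₁ where
      field
        on    : DSet n
        src   : Fin n → Fin n
        end   : Fin n → Fin n
      thread : Fin n → DSet n
      thread x = dset (λ v → v ∈ on × src v ≡ x) (λ v → dec on v ×-dec src v ≟ᶠ x)
      field
        on⊆   : on ⊆ A
        start : ∀ {x} → x ∈ X → x ∈ on × src x ≡ x
        src∈  : ∀ {v} → v ∈ on → src v ∈ X
        end∈  : ∀ {x} → x ∈ X → end x ∈ Y
        path  : ∀ {x} → x ∈ X → Walk G (thread x) x (end x)
        only  : ∀ {v} → v ∈ on → v ∈ Y → v ≡ end (src v)

    Separates : (A X Y T : DSet n) → Set
    Separates A X Y T = ∀ {x y} → x ∈ X → y ∈ Y → Walk G (A ∖ T) x y → ⊥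

    link-refl : ∀ {A X Y} → X ⊆ A → X ⊆ Y → Linkage A X Y
    link-refl {A} {X} xa xy = record
      { on = X ; src = id ; end = id ; on⊆ = xa ; start = λ p → p , refl ; src∈ = id ; end∈ = xy
      ; path = λ p → here (p , refl) ; only = λ _ _ → refl }

    link-extend : ∀ {A X Y} x z → x ∈ A → x ∈ X → x ∉ Y → z ∉ X → E G x z →
                  Linkage (A ∖ ⁅ x ⁆) (X ∖ ⁅ x ⁆ ∪ ⁅ z ⁆) Y → Linkage A X Y
    link-extend {A} {X} {Y} x z xa xX xY zX e L = record
      { on = on ∪ ⁅ x ⁆ ; src = src′ ; end = end′
      ; on⊆ = λ { (inj₁ p) → proj₁ (on⊆ p) ; (inj₂ refl) → xa }
      ; start = start′
      ; src∈ = λ { (inj₁ p) → src∈′ p ; (inj₂ refl) → subst (_∈ X) (sym src-x) xX }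
      ; end∈ = end∈′
      ; path = path′
      ; only = only′ }
      where
      open Linkage L
      back src′ end′ : Fin n → Fin n
      back = updateAt id z (λ _ → x)
      src′ = updateAt (back ∘ src) x (λ _ → x)
      end′ = updateAt end x (λ _ → end z)
      src-x : src′ x ≡ x
      src-x = updateAt-updates x (back ∘ src)
      end-x : end′ x ≡ end z
      end-x = updateAt-updates x end
      end-other : ∀ {v} → v ≢ x → end′ v ≡ end v
      end-other {v} = updateAt-minimal v x end
      src-on : ∀ {v} → v ∈ on → src′ v ≡ back (src v)
      src-on {v} p = updateAt-minimal v x (back ∘ src) λ { refl → proj₂ (on⊆ p) refl }
      back-z : back z ≡ x
      back-z = updateAt-updates z id
      back-X : ∀ {w} → w ∈ X → back w ≡ w
      back-X {w} p = updateAt-minimal w z id λ { refl → zX p }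
      start′ : ∀ {v} → v ∈ X → v ∈ on ∪ ⁅ x ⁆ × src′ v ≡ v
      start′ {v} p with v ≟ᶠ x
      ... | yes refl = inj₂ refl , src-x
      ... | no ne = inj₁ (proj₁ s) , trans (src-on (proj₁ s)) (trans (cong back (proj₂ s)) (back-X p))
        where s = start (inj₁ (p , ne))
      src∈′ : ∀ {v} → v ∈ on → src′ v ∈ X
      src∈′ {v} p = subst (_∈ X) (sym (src-on p)) (go (src∈ p))
        where
        go : ∀ {w} → w ∈ X ∖ ⁅ x ⁆ ∪ ⁅ z ⁆ → back w ∈ X
        go (inj₁ q) = subst (_∈ X) (sym (back-X (proj₁ q))) (proj₁ q)
        go (inj₂ refl) = subst (_∈ X) (sym back-z) xX
      end∈′ : ∀ {v} → v ∈ X → end′ v ∈ Y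
      end∈′ {v} p with v ≟ᶠ x
      ... | yes refl = subst (_∈ Y) (sym end-x) (end∈ (inj₂ refl))
      ... | no ne = subst (_∈ Y) (sym (end-other ne)) (end∈ (inj₁ (p , ne)))
      thread′ : Fin n → DSet n
      thread′ y = dset (λ v → v ∈ on ∪ ⁅ x ⁆ × src′ v ≡ y) (λ v → dec (on ∪ ⁅ x ⁆) v ×-dec src′ v ≟ᶠ y)
      path′ : ∀ {v} → v ∈ X → Walk G (thread′ v) v (end′ v)
      path′ {v} p with v ≟ᶠ x
      ... | yes refl = subst (Walk G (thread′ x) x) (sym end-x) (step (inj₂ refl , src-x) e
            (walk-⊆ (λ q → inj₁ (proj₁ q) , trans (src-on (proj₁ q)) (trans (cong back (proj₂ q)) back-z)) (path (inj₂ refl))))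
      ... | no ne = subst (Walk G (thread′ v) v) (sym (end-other ne))
            (walk-⊆ (λ q → inj₁ (proj₁ q) , trans (src-on (proj₁ q)) (trans (cong back (proj₂ q)) (back-X p))) (path (inj₁ (p , ne))))
      only′ : ∀ {v} → v ∈ on ∪ ⁅ x ⁆ → v ∈ Y → v ≡ end′ (src′ v)
      only′ (inj₂ refl) y = ⊥-elim (xY y)
      only′ {v} (inj₁ p) y = trans (only p y) (trans (go (src∈ p)) (cong end′ (sym (src-on p))))
        where
        go : ∀ {w} → w ∈ X ∖ ⁅ x ⁆ ∪ ⁅ z ⁆ → end w ≡ end′ (back w)
        go (inj₁ q) = trans (sym (end-other (proj₂ q))) (cong end′ (sym (back-X (proj₁ q))))
        go (inj₂ refl) = trans (sym end-x) (cong end′ (sym back-z))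

    -- One linkage lies in C ∪ T and the other outside C, so they meet only in T and the glued paths
    -- stay disjoint. Of the second, only the paths that start on the first are kept.
    link-trans : ∀ {A C X T Y} → (∀ {v} → v ∈ T → v ∉ C) → (∀ {v} → v ∈ Y → v ∉ C) → C ⊆ A → T ⊆ A →
                 Linkage (C ∪ T) X T → Linkage (A ∖ C) T Y → Linkage A X Y
    link-trans {A} {C} {X} {T} {Y} tc yc ca ta L R = record
      { on = on′ ; src = src′ ; end = λ v → R.end (L.end v)
      ; on⊆ = λ { (inj₁ p) → ca (proj₁ p) ; (inj₂ p) → proj₁ (R.on⊆ (proj₁ p)) }
      ; start = start′
      ; src∈ = src∈′
      ; end∈ = λ p → R.end∈ (L.end∈ p)
      ; path = λ p → walk-⊆ (first p) (L.path p) ++ʷ walk-⊆ (second p) (R.path (L.end∈ p))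
      ; only = only′ }
      where
      module L = Linkage L
      module R = Linkage R
      on′ : DSet n
      on′ = (C ∩ L.on) ∪ dset (λ v → v ∈ R.on × R.src v ∈ L.on) (λ v → dec R.on v ×-dec dec L.on (R.src v))
      src′ : Fin n → Fin n
      src′ v with dec C v
      ... | yes _ = L.src v
      ... | no _ = L.src (R.src v)
      src-C : ∀ {v} → v ∈ C → src′ v ≡ L.src v
      src-C {v} p with dec C v
      ... | yes _ = refl
      ... | no np = ⊥-elim (np p)
      src-R : ∀ {v} → v ∉ C → src′ v ≡ L.src (R.src v)
      src-R {v} np with dec C v
      ... | yes p = ⊥-elim (np p)
      ... | no _ = refl
      at-T : ∀ {v} → v ∈ T → v ∈ L.on → v ∈ on′ × src′ v ≡ L.src v
      at-T t p = inj₂ (proj₁ s , subst (_∈ L.on) (sym (proj₂ s)) p) , trans (src-R (tc t)) (cong L.src (proj₂ s))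
        where s = R.start t
      on-L : ∀ {v} → v ∈ L.on → v ∈ on′ × src′ v ≡ L.src v
      on-L p with L.on⊆ p
      ... | inj₁ c = inj₁ (c , p) , src-C c
      ... | inj₂ t = at-T t p
      start′ : ∀ {x} → x ∈ X → x ∈ on′ × src′ x ≡ x
      start′ p with L.start p
      ... | o , s with on-L o
      ... | o′ , s′ = o′ , trans s′ s
      src∈′ : ∀ {v} → v ∈ on′ → src′ v ∈ X
      src∈′ (inj₁ (c , p)) = subst (_∈ X) (sym (src-C c)) (L.src∈ p)
      src∈′ (inj₂ (r , p)) = subst (_∈ X) (sym (src-R (proj₂ (R.on⊆ r)))) (L.src∈ p)
      thread′ : Fin n → DSet n
      thread′ y = dset (λ v → v ∈ on′ × src′ v ≡ y) (λ v → dec on′ v ×-dec src′ v ≟ᶠ y)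
      first : ∀ {x} → x ∈ X → L.thread x ⊆ thread′ x
      first _ (p , s) = proj₁ (on-L p) , trans (proj₂ (on-L p)) s
      second : ∀ {x} → x ∈ X → R.thread (L.end x) ⊆ thread′ x
      second {x} p {v} (r , s) = inj₂ (r , subst (_∈ L.on) (sym s) (proj₁ q)) ,
        trans (src-R (proj₂ (R.on⊆ r))) (trans (cong L.src s) (proj₂ q))
        where
        q : L.end x ∈ L.thread x
        q = walk-end (L.path p)
      only′ : ∀ {v} → v ∈ on′ → v ∈ Y → v ≡ R.end (L.end (src′ v))
      only′ (inj₁ (c , _)) y = ⊥-elim (yc y c)
      only′ {v} (inj₂ (r , p)) y = trans (R.only r y) (cong R.end (trans (L.only p (R.src∈ r)) (cong L.end (sym (src-R (proj₂ (R.on⊆ r)))))))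

    reached : (A X T : DSet n) → DSet n
    reached A X T = dset (λ v → ∃ λ u → u ∈ X × Walk G (A ∖ T) u v)
                         (λ v → any? λ u → dec X u ×-dec walk? G (A ∖ T) u v)

    reached-closed : ∀ A X T {a b} → a ∈ reached A X T → b ∈ A ∖ T → E G a b → b ∈ reached A X T
    reached-closed A X T (u , uX , v) b e = u , uX , v ++ʷ edge (walk-end v) b e

    reached⊆ : ∀ A X T → reached A X T ⊆ A ∖ T
    reached⊆ A X T (_ , _ , v) = walk-end v

    -- After its last vertex in T, a walk from X to Y cannot return to the vertices reached from X.
    -- So this last part has to meet Q.
    separates-behind : ∀ A X Y T Q → T ⊆ A → Y ⊆ A → Separates A X Y T →
                       Separates (A ∖ reached A X T) T Y Q → Separates A X Y Q
    separates-behind A X Y T Q ta ya sep sq uX yY v with first-hit T (reverseʷ v)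
    ... | inj₁ v′ = sep uX yY (walk-⊆ (λ q → proj₁ (proj₁ q) , proj₂ q) (reverseʷ v′))
    ... | inj₂ (inj₁ t) = sq t yY (here ((ya yY , λ { (u , uX , w) → sep uX yY w }) , proj₂ (walk-end v)))
    ... | inj₂ (inj₂ (a , t , v′ , e , tT , p)) =
      sq tT yY (step ((ta tT , λ c → proj₂ (reached⊆ A X T c) tT) , proj₂ p) (esym G e)
                     (walk-⊆ (λ q → (proj₁ (proj₁ (proj₂ q)) , proj₂ (proj₂ q)) , proj₂ (proj₁ (proj₁ q))) (reverseʷ v″)))
      where
      v″ = walk-closed (A ∖ T ∖ reached A X T)
             (λ { (r , nc) q f → (proj₁ (proj₁ q) , proj₂ q) , λ c → nc (reached-closed A X T c r (esym G f)) })
             ((ya yY , proj₂ (walk-start v′)) , λ { (u , uX , w) → sep uX yY w }) v′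

    -- Menger's theorem. When the first step x → z towards Y cannot be committed to,
    -- a small separator of the remaining graph together with x is tight, and splits
    -- the graph into two smaller ones.
    menger : ∀ k A X Y → # A ≤ k → X ⊆ A → Y ⊆ A →
             (∀ T → T ⊆ A → Separates A X Y T → # X ≤ # T) → (Linkage A X Y → ⊥) → ⊥
    menger k A X Y ak xa ya big fail with any-∈ (X ∖ Y)
    ... | no none = fail (link-refl xa (∖-empty X Y none))
    menger zero A X Y ak xa ya big fail | yes (x , xX , xY) = <⇒≱ (#-one A x (xa xX)) ak
    menger (suc k) A X Y ak xa ya big fail | yes (x , xX , xY) =
      <⇒≱ (#-strict X₀ X x proj₁ xX λ q → proj₂ q refl) (big X₀ (λ p → xa (proj₁ p)) leave)
      where
      X₀ = X ∖ ⁅ x ⁆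
      A₀ = A ∖ ⁅ x ⁆
      only-x : ∀ {v} → v ∈ X → v ∉ X₀ → v ≡ x
      only-x {v} p np with v ≟ᶠ x
      ... | yes e = e
      ... | no ne = ⊥-elim (np (p , ne))
      -- By `big`, X₀ is too small to separate, so it remains to refute a walk outside X₀. It starts
      -- at x, and its next vertex z after the last visit to x is the step to commit to.
      leave : Separates A X Y X₀
      leave {v} {y} vX yY w with only-x vX (proj₂ (walk-start w)) | walk-unfold w
      ... | refl | inj₁ refl = xY yY
      ... | refl | inj₂ (z , e , w′) = em S λ { (inj₁ s) → menger k A₀ X₁ Y (small A₀ x proj₁ (xa xX) λ q → proj₂ q refl)
                                                   X₁⊆ Y⊆ s (λ L → fail (link-extend x z (xa xX) xX xY zX e L))
                                              ; (inj₂ ns) → ns λ T ta sep → case # X₁ ≤? # T of λ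
                                                   { (yes le) → le ; (no gt) → ⊥-elim (split T ta sep (≰⇒> gt)) } }
        where
        X₁ = X₀ ∪ ⁅ z ⁆
        S = ∀ T → T ⊆ A₀ → Separates A₀ X₁ Y T → # X₁ ≤ # T
        small : ∀ B v → B ⊆ A → v ∈ A → v ∉ B → # B ≤ k
        small B v ba va nv = ≤-pred (≤-trans (#-strict B A v ba va nv) ak)
        zX : z ∉ X
        zX p = proj₂ (proj₁ (walk-start w′)) (p , proj₂ (walk-start w′))
        X₁⊆ : X₁ ⊆ A₀
        X₁⊆ (inj₁ (p , ne)) = xa p , ne
        X₁⊆ (inj₂ refl) = proj₁ (proj₁ (walk-start w′)) , proj₂ (walk-start w′)
        Y⊆ : Y ⊆ A₀
        Y⊆ p = ya p , λ { refl → xY p }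
        split : ∀ T → T ⊆ A₀ → Separates A₀ X₁ Y T → # T < # X₁ → ⊥
        -- T⁺ = T ∪ ⁅ x ⁆ separates X from Y and has at most |X| vertices. Both sides satisfy the
        -- hypothesis on separators, and `yw` and `xw` show that both are proper.
        split T ta sep lt =
          menger k AL X T⁺ (small AL (proj₁ yw) AL⊆ (ya (proj₁ (proj₂ yw))) y-out) X⊆L inj₂ bigL λ LL →
          menger k AR T⁺ Y (small AR (proj₁ xw) proj₁ (xa (proj₁ (proj₂ xw))) λ q → proj₂ q x-in) T⊆R Y⊆R bigR λ LR →
          fail (link-trans {C = C} T∩C Y∩C C⊆A T⁺⊆A LL LR)
          where
          T⁺ = T ∪ ⁅ x ⁆
          C AL AR : DSet n
          C = reached A X T⁺
          AL = C ∪ T⁺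
          AR = A ∖ C
          T⁺⊆A : T⁺ ⊆ A
          T⁺⊆A (inj₁ t) = proj₁ (ta t)
          T⁺⊆A (inj₂ refl) = xa xX
          sep⁺ : Separates A X Y T⁺
          sep⁺ {u} uX yY v with u ≟ᶠ x
          ... | yes refl = proj₂ (walk-start v) (inj₂ refl)
          ... | no ne = sep (inj₁ (uX , ne)) yY (walk-⊆ (λ q → (proj₁ q , λ e → proj₂ q (inj₂ e)) , λ t → proj₂ q (inj₁ t)) v)
          X₁≤X : # X₁ ≤ # X
          X₁≤X = ≤-trans (#-insert X₀ z) (#-strict X₀ X x proj₁ xX λ q → proj₂ q refl)
          T⁺≤X : # T⁺ ≤ # X
          T⁺≤X = ≤-trans (#-insert T x) (≤-trans lt X₁≤X)
          C⊆ : C ⊆ A ∖ T⁺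
          C⊆ = reached⊆ A X T⁺
          C⊆A : C ⊆ A
          C⊆A c = proj₁ (C⊆ c)
          T∩C : ∀ {v} → v ∈ T⁺ → v ∉ C
          T∩C t c = proj₂ (C⊆ c) t
          Y∩C : ∀ {v} → v ∈ Y → v ∉ C
          Y∩C y (u , uX , v) = sep⁺ uX y v
          AL⊆ : AL ⊆ A
          AL⊆ (inj₁ c) = C⊆A c
          AL⊆ (inj₂ t) = T⁺⊆A t
          T⊆R : T⁺ ⊆ AR
          T⊆R t = T⁺⊆A t , T∩C t
          Y⊆R : Y ⊆ AR
          Y⊆R y = ya y , Y∩C y
          toC : ∀ {v} → v ∈ X → v ∉ T⁺ → v ∈ C
          toC p nt = _ , p , here (xa p , nt)
          X⊆L : X ⊆ AL
          X⊆L {v} p with dec T⁺ v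
          ... | yes t = inj₂ t
          ... | no nt = inj₁ (toC p nt)
          yw : ∃ λ y → y ∈ Y ∖ T⁺
          yw with any-∈ (Y ∖ T⁺)
          ... | yes r = r
          -- Otherwise Y ⊆ T⁺ misses x and so has fewer than |X| vertices, although Y is itself a
          -- separator.
          ... | no none = ⊥-elim (<⇒≱ (#-strict Y T⁺ x Y⊆T (inj₂ refl) xY) (≤-trans T⁺≤X (big Y ya λ _ y v → proj₂ (walk-end v) y)))
            where
            Y⊆T : Y ⊆ T⁺
            Y⊆T = ∖-empty Y T⁺ none
          y-out : proj₁ yw ∉ AL
          y-out (inj₁ c) = Y∩C (proj₁ (proj₂ yw)) c
          y-out (inj₂ t) = proj₂ (proj₂ yw) t
          xw : ∃ λ u → u ∈ X ∖ T⁺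
          xw with any-∈ (X ∖ T⁺)
          ... | yes r = r
          -- Otherwise X ⊆ T⁺ forces T ⊆ X₀ by size, and the walk from z, which avoids X, gets past
          -- T.
          ... | no none = ⊥-elim (sep (inj₂ refl) yY (walk-⊆ (λ q → (proj₁ (proj₁ q) , proj₂ q) , λ t → proj₂ (proj₁ q) (T⊆X₀ t)) w′))
            where
            X⊆T : X ⊆ T⁺
            X⊆T = ∖-empty X T⁺ none
            T⊆X₀ : T ⊆ X₀
            T⊆X₀ t = #-subset X T⁺ X⊆T T⁺≤X (inj₁ t) , proj₂ (ta t)
          x-in : proj₁ xw ∈ C
          x-in = toC (proj₁ (proj₂ xw)) (proj₂ (proj₂ xw))
          bigL : ∀ Q → Q ⊆ AL → Separates AL X T⁺ Q → # X ≤ # Q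
          bigL Q qa sq = big Q (λ q → AL⊆ (qa q)) cut
            where
            cut : Separates A X Y Q
            cut uX yY v with first-hit T⁺ v
            ... | inj₁ v′ = sep⁺ uX yY (walk-⊆ (λ q → proj₁ (proj₁ q) , proj₂ q) v′)
            ... | inj₂ (inj₁ t) = sq uX t (here (inj₂ t , proj₂ (walk-start v)))
            ... | inj₂ (inj₂ (a , t , v′ , e , tT , p)) =
              sq uX tT (walk-⊆ (λ q → inj₁ (proj₂ q) , proj₂ (proj₁ (proj₁ q))) v″
                        ++ʷ edge (inj₁ (proj₂ (walk-end v″)) , proj₂ (proj₁ (proj₁ (walk-end v″)))) (inj₂ tT , proj₂ p) e)
              where v″ = walk-closed C (λ c q → reached-closed A X T⁺ c (proj₁ (proj₁ q) , proj₂ q)) (toC uX (proj₂ (walk-start v′))) v′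
          bigR : ∀ Q → Q ⊆ AR → Separates AR T⁺ Y Q → # T⁺ ≤ # Q
          bigR Q qa sq = ≤-trans T⁺≤X (big Q (λ q → proj₁ (qa q)) (separates-behind A X Y T⁺ Q T⁺⊆A ya sep⁺ sq))

    -- Each path carries the label of its source to its end. As it meets Y only there, the set S of
    -- vertices of Y in use has at most |X| elements, at most two of them labelled `false`, and the
    -- rigid set joins them. A vertex of both X and Y is its own source and so lies in S.
    transfer : ∀ {A B X Y} f → Linkage A X Y → (∀ {v} → v ∈ A → v ∈ B → v ∈ Y) → Y ⊆ B → Lab X f →
               (∀ S → S ⊆ Y → # S ≤ # X → (∀ {v} → v ∈ X → v ∈ Y → v ∈ S) → Rigid B G S) → Sol (A ∪ B) G X f
    transfer {A} {B} {X} {Y} f L ab yb (b₁ , b₂ , lab) rig = solution e ((λ x p → trans (on-e (proj₁ (start p))) (cong f (proj₂ (start p)))) , joined)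
      where
      open Linkage L
      S = Y ∩ on
      f′ : Fin n → Bool
      f′ v = f (src v)
      S≤X : # S ≤ # X
      S≤X = #-inj S X src (λ p → src∈ (proj₂ p)) λ { (y₁ , o₁) (y₂ , o₂) eq → trans (only o₁ y₁) (trans (cong end eq) (sym (only o₂ y₂))) }
      labS : Lab S f′
      labS = end b₁ , end b₂ , λ { (y , o) eq → [ (λ s → inj₁ (trans (only o y) (cong end s))) , (λ s → inj₂ (trans (only o y) (cong end s))) ]′ (lab (src∈ o) eq) }
      sol : Sol B G S f′
      sol = rig S proj₁ S≤X (λ p y → y , proj₁ (start p)) f′ labS
      d = Sol.colour sol
      e : Fin n → Bool
      e v with dec B v
      ... | yes _ = d v
      ... | no _ = f (src v)
      on-B : ∀ {v} → v ∈ B → e v ≡ d v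
      on-B {v} p with dec B v
      ... | yes _ = refl
      ... | no np = ⊥-elim (np p)
      on-e : ∀ {v} → v ∈ on → e v ≡ f (src v)
      on-e {v} o with dec B v
      ... | yes b = proj₁ (Sol.solves sol) v (ab (on⊆ o) b , o)
      ... | no _ = refl
      out : ∀ {x} → x ∈ X → Walk G (class (A ∪ B) e (f x)) x (end x)
      out p = walk-⊆ (λ { (o , s) → inj₁ (on⊆ o) , trans (on-e o) (cong f s) }) (path p)
      end-S : ∀ {x} → x ∈ X → end x ∈ S × src (end x) ≡ x
      end-S p = (end∈ p , proj₁ (walk-end (path p))) , proj₂ (walk-end (path p))
      joined : ∀ x y → x ∈ X → y ∈ X → f x ≡ f y → Walk G (class (A ∪ B) e (f x)) x y
      joined x y p q eq = out p ++ʷ (walk-⊆ (λ { (b , k) → inj₂ b , trans (on-B b) (trans k (cong f (proj₂ (end-S p)))) })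
          (proj₂ (Sol.solves sol) (end x) (end y) (proj₁ (end-S p)) (proj₁ (end-S q))
            (trans (cong f (proj₂ (end-S p))) (trans eq (cong f (sym (proj₂ (end-S q)))))))
        ++ʷ reverseʷ (subst (λ β → Walk G (class (A ∪ B) e β) y (end y)) (sym eq) (out q)))

-- Massed graphs

*-pack : ∀ k {a b c} → a + b ≤ c → k * a + k * b ≤ k * c
*-pack k {a} {b} h = ≤-trans (≤-reflexive (sym (*-distribˡ-+ k a b))) (*-monoʳ-≤ k h)

module _ {n : ℕ} where

  Sol-⊆ : ∀ {B B′} {G : Gr n} {S f} → B ⊆ B′ → Sol B G S f → Sol B′ G S f
  Sol-⊆ h (solution c (agr , joi)) = solution c (agr , λ x y p q e → walk-⊆ (λ r → h (proj₁ r) , proj₂ r) (joi x y p q e))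

  -- The separation is (U ∖ Z, Z ∪ S) with X on the first side. The boundary S may contain
  -- terminals, and also vertices without a neighbour in Z.
  record Separation (U : DSet n) (G : Gr n) (X Z S : DSet n) : Set where
    field
      Z⊆U   : Z ⊆ U
      S⊆U   : S ⊆ U
      Z∩S   : ∀ {v} → v ∈ Z → v ∉ S
      X∩Z   : ∀ {v} → v ∈ X → v ∉ Z
      closed : ∀ {z w} → z ∈ Z → w ∈ U → E G z w → w ∈ Z ⊎ w ∈ S

  ρ-mono : ∀ U U′ (G : Gr n) Z Z′ → U ⊆ U′ → Z ⊆ Z′ → ρ U G Z ≤ ρ U′ G Z′
  ρ-mono U U′ G Z Z′ h k = ε-mono (touching U G Z) (touching U′ G Z′)
    λ { ((p , q) , e , t) → (h p , h q) , e , [ (λ z → inj₁ (k z)) , (λ z → inj₂ (k z)) ]′ t }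

  ρ-split : ∀ {U G X Z S} → Separation U G X Z S → X ⊆ U →
            ρ U G (U ∖ X) ≤ ρ (U ∖ Z) G (U ∖ Z ∖ X) + ρ U G Z
  ρ-split {U} {G} {X} {Z} sep xu = ε-cover (touching U G (U ∖ X)) (touching (U ∖ Z) G (U ∖ Z ∖ X)) (touching U G Z) cover
    where
    cover : ∀ {a b} → rel (touching U G (U ∖ X)) a b → rel (touching (U ∖ Z) G (U ∖ Z ∖ X)) a b ⊎ rel (touching U G Z) a b
    cover {a} {b} ((p , q) , e , t) with dec Z a | dec Z b
    ... | yes z | _ = inj₂ ((p , q) , e , inj₁ z)
    ... | no _ | yes z = inj₂ ((p , q) , e , inj₂ z)
    ... | no na | no nb = inj₁ (((p , na) , (q , nb)) , e ,
          [ (λ r → inj₁ ((p , na) , proj₂ r)) , (λ r → inj₂ ((q , nb) , proj₂ r)) ]′ t)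

  module _ {U : DSet n} {G X Z S} (sep : Separation U G X Z S) where
    open Separation sep

    Z≈ : # (Z ∪ S ∖ S) ≤ # Z
    Z≈ = #-mono (Z ∪ S ∖ S) Z λ { (inj₁ z , _) → z ; (inj₂ s , ns) → ⊥-elim (ns s) }

    ρ-local : ρ U G Z ≤ ρ (Z ∪ S) G (Z ∪ S ∖ S)
    ρ-local = ε-mono (touching U G Z) (touching (Z ∪ S) G (Z ∪ S ∖ S)) λ
      { ((p , q) , e , inj₁ z) → (inj₁ z , closed z q e) , e , inj₁ (inj₁ z , Z∩S z)
      ; ((p , q) , e , inj₂ z) → (closed z p (esym G e) , inj₁ z) , e , inj₂ (inj₁ z , Z∩S z) }

    sub-separation : ∀ {Z′ S′} → Separation (Z ∪ S) G S Z′ S′ → Separation U G X Z′ S′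
    sub-separation {Z′} {S′} s = record
      { Z⊆U = λ z → Z⊆U (inZ z) ; S⊆U = λ p → [ Z⊆U , S⊆U ]′ (s.S⊆U p) ; Z∩S = s.Z∩S
      ; X∩Z = λ x z → X∩Z x (inZ z)
      ; closed = λ z w e → s.closed z (closed (inZ z) w e) e }
      where
      module s = Separation s
      inZ : Z′ ⊆ Z
      inZ z with s.Z⊆U z
      ... | inj₁ r = r
      ... | inj₂ r = ⊥-elim (s.X∩Z r z)

  Joint : (U : DSet n) (G : Gr n) (X : DSet n) (f : Fin n → Bool) → Set
  Joint U G X f = ∃ λ u → ∃ λ v → u ∈ X × v ∈ X × f u ≢ f v × (∀ {z} → z ∈ U ∖ X → E G z u → E G z v → ⊥)

  module _ (α : ℕ) where

    Sparse : DSet n → Gr n → DSet n → Set₁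
    Sparse U G X = ∀ Z S → Separation U G X Z S → # S < # X → ρ U G Z ≤ α * # Z

    -- Density just above α suffices in each of three situations. The third one arises when
    -- contracting an edge uv produces a dense set whose boundary contains u and v.
    Slack : (U : DSet n) (G : Gr n) (X : DSet n) (f : Fin n → Bool) → Set
    Slack U G X f = # X ≤ α ⊎ (2 + α * # (U ∖ X) ≤ ρ U G (U ∖ X) ⊎ Joint U G X f)

    record Massed (U : DSet n) (G : Gr n) (X : DSet n) (f : Fin n → Bool) : Set₁ where
      field
        X⊆U    : X ⊆ U
        order  : # X ≤ 1 + α
        lab    : Lab X f
        dense  : α * # (U ∖ X) < ρ U G (U ∖ X)
        slack  : Slack U G X f
        sparse : Sparse U G X

    Hypothesis : DSet n → Set₁
    Hypothesis U = ∀ U′ G X f → # U′ < # U → Massed U′ G X f → Sol U′ G X f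

    -- A dense Z whose boundary S has least order is massed with S as terminals: a dense part behind
    -- fewer vertices would contradict the choice of S. So the induction hypothesis solves every
    -- labelling of S that has slack.
    rigid-sep : ∀ {U₀ U G X Z S} → Hypothesis U₀ → Separation U G X Z S → # (Z ∪ S) < # U₀ → # S ≤ 1 + α →
                α * # Z < ρ U G Z → (∀ Z′ S′ → Separation U G X Z′ S′ → # S′ < # S → ρ U G Z′ ≤ α * # Z′) →
                ∀ f → Lab S f → Slack (Z ∪ S) G S f → Sol (Z ∪ S) G S f
    rigid-sep {U₀} {U} {G} {X} {Z} {S} ih sep small ord dn sp f lab sl = ih (Z ∪ S) G S f small record
      { X⊆U = inj₂ ; order = ord ; lab = lab
      ; dense = ≤-trans (s≤s (*-monoʳ-≤ α (Z≈ sep))) (≤-trans dn (ρ-local sep))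
      ; slack = sl
      ; sparse = λ Z′ S′ s lt → ≤-trans (ρ-mono (Z ∪ S) U G Z′ Z′ (λ p → [ Separation.Z⊆U sep , Separation.S⊆U sep ]′ p) id)
                                         (sp Z′ S′ (sub-separation sep s) lt) }

    minimal-dense : ∀ {U G X} → ¬ Sparse U G X →
      (∀ Z S → Separation U G X Z S → # S < # X → α * # Z < ρ U G Z →
        (∀ Z′ S′ → Separation U G X Z′ S′ → # S′ < # S → ρ U G Z′ ≤ α * # Z′) → ⊥) → ⊥
    minimal-dense {U} {G} {X} nsp k = nsp λ Z S sep lt → case ρ U G Z ≤? α * # Z of λ
      { (yes le) → le
      ; (no gt) → ⊥-elim (least {P = λ (Z , S) → Separation U G X Z S × # S < # X × α * # Z < ρ U G Z} (λ p → # (proj₂ p))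
          (Z , S) (sep , lt , ≰⇒> gt) λ (Z , S) (sep , lt , dn) m → k Z S sep lt dn λ Z′ S′ sep′ l → case ρ U G Z′ ≤? α * # Z′ of λ
            { (yes le) → le ; (no gt) → ⊥-elim (<⇒≱ l (m (Z′ , S′) (sep′ , ≤-trans l (<⇒≤ lt) , ≰⇒> gt))) }) }

    module _ {U : DSet n} {G X f} (M : Massed U G X f) (ih : Hypothesis U) (fail : ¬ Sol U G X f) where
      open Massed M

      -- A rigid set Z cut off by few vertices can be replaced by a clique on its boundary S.
      -- If the result is not massed, a dense set of it with a smallest boundary enlarges Z.
      no-rigid : ∀ k Z S → # (U ∖ Z) ≤ k → Separation U G X Z S → # S < # X → (∃ λ z → z ∈ Z) →
                 Rigid (Z ∪ S) G S → ⊥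
      no-rigid k Z S uk sep lt (z₀ , z₀∈) rig = em (Sparse A G⁺ X) λ
        { (inj₁ sp) → fail (Sol-⊆ whole (simulate {D = A} {Z = Z} {S = S} f rig proj₂ S⊆A X⊆A lab (ih A G⁺ X f A<U (massed sp))))
        ; (inj₂ nsp) → minimal-dense nsp enlarge }
        where
        open Separation sep
        A = U ∖ Z
        G⁺ = torso G S
        A<U : # A < # U
        A<U = #-strict A U z₀ proj₁ (Z⊆U z₀∈) λ p → proj₂ p z₀∈
        whole : A ∪ Z ⊆ U
        whole = [ proj₁ , Z⊆U ]′
        S⊆A : S ⊆ A
        S⊆A s = S⊆U s , λ z → Z∩S z s
        X⊆A : X ⊆ A
        X⊆A x = X⊆U x , X∩Z x
        weights : α * # (A ∖ X) + α * # Z ≤ α * # (U ∖ X)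
        weights = *-pack α (#-pack (A ∖ X) Z (U ∖ X) (λ p → proj₁ (proj₁ p) , proj₂ p) (λ z → Z⊆U z , λ x → X∩Z x z) λ p z → proj₂ (proj₁ p) z)
        base = ρ A G (A ∖ X)
        base≤ : base ≤ ρ A G⁺ (A ∖ X)
        base≤ = ε-mono (touching A G (A ∖ X)) (touching A G⁺ (A ∖ X)) λ { (p , e , t) → p , inj₁ e , t }
        -- As |S| < |X|, sparsity says that cutting off Z loses at most α |Z| edges; the surplus c
        -- over α per vertex survives.
        keep : ∀ c → c + α * # (U ∖ X) ≤ ρ U G (U ∖ X) → c + α * # (A ∖ X) ≤ base
        keep c h = ≮⇒≥ λ bad → linarith (c ∷ α * # (U ∖ X) ∷ ρ U G (U ∖ X) ∷ α * # (A ∖ X) ∷ base ∷ α * # Z ∷ ρ U G Z ∷ [])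
          (v₀ ⊕ v₁ ≼ v₂ ∷ v₃ ⊕ v₅ ≼ v₁ ∷ v₂ ≼ v₄ ⊕ v₆ ∷ v₆ ≼ v₅ ∷ num 1 ⊕ v₄ ≼ v₀ ⊕ v₃ ∷ [])
          (h , weights , ρ-split sep X⊆U , sparse Z S sep lt , bad , tt)
        gain : ∀ {z u} → z ∈ A ∖ X → u ∈ X → E G⁺ z u → ¬ E G z u → 1 + base ≤ ρ A G⁺ (A ∖ X)
        gain {z} {u} zA uX e ne = ≤-trans (≤-reflexive (trans (+-comm 1 base) (cong (base +_) (sym (trans (ε-star z ⁅ u ⁆ λ { refl → proj₂ zA uX }) (#-⁅⁆ u))))))
          (ε-pack (touching A G (A ∖ X)) (star z ⁅ u ⁆) (touching A G⁺ (A ∖ X)) (λ { (p , e , t) → p , inj₁ e , t })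
            (λ { (inj₁ (refl , refl)) → (proj₁ zA , X⊆A uX) , e , inj₁ zA ; (inj₂ (refl , refl)) → (X⊆A uX , proj₁ zA) , esym G⁺ e , inj₂ zA })
            λ { (_ , e′ , _) (inj₁ (refl , refl)) → ne e′ ; (_ , e′ , _) (inj₂ (refl , refl)) → ne (esym G e′) })
        slack⁺ : Slack A G⁺ X f
        slack⁺ with slack
        ... | inj₁ s = inj₁ s
        ... | inj₂ (inj₁ two) = inj₂ (inj₁ (≤-trans (keep 2 two) base≤))
        ... | inj₂ (inj₂ (u , v , uX , vX , ne , free))
          with any? (λ z → dec (A ∖ X) z ×-dec E? G⁺ z u ×-dec E? G⁺ z v)
        ... | no none = inj₂ (inj₂ (u , v , uX , vX , ne , λ {z} p a b → none (z , p , a , b)))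
        ... | yes (z , zA , eu , ev) = inj₂ (inj₁ (≤-trans (s≤s (keep 1 dense)) new))
          where
          new : 1 + base ≤ ρ A G⁺ (A ∖ X)
          new with E? G z u | E? G z v
          ... | no nu | _ = gain zA uX eu nu
          ... | yes _ | no nv = gain zA vX ev nv
          ... | yes eu′ | yes ev′ = ⊥-elim (free (proj₁ (proj₁ zA) , proj₂ zA) eu′ ev′)
        massed : Sparse A G⁺ X → Massed A G⁺ X f
        massed sp = record { X⊆U = X⊆A ; order = order ; lab = lab ; dense = ≤-trans (keep 1 dense) base≤
                           ; slack = slack⁺ ; sparse = sp }
        enlarge : ∀ Z₁ S₁ → Separation A G⁺ X Z₁ S₁ → # S₁ < # X → α * # Z₁ < ρ A G⁺ Z₁ →
                  (∀ Z′ S′ → Separation A G⁺ X Z′ S′ → # S′ < # S₁ → ρ A G⁺ Z′ ≤ α * # Z′) → ⊥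
        enlarge Z₁ S₁ sep₁ lt₁ dn mn with any-∈ (S ∩ Z₁)
        -- Z₁ contains no vertex of S, so no added edge touches it and it is already too dense in G.
        ... | no none = <⇒≱ dn (≤-trans old (sparse Z₁ S₁ sepU lt₁))
          where
          module s = Separation sep₁
          sepU : Separation U G X Z₁ S₁
          sepU = record { Z⊆U = λ z → proj₁ (s.Z⊆U z) ; S⊆U = λ p → proj₁ (s.S⊆U p) ; Z∩S = s.Z∩S ; X∩Z = s.X∩Z ; closed = cl }
            where
            cl : ∀ {z w} → z ∈ Z₁ → w ∈ U → E G z w → w ∈ Z₁ ⊎ w ∈ S₁
            cl {z} {w} p q e with dec Z w
            ... | no nz = s.closed p (q , nz) (inj₁ e)
            ... | yes wz with closed wz (proj₁ (s.Z⊆U p)) (esym G e)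
            ... | inj₁ zz = ⊥-elim (proj₂ (s.Z⊆U p) zz)
            ... | inj₂ zs = ⊥-elim (none (z , zs , p))
          old : ρ A G⁺ Z₁ ≤ ρ U G Z₁
          old = ε-mono (touching A G⁺ Z₁) (touching U G Z₁) λ
            { ((p , q) , inj₁ e , t) → (proj₁ p , proj₁ q) , e , t
            ; ((p , q) , inj₂ (_ , a , b) , t) → ⊥-elim ([ (λ z → none (_ , a , z)) , (λ z → none (_ , b , z)) ]′ t) }
        enlarge Z₁ S₁ sep₁ lt₁ dn mn | yes (s₀ , s₀S , s₀Z) = recurse k uk
          where
          module s = Separation sep₁
          S⊆D : S ⊆ Z₁ ∪ S₁
          S⊆D {t} p with s₀ ≟ᶠ t
          ... | yes refl = inj₁ s₀Z
          ... | no ne = s.closed s₀Z (S⊆A p) (inj₂ (ne , s₀S , p))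
          D⊆A : Z₁ ∪ S₁ ⊆ A
          D⊆A = [ s.Z⊆U , s.S⊆U ]′
          -- The clique S has a vertex in Z₁ and thus lies in Z₁ ∪ S₁, so S₁ cuts off Z ∪ Z₁ in G.
          sep′ : Separation U G X (Z ∪ Z₁) S₁
          sep′ = record
            { Z⊆U = [ Z⊆U , (λ z → proj₁ (s.Z⊆U z)) ]′ ; S⊆U = λ p → proj₁ (s.S⊆U p)
            ; Z∩S = λ { (inj₁ z) p → proj₂ (s.S⊆U p) z ; (inj₂ z) p → s.Z∩S z p }
            ; X∩Z = λ { x (inj₁ z) → X∩Z x z ; x (inj₂ z) → s.X∩Z x z }
            ; closed = cl }
            where
            cl : ∀ {z w} → z ∈ Z ∪ Z₁ → w ∈ U → E G z w → w ∈ Z ∪ Z₁ ⊎ w ∈ S₁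
            cl {z} {w} p q e with dec Z w
            ... | yes wz = inj₁ (inj₁ wz)
            cl (inj₁ z) q e | no nz with closed z q e
            ... | inj₁ wz = ⊥-elim (nz wz)
            ... | inj₂ ws = [ (λ r → inj₁ (inj₂ r)) , inj₂ ]′ (S⊆D ws)
            cl (inj₂ z) q e | no nz = [ (λ r → inj₁ (inj₂ r)) , inj₂ ]′ (s.closed z (q , nz) (inj₁ e))
          rig′ : Rigid ((Z ∪ Z₁) ∪ S₁) G S₁
          rig′ f′ lab′ = Sol-⊆ (λ { (inj₁ (inj₁ z)) → inj₁ (inj₂ z) ; (inj₁ (inj₂ p)) → inj₂ p ; (inj₂ z) → inj₁ (inj₁ z) })
            (simulate {D = Z₁ ∪ S₁} {Z = Z} {S = S} f′ rig (λ p → proj₂ (D⊆A p)) S⊆D inj₂ lab′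
              (rigid-sep ih sep₁ (≤-trans (s≤s (#-mono (Z₁ ∪ S₁) A D⊆A)) A<U) (≤-trans (<⇒≤ lt₁) order) dn mn f′ lab′
                (inj₁ (≤-pred (≤-trans lt₁ order)))))
          recurse : ∀ k → # (U ∖ Z) ≤ k → ⊥
          recurse zero h = <⇒≱ (#-one (U ∖ Z) s₀ (S⊆A s₀S)) h
          recurse (suc k) h = no-rigid k (Z ∪ Z₁) S₁
            (≤-pred (≤-trans (#-strict (U ∖ (Z ∪ Z₁)) (U ∖ Z) s₀ (λ p → proj₁ p , λ z → proj₂ p (inj₁ z)) (S⊆A s₀S) λ p → proj₂ p (inj₂ s₀Z)) h))
            sep′ lt₁ (s₀ , inj₂ s₀Z) rig′

-- Rigid sets linked to the terminals

module _ {n : ℕ} where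

  rigid-⊆ : ∀ {B : DSet n} {G S S′} → S′ ⊆ S → Rigid B G S → Rigid B G S′
  rigid-⊆ {B} {G} {S} {S′} h rig f (b₁ , b₂ , lab) = solution (Sol.colour s)
    ((λ x p → trans (proj₁ (Sol.solves s) x (h p)) (on p)) ,
     λ x y p q e → subst (λ β → Walk G (class B (Sol.colour s) β) x y) (on p)
       (proj₂ (Sol.solves s) x y (h p) (h q) (trans (on p) (trans e (sym (on q))))))
    where
    -- The additional vertices are labelled `true`, since only two may be `false`.
    f′ : Fin n → Bool
    f′ v with dec S′ v
    ... | yes _ = f v
    ... | no _ = true
    on : ∀ {v} → v ∈ S′ → f′ v ≡ f v
    on {v} p with dec S′ v
    ... | yes _ = refl
    ... | no np = ⊥-elim (np p)
    lab′ : ∀ {x} → x ∈ S → f′ x ≡ false → x ≡ b₁ ⊎ x ≡ b₂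
    lab′ {x} p e with dec S′ x
    ... | yes q = lab q e
    lab′ {x} p () | no _
    s = rig f′ (b₁ , b₂ , lab′)

  half-zero : ∀ m → half {m} (λ _ _ → 0) ≡ 0
  half-zero zero = refl
  half-zero (suc m) = cong₂ _+_ (sum-zero m) (half-zero m)

  ρ-none : ∀ U (G : Gr n) Z → (∀ z → z ∉ Z) → ρ U G Z ≡ 0
  ρ-none U G Z none = ≤-antisym (≤-trans (half-mono λ a b → ≤-reflexive (χ-no (rdec (touching U G Z) a b)
    λ r → [ none a , none b ]′ (proj₂ (proj₂ r)))) (≤-reflexive (half-zero n))) z≤n

  minimal-separator : ∀ {G : Gr n} {A X Y} → X ⊆ A →
    (∀ T → T ⊆ A → Separates G A X Y T → # T ≤ # X → (∀ T′ → T′ ⊆ A → Separates G A X Y T′ → # T ≤ # T′) → ⊥) → ⊥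
  minimal-separator {G} {A} {X} {Y} xa k = least {P = λ T → T ⊆ A × Separates G A X Y T} # X (xa , trivial)
    λ T (ta , sep) m → k T ta sep (m X (xa , trivial)) λ T′ ta′ sep′ → m T′ (ta′ , sep′)
    where
    trivial : Separates G A X Y X
    trivial p _ w = proj₂ (walk-start w) p

  module _ (α : ℕ) {U : DSet n} {G X f} (M : Massed α U G X f) (ih : Hypothesis α U) (fail : ¬ Sol U G X f) where
    open Massed M

    -- A minimum separator T of X from the boundary S is linked to S, which makes it
    -- rigid as well; it is either as large as X or covered by no-rigid.
    no-rigid-linked : ∀ Z S → Separation U G X Z S → (∃ λ z → z ∈ Z) →
      (∀ S′ → S′ ⊆ S → # S′ ≤ # X → (∀ {v} → v ∈ X → v ∈ S → v ∈ S′) → Rigid (Z ∪ S) G S′) → ⊥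
    no-rigid-linked Z S sep (z₀ , z₀∈) rig = minimal-separator {G} {A} {X} {S} X⊆A λ T ta st tx mn → case # X ≤? # T of λ
      { (yes xt) → menger G (# A) A X S ≤-refl X⊆A S⊆A (λ T′ ta′ st′ → ≤-trans xt (mn T′ ta′ st′)) λ L →
          fail (Sol-⊆ whole (transfer G f L meet inj₂ lab rig))
      ; (no gt) → behind T ta st tx mn (≰⇒> gt) }
      where
      open Separation sep
      A = U ∖ Z
      X⊆A : X ⊆ A
      X⊆A x = X⊆U x , X∩Z x
      S⊆A : S ⊆ A
      S⊆A s = S⊆U s , λ z → Z∩S z s
      whole : A ∪ (Z ∪ S) ⊆ U
      whole = [ proj₁ , [ Z⊆U , S⊆U ]′ ]′
      meet : ∀ {v} → v ∈ A → v ∈ Z ∪ S → v ∈ S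
      meet a (inj₁ z) = ⊥-elim (proj₂ a z)
      meet a (inj₂ s) = s
      -- Now T is smaller than X. Being a minimum separator it is linked to S beyond the vertices
      -- reached from X, so the remainder Z₁ is rigid with boundary T.
      behind : ∀ T → T ⊆ A → Separates G A X S T → # T ≤ # X →
               (∀ T′ → T′ ⊆ A → Separates G A X S T′ → # T ≤ # T′) → # T < # X → ⊥
      behind T ta st tx mn lt = menger G (# R) R T S ≤-refl T⊆R S⊆R
        (λ Q qr sq → mn Q (λ q → proj₁ (qr q)) (separates-behind G A X S T Q ta S⊆A st sq)) λ L →
        no-rigid α M ih fail (# (U ∖ Z₁)) Z₁ T ≤-refl sep₁ lt (z₀ , z-in z₀∈) λ f′ lab′ →
          Sol-⊆ cover (transfer G f′ L (λ r → meet (proj₁ r)) inj₂ lab′ λ S′ s′ sz h →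
            rig S′ s′ (≤-trans sz tx) λ p q → h (caught p q) q)
        where
        C = reached G A X T
        R = A ∖ C
        Z₁ = U ∖ C ∖ T
        caught : ∀ {v} → v ∈ X → v ∈ S → v ∈ T
        caught {v} p q with dec T v
        ... | yes t = t
        ... | no nt = ⊥-elim (st p q (here (X⊆A p , nt)))
        S∩C : ∀ {v} → v ∈ S → v ∉ C
        S∩C s (u , uX , w) = st uX s w
        T⊆R : T ⊆ R
        T⊆R t = ta t , λ c → proj₂ (reached⊆ G A X T c) t
        S⊆R : S ⊆ R
        S⊆R s = S⊆A s , S∩C s
        z-in : Z ⊆ Z₁
        z-in z = (Z⊆U z , λ c → proj₂ (proj₁ (reached⊆ G A X T c)) z) , λ t → proj₂ (ta t) z
        cover : R ∪ (Z ∪ S) ⊆ Z₁ ∪ T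
        cover {v} p with dec T v
        ... | yes t = inj₂ t
        cover (inj₁ ((u , nz) , nc)) | no nt = inj₁ ((u , nc) , nt)
        cover (inj₂ (inj₁ z)) | no nt = inj₁ (z-in z)
        cover (inj₂ (inj₂ s)) | no nt = inj₁ ((S⊆U s , S∩C s) , nt)
        sep₁ : Separation U G X Z₁ T
        sep₁ = record
          { Z⊆U = λ z → proj₁ (proj₁ z) ; S⊆U = λ t → proj₁ (ta t) ; Z∩S = proj₂
          ; X∩Z = λ x z → proj₂ (proj₁ z) (_ , x , here (X⊆A x , proj₂ z))
          ; closed = cl }
          where
          cl : ∀ {z w} → z ∈ Z₁ → w ∈ U → E G z w → w ∈ Z₁ ⊎ w ∈ T
          cl {z} {w} ((zU , nc) , nt) wU e with dec T w | dec C w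
          ... | yes t | _ = inj₂ t
          ... | no ntw | no ncw = inj₁ ((wU , ncw) , ntw)
          ... | no ntw | yes cw with dec Z z
          ... | no nz = ⊥-elim (nc (reached-closed G A X T cw ((zU , nz) , nt) (esym G e)))
          ... | yes zZ with closed zZ wU e
          ... | inj₁ wZ = ⊥-elim (proj₂ (proj₁ (reached⊆ G A X T cw)) wZ)
          ... | inj₂ wS = ⊥-elim (S∩C wS cw)

    -- A separation whose boundary contains a vertex q outside X is proper even when
    -- its order is that of X.
    module _ {Z S q} (sep : Separation U G X Z (S ∪ ⁅ q ⁆)) (lt : # S < # X) (qX : q ∉ X)
             (dn : α * # Z < ρ U G Z) where
      open Separation sep
      private S⁺ = S ∪ ⁅ q ⁆

      boundary≤ : # S⁺ ≤ # X
      boundary≤ = ≤-trans (#-insert S q) lt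

      -- If Z ∪ S⁺ were all of U, then X, which avoids Z and q, would be contained in the smaller
      -- set S.
      proper : # (Z ∪ S⁺) < # U
      proper with # (Z ∪ S⁺) <? # U
      ... | yes l = l
      ... | no nl = ⊥-elim (<⇒≱ lt (#-mono X S inS))
        where
        inS : X ⊆ S
        inS {v} x with #-subset (Z ∪ S⁺) U [ Z⊆U , S⊆U ]′ (≮⇒≥ nl) (X⊆U x)
        ... | inj₁ z = ⊥-elim (X∩Z x z)
        ... | inj₂ (inj₁ s) = s
        ... | inj₂ (inj₂ refl) = ⊥-elim (qX x)

      boundary-sol : ∀ f′ → Lab S⁺ f′ → Slack α (Z ∪ S⁺) G S⁺ f′ → Sol (Z ∪ S⁺) G S⁺ f′
      boundary-sol = rigid-sep α ih sep proper (≤-trans boundary≤ order) dn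
        λ Z′ S′ s l → sparse Z′ S′ s (≤-trans l boundary≤)

      inhabited : ∃ λ z → z ∈ Z
      inhabited with any-∈ Z
      ... | yes w = w
      ... | no none = ⊥-elim (<⇒≱ (≤-trans (s≤s z≤n) dn) (≤-reflexive (ρ-none U G Z λ v z → none (v , z))))

      no-rigid-boundary : Rigid (Z ∪ S⁺) G S⁺ → ⊥
      no-rigid-boundary rig = no-rigid-linked Z S⁺ sep inhabited λ S′ h _ _ → rigid-⊆ h rig

-- Deleting and contracting edges

module _ {n : ℕ} where

  ε-edge : ∀ {R S : DRel n} {p q} → p ≢ q → (∀ {a b} → rel R a b → rel S a b) → rel S p q → rel S q p →
           ¬ rel R p q → ¬ rel R q p → 1 + ε R ≤ ε S
  ε-edge {R} {S} {p} {q} ne h s s′ r r′ =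
    ≤-trans (≤-reflexive (trans (+-comm 1 (ε R)) (cong (ε R +_) (sym (trans (ε-star p ⁅ q ⁆ ne) (#-⁅⁆ q))))))
      (ε-pack R (star p ⁅ q ⁆) S h (λ { (inj₁ (refl , refl)) → s ; (inj₂ (refl , refl)) → s′ })
        λ { t (inj₁ (refl , refl)) → r t ; t (inj₂ (refl , refl)) → r′ t })

  module Deletion (G : Gr n) (p q : Fin n) where
    Cut : Fin n → Fin n → Set
    Cut a b = (a ≡ p × b ≡ q) ⊎ (a ≡ q × b ≡ p)

    cut? : ∀ a b → Dec (Cut a b)
    cut? a b = (a ≟ᶠ p ×-dec b ≟ᶠ q) ⊎-dec (a ≟ᶠ q ×-dec b ≟ᶠ p)

    cut-sym : ∀ {a b} → Cut a b → Cut b a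
    cut-sym (inj₁ (a , b)) = inj₂ (b , a)
    cut-sym (inj₂ (a , b)) = inj₁ (b , a)

    G⁻ : Gr n
    G⁻ = record
      { E = λ a b → E G a b × ¬ Cut a b
      ; E? = λ a b → E? G a b ×-dec ¬? (cut? a b)
      ; esym = λ { (e , nc) → esym G e , λ c → nc (cut-sym c) }
      ; eirr = λ { (e , _) → eirr G e } }

  module Contraction (G : Gr n) (x y : Fin n) where
    -- The vertex type is unchanged: x takes over the neighbours of y, and y disappears through the
    -- passage from U to U ∖ ⁅ y ⁆.
    G/ : Gr n
    G/ = record
      { E = λ a b → E G a b ⊎ ((a ≡ x × E G y b × b ≢ x) ⊎ (b ≡ x × E G y a × a ≢ x))
      ; E? = λ a b → E? G a b ⊎-dec ((a ≟ᶠ x ×-dec E? G y b ×-dec ¬? (b ≟ᶠ x)) ⊎-dec (b ≟ᶠ x ×-dec E? G y a ×-dec ¬? (a ≟ᶠ x)))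
      ; esym = λ { (inj₁ e) → inj₁ (esym G e) ; (inj₂ (inj₁ r)) → inj₂ (inj₂ r) ; (inj₂ (inj₂ r)) → inj₂ (inj₁ r) }
      ; eirr = λ { (inj₁ e) → eirr G e ; (inj₂ (inj₁ (e , _ , ne))) → ne e ; (inj₂ (inj₂ (e , _ , ne))) → ne e } }

    -- Give y the colour of x and replace an edge inherited by x by the detour through y. The set S⁺
    -- may contain y when x is a terminal with the same label.
    lift-sol : ∀ {B S S⁺ f} → E G x y → y ∉ B → S ⊆ B → (∀ {v} → v ∈ S⁺ → v ≢ y → v ∈ S) →
               (y ∈ S⁺ → x ∈ S × f x ≡ f y) → Sol B G/ S f → Sol (B ∪ ⁅ y ⁆) G S⁺ f
    lift-sol {B} {S} {S⁺} {f} exy yB sb other same (solution c (agr , joi)) = solution c⁺ (agr⁺ , joined)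
      where
      π : Fin n → Fin n
      π = updateAt id y (λ _ → x)
      c⁺ : Fin n → Bool
      c⁺ v = c (π v)
      π-y : π y ≡ x
      π-y = updateAt-updates y id
      π-other : ∀ {v} → v ≢ y → π v ≡ v
      π-other {v} = updateAt-minimal v y id
      inB : ∀ {v} → v ∈ B → c⁺ v ≡ c v
      inB p = cong c (π-other λ { refl → yB p })
      π-S : ∀ {v} → v ∈ S⁺ → π v ∈ S × f (π v) ≡ f v
      π-S {v} p with v ≟ᶠ y
      ... | yes refl = subst (λ w → w ∈ S × f w ≡ f y) (sym π-y) (same p)
      ... | no ne = subst (λ w → w ∈ S × f w ≡ f v) (sym (π-other ne)) (other p ne , refl)
      agr⁺ : ∀ v → v ∈ S⁺ → c⁺ v ≡ f v
      agr⁺ v p = trans (agr (π v) (proj₁ (π-S p))) (proj₂ (π-S p))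
      up : ∀ {β v} → v ∈ class B c β → v ∈ class (B ∪ ⁅ y ⁆) c⁺ β
      up (b , k) = inj₁ b , trans (inB b) k
      via : ∀ {β} → x ∈ class B c β → y ∈ class (B ∪ ⁅ y ⁆) c⁺ β
      via (_ , k) = inj₂ refl , trans (cong c π-y) k
      lift : ∀ {β a b} → Walk G/ (class B c β) a b → Walk G (class (B ∪ ⁅ y ⁆) c⁺ β) a b
      lift {β} = walk-bind up λ
        { p q (inj₁ e) → edge (up p) (up q) e
        ; p q (inj₂ (inj₁ (refl , e , _))) → step (up p) exy (edge (via p) (up q) e)
        ; p q (inj₂ (inj₂ (refl , e , _))) → step (up p) (esym G e) (edge (via q) (up q) (esym G exy)) }
      stub : ∀ {v} → v ∈ S⁺ → Walk G (class (B ∪ ⁅ y ⁆) c⁺ (f v)) v (π v)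
      stub {v} p with v ≟ᶠ y
      ... | no ne = subst (Walk G (class (B ∪ ⁅ y ⁆) c⁺ (f v)) v) (sym (π-other ne)) (here (up (sb (other p ne) , agr v (other p ne))))
      ... | yes refl = subst (Walk G (class (B ∪ ⁅ y ⁆) c⁺ (f y)) y) (sym π-y) (edge (via xc) (up xc) (esym G exy))
        where
        xc : x ∈ class B c (f y)
        xc = sb (proj₁ (same p)) , trans (agr x (proj₁ (same p))) (proj₂ (same p))
      joined : ∀ a b → a ∈ S⁺ → b ∈ S⁺ → f a ≡ f b → Walk G (class (B ∪ ⁅ y ⁆) c⁺ (f a)) a b
      joined a b p q e = stub p ++ʷ
        (subst (λ β → Walk G (class (B ∪ ⁅ y ⁆) c⁺ β) (π a) (π b)) (proj₂ (π-S p))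
          (lift (joi (π a) (π b) (proj₁ (π-S p)) (proj₁ (π-S q)) (trans (proj₂ (π-S p)) (trans e (sym (proj₂ (π-S q))))))) ++ʷ
        reverseʷ (subst (λ β → Walk G (class (B ∪ ⁅ y ⁆) c⁺ β) b (π b)) (sym e) (stub q)))

    -- Contracting y into x loses the edge xy and one edge for each vertex counted here;
    -- edges between two vertices of X do not contribute to the density.
    clash : DSet n → DSet n → DSet n
    clash U X = dset (λ w → w ∈ U × E G y w × w ≢ x × (E G x w ⊎ (x ∈ X × w ∈ X)))
                     (λ w → dec U w ×-dec E? G y w ×-dec ¬? (w ≟ᶠ x) ×-dec (E? G x w ⊎-dec (dec X x ×-dec dec X w)))

    module _ (U X : DSet n) (xU : x ∈ U) (yU : y ∈ U) (yX : y ∉ X) (exy : E G x y) where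
      x≢y : x ≢ y
      x≢y refl = eirr G exy
      private
        U/ = U ∖ ⁅ y ⁆
        old : DRel n
        old = drel (λ a b → rel (touching U G (U ∖ X)) a b × a ≢ y × b ≢ y)
                   (λ a b → rdec (touching U G (U ∖ X)) a b ×-dec ¬? (a ≟ᶠ y) ×-dec ¬? (b ≟ᶠ y))
        new : DSet n
        new = dset (λ w → w ∈ U × E G y w × w ≢ x × ¬ (E G x w ⊎ (x ∈ X × w ∈ X)))
                   (λ w → dec U w ×-dec E? G y w ×-dec ¬? (w ≟ᶠ x) ×-dec ¬? (E? G x w ⊎-dec (dec X x ×-dec dec X w)))

      -- Of the edges at y, xy disappears, and those to `clash` become double or join two terminals.
      -- All others become new edges at x that still have an end outside X.
      ρ-contract : ρ U G (U ∖ X) ≤ ρ U/ G/ (U/ ∖ X) + (1 + # (clash U X))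
      ρ-contract = ≮⇒≥ λ bad → linarith (ρ U G (U ∖ X) ∷ ε old ∷ # (nbr G U y) ∷ # (clash U X) ∷ # new ∷ ρ U/ G/ (U/ ∖ X) ∷ # (⁅ x ⁆ ∪ new) ∷ [])
        (num 1 ⊕ (v₅ ⊕ (num 1 ⊕ v₃)) ≼ v₀ ∷ v₀ ≼ v₁ ⊕ v₂ ∷ v₂ ≼ v₃ ⊕ v₆ ∷ v₆ ≼ num 1 ⊕ v₄ ∷ v₁ ⊕ v₄ ≼ v₅ ∷ [])
        (bad , upper , #-cover (nbr G U y) (clash U X) (⁅ x ⁆ ∪ new) sort
             , ≤-trans (#-cover (⁅ x ⁆ ∪ new) ⁅ x ⁆ new id) (≤-reflexive (cong (_+ # new) (#-⁅⁆ x))) , lower , tt)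
        where
        upper : ρ U G (U ∖ X) ≤ ε old + # (nbr G U y)
        upper = ≤-trans (ε-cover (touching U G (U ∖ X)) old (star y (nbr G U y)) λ {a} {b} r → split r (a ≟ᶠ y) (b ≟ᶠ y))
                  (≤-reflexive (cong (ε old +_) (ε-star y (nbr G U y) λ p → eirr G (proj₂ p))))
          where
          split : ∀ {a b} → rel (touching U G (U ∖ X)) a b → Dec (a ≡ y) → Dec (b ≡ y) → rel old a b ⊎ rel (star y (nbr G U y)) a b
          split ((p , q) , e , t) (yes refl) _ = inj₂ (inj₁ (refl , q , e))
          split ((p , q) , e , t) (no _) (yes refl) = inj₂ (inj₂ (refl , p , esym G e))
          split r (no na) (no nb) = inj₁ (r , na , nb)
        sort : nbr G U y ⊆ clash U X ∪ (⁅ x ⁆ ∪ new)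
        sort {w} (p , e) with w ≟ᶠ x
        ... | yes eq = inj₂ (inj₁ eq)
        ... | no ne with E? G x w ⊎-dec (dec X x ×-dec dec X w)
        ... | yes h = inj₁ (p , e , ne , h)
        ... | no nh = inj₂ (inj₂ (p , e , ne , nh))
        w≢y : ∀ {w} → E G y w → w ≢ y
        w≢y e refl = eirr G e
        touch : ∀ {w} → w ∈ new → x ∈ U/ ∖ X ⊎ w ∈ U/ ∖ X
        touch {w} (p , e , _ , nh) with dec X x | dec X w
        ... | no nx | _ = inj₁ ((xU , x≢y) , nx)
        ... | yes _ | no nw = inj₂ ((p , w≢y e) , nw)
        ... | yes xx | yes ww = ⊥-elim (nh (inj₂ (xx , ww)))
        swap : ∀ {A B : Set} → A ⊎ B → B ⊎ A
        swap = [ inj₂ , inj₁ ]′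
        lower : ε old + # new ≤ ρ U/ G/ (U/ ∖ X)
        lower = ≤-trans (≤-reflexive (cong (ε old +_) (sym (ε-star x new λ p → proj₁ (proj₂ (proj₂ p)) refl))))
          (ε-pack old (star x new) (touching U/ G/ (U/ ∖ X))
            (λ { (((p , q) , e , t) , na , nb) → ((p , na) , (q , nb)) , inj₁ e ,
                 [ (λ r → inj₁ ((p , na) , proj₂ r)) , (λ r → inj₂ ((q , nb) , proj₂ r)) ]′ t })
            (λ { (inj₁ (refl , w)) → ((xU , x≢y) , (proj₁ w , w≢y (proj₁ (proj₂ w)))) , inj₂ (inj₁ (refl , proj₁ (proj₂ w) , proj₁ (proj₂ (proj₂ w)))) , touch w
               ; (inj₂ (refl , w)) → ((proj₁ w , w≢y (proj₁ (proj₂ w))) , (xU , x≢y)) , inj₂ (inj₂ (refl , proj₁ (proj₂ w) , proj₁ (proj₂ (proj₂ w)))) , swap (touch w) })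
            λ { (((p , q) , e , t) , _) (inj₁ (refl , w)) → proj₂ (proj₂ (proj₂ w)) (inj₁ e)
              ; (((p , q) , e , t) , _) (inj₂ (refl , w)) → proj₂ (proj₂ (proj₂ w)) (inj₁ (esym G e)) })

      module _ (Z : DSet n) (zu : Z ⊆ U/) (xZ : x ∉ Z) where
        private
          Zx Zy : DSet n
          Zx = nbr G Z x
          Zy = nbr G Z y
          old₁ old₂ : DRel n
          old₁ = drel (λ a b → rel (touching U G Z) a b × a ≢ y × b ≢ y)
                      (λ a b → rdec (touching U G Z) a b ×-dec ¬? (a ≟ᶠ y) ×-dec ¬? (b ≟ᶠ y))
          old₂ = drel (λ a b → rel old₁ a b × a ≢ x × b ≢ x)
                      (λ a b → rdec old₁ a b ×-dec ¬? (a ≟ᶠ x) ×-dec ¬? (b ≟ᶠ x))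
          upper : ρ U/ G/ Z ≤ ε old₂ + # (Zx ∪ Zy)
          upper = ≤-trans (ε-cover (touching U/ G/ Z) old₂ (star x (Zx ∪ Zy)) λ {a} {b} r → split r (a ≟ᶠ x) (b ≟ᶠ x))
                    (≤-reflexive (cong (ε old₂ +_) (ε-star x (Zx ∪ Zy) [ (λ p → xZ (proj₁ p)) , (λ p → xZ (proj₁ p)) ]′)))
            where
            nb : ∀ {b} → E G/ x b → b ∈ Z → b ∈ Zx ∪ Zy
            nb (inj₁ e) z = inj₁ (z , e)
            nb (inj₂ (inj₁ (_ , e , _))) z = inj₂ (z , e)
            nb (inj₂ (inj₂ (refl , _))) z = ⊥-elim (xZ z)
            split : ∀ {a b} → rel (touching U/ G/ Z) a b → Dec (a ≡ x) → Dec (b ≡ x) → rel old₂ a b ⊎ rel (star x (Zx ∪ Zy)) a b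
            split ((p , q) , e , inj₁ z) (yes refl) _ = ⊥-elim (xZ z)
            split ((p , q) , e , inj₂ z) (yes refl) _ = inj₂ (inj₁ (refl , nb e z))
            split ((p , q) , e , inj₂ z) (no _) (yes refl) = ⊥-elim (xZ z)
            split ((p , q) , e , inj₁ z) (no _) (yes refl) = inj₂ (inj₂ (refl , nb (esym G/ e) z))
            split ((p , q) , inj₁ e , t) (no na) (no nb) = inj₁ ((((proj₁ p , proj₁ q) , e , t) , proj₂ p , proj₂ q) , na , nb)
            split (_ , inj₂ (inj₁ (refl , _)) , _) (no na) (no nb) = ⊥-elim (na refl)
            split (_ , inj₂ (inj₂ (refl , _)) , _) (no na) (no nb) = ⊥-elim (nb refl)
          lower₁ : ε old₁ + # Zy ≤ ρ U G Z
          lower₁ = ≤-trans (≤-reflexive (cong (ε old₁ +_) (sym (ε-star y Zy λ p → proj₂ (zu (proj₁ p)) refl))))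
            (ε-pack old₁ (star y Zy) (touching U G Z) proj₁
              (λ { (inj₁ (refl , z , e)) → (yU , proj₁ (zu z)) , e , inj₂ z ; (inj₂ (refl , z , e)) → (proj₁ (zu z) , yU) , esym G e , inj₁ z })
              λ { (_ , na , nb) (inj₁ (refl , _)) → na refl ; (_ , na , nb) (inj₂ (refl , _)) → nb refl })
          lower₂ : ε old₂ + # Zx ≤ ε old₁
          lower₂ = ≤-trans (≤-reflexive (cong (ε old₂ +_) (sym (ε-star x Zx λ p → xZ (proj₁ p)))))
            (ε-pack old₂ (star x Zx) old₁ proj₁
              (λ { (inj₁ (refl , z , e)) → ((xU , proj₁ (zu z)) , e , inj₂ z) , x≢y , proj₂ (zu z)
                 ; (inj₂ (refl , z , e)) → ((proj₁ (zu z) , xU) , esym G e , inj₁ z) , proj₂ (zu z) , x≢y })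
              λ { (_ , na , nb) (inj₁ (refl , _)) → na refl ; (_ , na , nb) (inj₂ (refl , _)) → nb refl })

        private
          -- Since Z avoids x and y, only the edges at their common neighbours in Z are merged: |Zx
          -- ∪ Zy| takes the place of |Zx| + |Zy|.
          ρ-bound : ∀ c → c + # (Zx ∪ Zy) ≤ # Zx + # Zy → c + ρ U/ G/ Z ≤ ρ U G Z
          ρ-bound c h = ≮⇒≥ λ bad → linarith (c ∷ ρ U/ G/ Z ∷ ε old₂ ∷ # (Zx ∪ Zy) ∷ ε old₁ ∷ # Zx ∷ # Zy ∷ ρ U G Z ∷ [])
            (num 1 ⊕ v₇ ≼ v₀ ⊕ v₁ ∷ v₁ ≼ v₂ ⊕ v₃ ∷ v₀ ⊕ v₃ ≼ v₅ ⊕ v₆ ∷ v₂ ⊕ v₅ ≼ v₄ ∷ v₄ ⊕ v₆ ≼ v₇ ∷ [])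
            (bad , upper , h , lower₂ , lower₁ , tt)

        ρ-shrinks : ρ U/ G/ Z ≤ ρ U G Z
        ρ-shrinks = ρ-bound 0 (#-cover (Zx ∪ Zy) Zx Zy id)

        ρ-shrinks-strictly : ∀ {z} → z ∈ Z → E G z x → E G z y → 1 + ρ U/ G/ Z ≤ ρ U G Z
        ρ-shrinks-strictly {z} zZ ex ey = ρ-bound 1 (≤-trans (s≤s (#-cover (Zx ∪ Zy) Zx (Zy ∖ ⁅ z ⁆) part))
            (≤-trans (≤-reflexive (sym (+-suc (# Zx) _))) (+-mono-≤ (≤-refl {# Zx})
              (#-strict (Zy ∖ ⁅ z ⁆) Zy z proj₁ (zZ , esym G ey) λ p → proj₂ p refl))))
          where
          part : Zx ∪ Zy ⊆ Zx ∪ (Zy ∖ ⁅ z ⁆)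
          part (inj₁ p) = inj₁ p
          part {w} (inj₂ p) with w ≟ᶠ z
          ... | yes refl = inj₁ (zZ , esym G ex)
          ... | no ne = inj₂ (p , ne)

-- Irreducibility of a minimal counterexample

module _ {n : ℕ} (α : ℕ) {U : DSet n} {G X f} (M : Massed α U G X f) (ih : Hypothesis α U) (fail : ¬ Sol U G X f) where
  open Massed M

  slack-two : ∀ {Z S f′} → Separation U G X Z S → 2 + α * # Z ≤ ρ U G Z → Slack α (Z ∪ S) G S f′
  slack-two sep two = inj₂ (inj₁ (≤-trans (s≤s (s≤s (*-monoʳ-≤ α (Z≈ sep)))) (≤-trans two (ρ-local sep))))

  module _ {p q : Fin n} (pN : p ∈ U ∖ X) (qN : q ∈ U ∖ X) (epq : E G p q) where
    open Deletion G p q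
    private
      ρ⁻ = ρ U G⁻ (U ∖ X)
      p≢q : p ≢ q
      p≢q refl = eirr G epq

    deletion-dense : ∀ c → 1 + c + α * # (U ∖ X) ≤ ρ U G (U ∖ X) → c + α * # (U ∖ X) ≤ ρ⁻
    deletion-dense c h = ≤-pred (≤-trans h (≤-trans
      (ε-cover (touching U G (U ∖ X)) (touching U G⁻ (U ∖ X)) (star p ⁅ q ⁆) λ {a} {b} r → split r (cut? a b))
      (≤-reflexive (trans (cong (ρ⁻ +_) (trans (ε-star p ⁅ q ⁆ p≢q) (#-⁅⁆ q))) (+-comm ρ⁻ 1)))))
      where
      split : ∀ {a b} → rel (touching U G (U ∖ X)) a b → Dec (Cut a b) → rel (touching U G⁻ (U ∖ X)) a b ⊎ rel (star p ⁅ q ⁆) a b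
      split (r , e , t) (no nc) = inj₁ (r , (e , nc) , t)
      split _ (yes (inj₁ c)) = inj₂ (inj₁ c)
      split _ (yes (inj₂ (a , b))) = inj₂ (inj₂ (b , a))

    deletion-gain : ∀ Z → p ∈ Z ⊎ q ∈ Z → 1 + ρ U G⁻ Z ≤ ρ U G Z
    deletion-gain Z t = ε-edge p≢q (λ { (r , e , t) → r , proj₁ e , t })
      ((proj₁ pN , proj₁ qN) , epq , t) ((proj₁ qN , proj₁ pN) , esym G epq , [ inj₂ , inj₁ ]′ t)
      (λ { (_ , e , _) → proj₂ e (inj₁ (refl , refl)) }) (λ { (_ , e , _) → proj₂ e (inj₂ (refl , refl)) })

    -- Only sparsity can fail after the deletion. In a violating separation pq runs from Z to a
    -- vertex r beyond the boundary. With r added, the boundary has order at most |X|, and since pq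
    -- counts in G, Z has surplus 2 there: slack enough to make it rigid.
    no-inner-edge : (∀ G′ → ρ U G′ (U ∖ X) < ρ U G (U ∖ X) → Massed α U G′ X f → Sol U G′ X f) →
                    α * # (U ∖ X) < ρ⁻ → Slack α U G⁻ X f → ⊥
    no-inner-edge ih₂ dn sl = em (Sparse α U G⁻ X) λ
      { (inj₁ sp) → case ih₂ G⁻ (deletion-gain (U ∖ X) (inj₁ pN)) record
            { X⊆U = X⊆U ; order = order ; lab = lab ; dense = dn ; slack = sl ; sparse = sp } of λ
          { (solution c (agr , joi)) → fail (solution c (agr , λ x y xX yX e → walk-bind id (λ r s g → edge r s (proj₁ g)) (joi x y xX yX e))) }
      ; (inj₂ nsp) → minimal-dense α nsp λ Z S sep lt dn′ _ → violation Z S sep lt dn′ }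
      where
      violation : ∀ Z S → Separation U G⁻ X Z S → # S < # X → α * # Z < ρ U G⁻ Z → ⊥
      violation Z S sep lt dn′ = main (dec Z p) (dec Z q) (dec (Z ∪ S) p) (dec (Z ∪ S) q)
        where
        open Separation sep
        ρ≤ : ρ U G⁻ Z ≤ ρ U G Z
        ρ≤ = ε-mono (touching U G⁻ Z) (touching U G Z) λ { (r , e , t) → r , proj₁ e , t }
        intact : (∀ {z w} → z ∈ Z → Cut z w → w ∈ Z ∪ S) → ⊥
        intact h = <⇒≱ (≤-trans dn′ ρ≤) (sparse Z S record
          { Z⊆U = Z⊆U ; S⊆U = S⊆U ; Z∩S = Z∩S ; X∩Z = X∩Z
          ; closed = λ {z} {w} zZ wU e → case cut? z w of λ { (yes c) → h zZ c ; (no nc) → closed zZ wU (e , nc) } } lt)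
        crossing : ∀ r → r ∈ U ∖ X → r ∉ Z ∪ S → (∀ {z w} → z ∈ Z → Cut z w → w ≡ r) → 1 + ρ U G⁻ Z ≤ ρ U G Z → ⊥
        crossing r rN nr h gain = no-rigid-boundary α M ih fail sep⁺ lt (proj₂ rN) dn⁺ λ f′ lab′ →
            boundary-sol α M ih fail sep⁺ lt (proj₂ rN) dn⁺ f′ lab′ (slack-two sep⁺ two)
          where
          two : 2 + α * # Z ≤ ρ U G Z
          two = ≤-trans (s≤s dn′) gain
          dn⁺ : α * # Z < ρ U G Z
          dn⁺ = ≤-trans (n≤1+n _) two
          sep⁺ : Separation U G X Z (S ∪ ⁅ r ⁆)
          sep⁺ = record
            { Z⊆U = Z⊆U ; S⊆U = λ { (inj₁ s) → S⊆U s ; (inj₂ refl) → proj₁ rN }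
            ; Z∩S = λ { z (inj₁ s) → Z∩S z s ; z (inj₂ refl) → nr (inj₁ z) } ; X∩Z = X∩Z
            ; closed = λ {z} {w} zZ wU e → case cut? z w of λ
                { (yes c) → inj₂ (inj₂ (h zZ c))
                ; (no nc) → [ inj₁ , (λ s → inj₂ (inj₁ s)) ]′ (closed zZ wU (e , nc)) } }
        main : Dec (p ∈ Z) → Dec (q ∈ Z) → Dec (p ∈ Z ∪ S) → Dec (q ∈ Z ∪ S) → ⊥
        main (yes pZ) _ _ (no nq) = crossing q qN nq
          (λ { _ (inj₁ (_ , e)) → e ; z (inj₂ (refl , refl)) → ⊥-elim (nq (inj₁ z)) }) (deletion-gain Z (inj₁ pZ))
        main _ (yes qZ) (no np) _ = crossing p pN np
          (λ { _ (inj₂ (_ , e)) → e ; z (inj₁ (refl , refl)) → ⊥-elim (np (inj₁ z)) }) (deletion-gain Z (inj₂ qZ))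
        main (no np) (no nq) _ _ = intact λ { z (inj₁ (refl , _)) → ⊥-elim (np z) ; z (inj₂ (refl , _)) → ⊥-elim (nq z) }
        main (yes pZ) (no nq) _ (yes qb) = intact λ { z (inj₁ (refl , refl)) → qb ; z (inj₂ (refl , _)) → ⊥-elim (nq z) }
        main (no np) (yes qZ) (yes pb) _ = intact λ { z (inj₂ (refl , refl)) → pb ; z (inj₁ (refl , _)) → ⊥-elim (np z) }
        main (yes pZ) (yes qZ) (yes pb) (yes qb) = intact λ { z (inj₁ (refl , refl)) → qb ; z (inj₂ (refl , refl)) → pb }

  module _ {x y : Fin n} (xU : x ∈ U) (yN : y ∈ U ∖ X) (exy : E G x y) where
    open Contraction G x y
    private
      yU = proj₁ yN
      yX = proj₂ yN
      U/ = U ∖ ⁅ y ⁆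
      U/<U : # U/ < # U
      U/<U = #-strict U/ U y proj₁ yU λ p → proj₂ p refl

    contraction-dense : ∀ c c′ → c + α * # (U ∖ X) ≤ ρ U G (U ∖ X) → c′ + (1 + # (clash U X)) ≤ c + α →
                        c′ + α * # (U/ ∖ X) ≤ ρ U/ G/ (U/ ∖ X)
    contraction-dense c c′ h k = ≮⇒≥ λ bad → linarith
      (c ∷ c′ ∷ α ∷ # (clash U X) ∷ α * # (U ∖ X) ∷ α * # (U/ ∖ X) ∷ ρ U G (U ∖ X) ∷ ρ U/ G/ (U/ ∖ X) ∷ [])
      (num 1 ⊕ v₇ ≼ v₁ ⊕ v₅ ∷ v₀ ⊕ v₄ ≼ v₆ ∷ v₁ ⊕ (num 1 ⊕ v₃) ≼ v₀ ⊕ v₂ ∷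
       v₆ ≼ v₇ ⊕ (num 1 ⊕ v₃) ∷ v₂ ⊕ v₅ ≼ v₄ ∷ [])
      (bad , h , k , ρ-contract U X xU yU yX exy , weights , tt)
      where
      weights : α + α * # (U/ ∖ X) ≤ α * # (U ∖ X)
      weights = ≤-trans (≤-reflexive (cong (_+ α * # (U/ ∖ X)) (sym (*-identityʳ α))))
        (*-pack α {1} {# (U/ ∖ X)} {# (U ∖ X)}
          (#-strict (U/ ∖ X) (U ∖ X) y (λ p → proj₁ (proj₁ p) , proj₂ p) yN λ p → proj₂ (proj₁ p) refl))

    -- A set that is too dense after the contraction is traced back to G. If x ∈ Z, then y joins Z;
    -- if x ∉ Z ∪ S, the separation exists in G already; if x ∈ S, then y joins the boundary, which
    -- may become as large as X.
    no-contraction : # (clash U X) < α → Slack α U/ G/ X f → ⊥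
    no-contraction few sl = em (Sparse α U/ G/ X) λ
      { (inj₁ sp) → fail (Sol-⊆ [ proj₁ , (λ { refl → yU }) ]′
          (lift-sol {U/} {X} {X} exy (λ p → proj₂ p refl) X⊆U/ (λ p _ → p) (λ p → ⊥-elim (yX p))
            (ih U/ G/ X f U/<U record
              { X⊆U = X⊆U/ ; order = order ; lab = lab
              ; dense = contraction-dense 1 1 dense (s≤s few)
              ; slack = sl ; sparse = sp })))
      ; (inj₂ nsp) → minimal-dense α nsp violation }
      where
      X⊆U/ : X ⊆ U/
      X⊆U/ p = X⊆U p , λ { refl → yX p }
      violation : ∀ Z S → Separation U/ G/ X Z S → # S < # X → α * # Z < ρ U/ G/ Z →
                  (∀ Z′ S′ → Separation U/ G/ X Z′ S′ → # S′ < # S → ρ U/ G/ Z′ ≤ α * # Z′) → ⊥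
      violation Z S sep lt dn mn = cases (dec Z x) (dec S x)
        where
        open Separation sep
        S≤α : # S ≤ α
        S≤α = ≤-pred (≤-trans lt order)
        rig : Rigid (Z ∪ S) G/ S
        rig f′ lab′ = rigid-sep α ih sep (≤-trans (s≤s (#-mono (Z ∪ S) U/ [ Z⊆U , S⊆U ]′)) U/<U)
          (≤-trans S≤α (n≤1+n α)) dn mn f′ lab′ (inj₁ S≤α)
        y-out : y ∉ Z ∪ S
        y-out (inj₁ z) = proj₂ (Z⊆U z) refl
        y-out (inj₂ s) = proj₂ (S⊆U s) refl
        toX : ∀ {z} → z ∈ Z → x ∉ Z → E G z y → x ∈ Z ⊎ x ∈ S
        toX {z} zZ nx e = closed zZ (xU , x≢y U X xU yU yX exy) (inj₂ (inj₂ (refl , esym G e , λ { refl → nx zZ })))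
        cases : Dec (x ∈ Z) → Dec (x ∈ S) → ⊥
        cases (yes xZ) _ = no-rigid α M ih fail (# (U ∖ (Z ∪ ⁅ y ⁆))) (Z ∪ ⁅ y ⁆) S ≤-refl sep⁺ lt (x , inj₁ xZ) rig⁺
          where
          cl : ∀ {z w} → z ∈ Z ∪ ⁅ y ⁆ → w ∈ U → E G z w → w ∈ Z ∪ ⁅ y ⁆ ⊎ w ∈ S
          cl {z} {w} zZ wU e with w ≟ᶠ y
          ... | yes eq = inj₁ (inj₂ eq)
          cl (inj₁ z) wU e | no ne = [ (λ r → inj₁ (inj₁ r)) , inj₂ ]′ (closed z (wU , ne) (inj₁ e))
          cl {w = w} (inj₂ refl) wU e | no ne with w ≟ᶠ x
          ... | yes refl = inj₁ (inj₁ xZ)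
          ... | no nx = [ (λ r → inj₁ (inj₁ r)) , inj₂ ]′ (closed xZ (wU , ne) (inj₂ (inj₁ (refl , e , nx))))
          sep⁺ : Separation U G X (Z ∪ ⁅ y ⁆) S
          sep⁺ = record
            { Z⊆U = λ { (inj₁ z) → proj₁ (Z⊆U z) ; (inj₂ refl) → yU } ; S⊆U = λ s → proj₁ (S⊆U s)
            ; Z∩S = λ { (inj₁ z) s → Z∩S z s ; (inj₂ refl) s → proj₂ (S⊆U s) refl }
            ; X∩Z = λ { p (inj₁ z) → X∩Z p z ; p (inj₂ refl) → yX p } ; closed = cl }
          rig⁺ : Rigid ((Z ∪ ⁅ y ⁆) ∪ S) G S
          rig⁺ f′ lab′ = Sol-⊆ (λ { (inj₁ (inj₁ z)) → inj₁ (inj₁ z) ; (inj₁ (inj₂ s)) → inj₂ s ; (inj₂ e) → inj₁ (inj₂ e) })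
            (lift-sol {Z ∪ S} exy y-out inj₂ (λ p _ → p) (λ p → ⊥-elim (y-out (inj₂ p))) (rig f′ lab′))
        cases (no nx) (no ns) = <⇒≱ (≤-trans dn (ρ-shrinks U X xU yU yX exy Z Z⊆U nx)) (sparse Z S record
          { Z⊆U = λ z → proj₁ (Z⊆U z) ; S⊆U = λ s → proj₁ (S⊆U s) ; Z∩S = Z∩S ; X∩Z = X∩Z
          ; closed = cl } lt)
          where
          cl : ∀ {z w} → z ∈ Z → w ∈ U → E G z w → w ∈ Z ⊎ w ∈ S
          cl {z} {w} zZ wU e with w ≟ᶠ y
          ... | yes refl = ⊥-elim ([ nx , ns ]′ (toX zZ nx e))
          ... | no ne = closed zZ (wU , ne) (inj₁ e)
        cases (no nx) (yes xS) = no-rigid-boundary α M ih fail sep⁺ lt yX dn⁺ rig⁺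
          where
          S⁺ = S ∪ ⁅ y ⁆
          cl : ∀ {z w} → z ∈ Z → w ∈ U → E G z w → w ∈ Z ⊎ w ∈ S⁺
          cl {z} {w} zZ wU e with w ≟ᶠ y
          ... | yes eq = inj₂ (inj₂ eq)
          ... | no ne = [ inj₁ , (λ s → inj₂ (inj₁ s)) ]′ (closed zZ (wU , ne) (inj₁ e))
          sep⁺ : Separation U G X Z S⁺
          sep⁺ = record
            { Z⊆U = λ z → proj₁ (Z⊆U z) ; S⊆U = λ { (inj₁ s) → proj₁ (S⊆U s) ; (inj₂ refl) → yU }
            ; Z∩S = λ { z (inj₁ s) → Z∩S z s ; z (inj₂ refl) → proj₂ (Z⊆U z) refl } ; X∩Z = X∩Z ; closed = cl }
          dn⁺ : α * # Z < ρ U G Z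
          dn⁺ = ≤-trans dn (ρ-shrinks U X xU yU yX exy Z Z⊆U nx)
          common? : Dec (∃ λ z → z ∈ Z × E G z x × E G z y)
          common? = any? (λ z → dec Z z ×-dec E? G z x ×-dec E? G z y)
          -- A common neighbour of x and y in Z means that two edges were merged, so G has one more
          -- edge at Z and surplus 2. Without one, x and y are a `Joint` pair.
          slack⁺ : ∀ f′ → f′ x ≢ f′ y → Slack α (Z ∪ S⁺) G S⁺ f′
          slack⁺ f′ ne with common?
          ... | no none = inj₂ (inj₂ (x , y , inj₁ xS , inj₂ refl , ne , λ
                  { (inj₁ z , _) a b → none (_ , z , a , b) ; (inj₂ s , ns) _ _ → ns s }))
          ... | yes (z , zZ , a , b) = slack-two sep⁺ (≤-trans (s≤s dn) (ρ-shrinks-strictly U X xU yU yX exy Z Z⊆U nx zZ a b))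
          -- Equal labels at x and y are solved in the contracted graph, different ones by means of
          -- `slack⁺`.
          rig⁺ : Rigid (Z ∪ S⁺) G S⁺
          rig⁺ f′ lab′@(b₁ , b₂ , lb) with f′ x ≟ᵇ f′ y
          ... | no ne = boundary-sol α M ih fail sep⁺ lt yX dn⁺ f′ lab′ (slack⁺ f′ ne)
          ... | yes eq = Sol-⊆ (λ { (inj₁ (inj₁ z)) → inj₁ z ; (inj₁ (inj₂ s)) → inj₂ (inj₁ s) ; (inj₂ e) → inj₂ (inj₂ e) })
              (lift-sol {Z ∪ S} {S⁺ = S⁺} exy y-out inj₂ (λ { (inj₁ s) _ → s ; (inj₂ e) ne → ⊥-elim (ne e) }) (λ _ → xS , eq)
                (rig f′ (b₁ , b₂ , λ s → lb (inj₁ s))))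

-- The neighbourhood of a vertex of small degree

module _ {n : ℕ} where

  #-pack₃ : ∀ (P Q R S : DSet n) → P ⊆ S → Q ⊆ S → R ⊆ S → (∀ {v} → v ∈ P → v ∉ Q) → (∀ {v} → v ∈ P → v ∉ R) →
            (∀ {v} → v ∈ Q → v ∉ R) → # P + (# Q + # R) ≤ # S
  #-pack₃ P Q R S p q r pq pr qr = ≤-trans (+-mono-≤ (≤-refl {# P}) (#-pack Q R (Q ∪ R) inj₁ inj₂ qr))
    (#-pack P (Q ∪ R) S p [ q , r ]′ λ a → [ pq a , pr a ]′)

  #-cover₃ : ∀ (P Q R S : DSet n) → P ⊆ Q ∪ (R ∪ S) → # P ≤ # Q + (# R + # S)
  #-cover₃ P Q R S h = ≤-trans (#-cover P Q (R ∪ S) h) (+-mono-≤ (≤-refl {# Q}) (#-cover (R ∪ S) R S id))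

  #-suc : ∀ (P Q : DSet n) x → x ∉ P → P ⊆ Q → x ∈ Q → 1 + # P ≤ # Q
  #-suc P Q x nx pq xq = #-strict P Q x pq xq nx

  #-remove : ∀ (Q : DSet n) x → x ∈ Q → 1 + # (Q ∖ ⁅ x ⁆) ≤ # Q
  #-remove Q x xq = #-strict (Q ∖ ⁅ x ⁆) Q x proj₁ xq λ p → proj₂ p refl

  -- Let b₁ and b₂ be the terminals in S labelled false and A the others. Either y can join A
  -- and b₁, b₂ are joined through W = H ∖ S, or y joins b₁ to b₂ and A is joined through W.
  -- If both fail, W splits between b₁ and b₂, and A ∪ W splits into halves P and Q; then no
  -- block is large enough for the degrees, of which only π and non-neighbours of π outside
  -- X may fall short of α, by δ ≤ 1.
  module Neighbourhood (α : ℕ) (U : DSet n) (G : Gr n) (X : DSet n) (y : Fin n) where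

    H : DSet n
    H = nbr G U y

    clash : Fin n → DSet n
    clash x = Contraction.clash G x y U X

    -- The case δ = 1 comes from a `Joint` pair of which π is the vertex adjacent to y; `size` then
    -- pays one unit for the missing degree.
    record Dense (δ : ℕ) (π : Fin n) : Set where
      field
        low   : ∀ {x} → x ∈ H → α ≤ δ + # (clash x)
        high  : ∀ {x} → x ∈ H → α ≤ # (clash x) ⊎ (δ ≡ 1 × (π ∈ X × π ∈ H) × (x ≡ π ⊎ (x ∉ X × ¬ E G x π)))
        size  : # H + (# (X ∩ H) + δ) ≤ 1 + (α + α)
        δ≤φ   : δ ≤ # (X ∩ H)

    module _ {δ π} (D : Dense δ π) (S : DSet n) (S⊆H : S ⊆ H) (S≤ : # S ≤ 1 + α)
             (XS : ∀ {v} → v ∈ X → v ∈ H → v ∈ S) where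
      open Dense D

      W : DSet n
      W = H ∖ S

      W∩X : ∀ {v} → v ∈ W → v ∉ X
      W∩X w x = proj₂ w (XS x (proj₁ w))

      module Counting (b₁ b₂ : Fin n) (b₁S : b₁ ∈ S) (b₂S : b₂ ∈ S) (b₁≢b₂ : b₁ ≢ b₂) where

        End : Fin n → Set
        End v = v ≡ b₁ ⊎ v ≡ b₂

        A B : DSet n
        A = dset (λ v → v ∈ S × ¬ End v) (λ v → dec S v ×-dec ¬? (v ≟ᶠ b₁ ⊎-dec v ≟ᶠ b₂))
        B = dset (λ v → End v × v ∈ X) (λ v → (v ≟ᶠ b₁ ⊎-dec v ≟ᶠ b₂) ×-dec dec X v)

        -- R is one side of the graph on W and both ends, once b₁ and b₂ are known not to be joined
        -- there.
        record Side (b : Fin n) (R : DSet n) : Set where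
          field
            end   : End b
            own   : ∀ {v} → End v → v ∈ R → v ≡ b
            home  : b ∈ R
            stays : ∀ {u v} → u ∈ R → v ∈ W ⊎ End v → E G u v → v ∈ R

        record Halves (P Q : DSet n) : Set where
          field
            cover : ∀ {v} → v ∈ A ⊎ v ∈ W → v ∈ P ⊎ v ∈ Q
            apart : ∀ {v} → v ∈ P → v ∉ Q
            cut   : ∀ {u v} → u ∈ P → v ∈ Q → ¬ E G u v

        swapʰ : ∀ {P Q} → Halves P Q → Halves Q P
        swapʰ h = record { cover = λ p → [ inj₂ , inj₁ ]′ (cover p) ; apart = λ q p → apart p q ; cut = λ q p e → cut p q (esym G e) }
          where open Halves h

        A⊆H : A ⊆ H
        A⊆H a = S⊆H (proj₁ a)

        End⊆S : ∀ {v} → End v → v ∈ S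
        End⊆S (inj₁ refl) = b₁S
        End⊆S (inj₂ refl) = b₂S

        place : ∀ {v} → v ∈ H → v ∈ W ⊎ (End v ⊎ v ∈ A)
        place {v} h with dec S v
        ... | no ns = inj₁ (h , ns)
        ... | yes s with v ≟ᶠ b₁ ⊎-dec v ≟ᶠ b₂
        ... | yes e = inj₂ (inj₁ e)
        ... | no ne = inj₂ (inj₂ (s , ne))

        inH : ∀ {x w} → w ∈ clash x → w ∈ H
        inH (u , e , _) = u , e

        real : ∀ {x w} → x ∉ X ⊎ w ∉ X → w ∈ clash x → E G x w
        real _ (_ , _ , _ , inj₁ e) = e
        real (inj₁ nx) (_ , _ , _ , inj₂ (x , _)) = ⊥-elim (nx x)
        real (inj₂ nw) (_ , _ , _ , inj₂ (_ , w)) = ⊥-elim (nw w)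

        self : ∀ {x} → x ∉ clash x
        self (_ , _ , ne , _) = ne refl

        Ends : DSet n
        Ends = ⁅ b₁ ⁆ ∪ ⁅ b₂ ⁆

        #Ends≤ : # Ends ≤ 2
        #Ends≤ = ≤-trans (#-insert ⁅ b₁ ⁆ b₂) (s≤s (≤-reflexive (#-⁅⁆ b₁)))

        #Ends≥ : 2 ≤ # Ends
        #Ends≥ = #-pair Ends (inj₁ refl) (inj₂ refl) b₁≢b₂

        module _ {P Q : DSet n} (h : Halves P Q) where
          open Halves h

          AP AQ : DSet n
          AP = A ∩ P
          AQ = A ∩ Q

          private
            terminals : # AP + (# AQ + # Ends) ≤ # S
            terminals = #-pack₃ AP AQ Ends S (λ a → proj₁ (proj₁ a)) (λ a → proj₁ (proj₁ a)) End⊆S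
              (λ a q → apart (proj₂ a) (proj₂ q)) (λ a e → proj₂ (proj₁ a) e) (λ a e → proj₂ (proj₁ a) e)

          count-S : 1 + (# AP + # AQ) ≤ α
          count-S = ≮⇒≥ λ bad → linarith (α ∷ # AP ∷ # AQ ∷ # Ends ∷ # S ∷ [])
            (num 1 ⊕ v₀ ≼ num 1 ⊕ (v₁ ⊕ v₂) ∷ num 2 ≼ v₃ ∷ v₁ ⊕ (v₂ ⊕ v₃) ≼ v₄ ∷ v₄ ≼ num 1 ⊕ v₀ ∷ [])
            (bad , #Ends≥ , terminals , S≤ , tt)

          count-φ : # (AP ∩ X) + (# (AQ ∩ X) + # B) ≤ # (X ∩ H)
          count-φ = #-pack₃ (AP ∩ X) (AQ ∩ X) B (X ∩ H) (λ a → proj₂ a , A⊆H (proj₁ (proj₁ a))) (λ a → proj₂ a , A⊆H (proj₁ (proj₁ a)))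
            (λ e → proj₂ e , S⊆H (End⊆S (proj₁ e))) (λ a q → apart (proj₂ (proj₁ a)) (proj₂ (proj₁ q)))
            (λ a e → proj₂ (proj₁ (proj₁ a)) (proj₁ e)) (λ a e → proj₂ (proj₁ (proj₁ a)) (proj₁ e))

          count-H : # W + (# AP + # AQ) + 2 ≤ # H
          count-H = ≮⇒≥ λ bad → linarith (# W ∷ # AP ∷ # AQ ∷ # Ends ∷ # S ∷ # H ∷ [])
            (num 1 ⊕ v₅ ≼ v₀ ⊕ (v₁ ⊕ v₂) ⊕ num 2 ∷ num 2 ≼ v₃ ∷ v₁ ⊕ (v₂ ⊕ v₃) ≼ v₄ ∷ v₀ ⊕ v₄ ≼ v₅ ∷ [])
            (bad , #Ends≥ , terminals , #-pack W S H proj₁ S⊆H proj₂ , tt)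

          -- A free vertex sees only its own half and at most one end.
          clash-W : ∀ {w b R} → Side b R → w ∈ W → w ∈ P → w ∈ R → # (clash w) ≤ # (W ∩ P) + # AP
          clash-W {w} {b} {R} sd wW wP wR = ≮⇒≥ λ bad → linarith
            (# (clash w) ∷ # (W ∩ P) ∷ # AP ∷ # N ∷ # ⁅ b ⁆ ∷ [])
            (num 1 ⊕ (v₁ ⊕ v₂) ≼ v₀ ∷ num 1 ⊕ v₀ ≼ v₃ ∷ v₃ ≼ v₁ ⊕ (v₂ ⊕ v₄) ∷ v₄ ≼ num 1 ∷ [])
            (bad , #-suc (clash w) N w self into (inj₁ (wW , wP)) , #-cover₃ N (W ∩ P) AP ⁅ b ⁆ id , ≤-reflexive (#-⁅⁆ b) , tt)
            where
            open Side sd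
            N : DSet n
            N = (W ∩ P) ∪ (AP ∪ ⁅ b ⁆)
            into : clash w ⊆ N
            into {v} c with real (inj₁ (W∩X wW)) c | place (inH {w} c)
            ... | e | inj₁ vW with cover (inj₂ vW)
            ... | inj₁ p = inj₁ (vW , p)
            ... | inj₂ q = ⊥-elim (cut wP q e)
            into {v} c | e | inj₂ (inj₁ ve) = inj₂ (inj₂ (own ve (stays wR (inj₂ ve) e)))
            into {v} c | e | inj₂ (inj₂ vA) with cover (inj₁ vA)
            ... | inj₁ p = inj₂ (inj₁ (vA , p))
            ... | inj₂ q = ⊥-elim (cut wP q e)

          -- A free vertex in each half gives 2α ≤ |W| + |A| + 2δ. But `size` gives |W| + |A| ≤ |H|
          -- - 2 ≤ 2α - 1 - |X ∩ H| - δ, and δ ≤ |X ∩ H|.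
          free-halves : ∀ {w w′ b b′ R R′} → Side b R → Side b′ R′ → w ∈ R → w′ ∈ R′ →
                        w ∈ W → w ∈ P → w′ ∈ W → w′ ∈ Q → # (clash w′) ≤ # (W ∩ Q) + # AQ → ⊥
          free-halves {w} {w′} sd sd′ wR wR′ wW wP wW′ wQ′ bound = linarith
            (α ∷ δ ∷ # (clash w) ∷ # (clash w′) ∷ # (W ∩ P) ∷ # AP ∷ # (W ∩ Q) ∷ # AQ ∷ # W ∷ # H ∷ # (X ∩ H) ∷ [])
            (v₀ ≼ v₁ ⊕ v₂ ∷ v₀ ≼ v₁ ⊕ v₃ ∷ v₂ ≼ v₄ ⊕ v₅ ∷ v₃ ≼ v₆ ⊕ v₇ ∷ v₄ ⊕ v₆ ≼ v₈ ∷
             v₈ ⊕ (v₅ ⊕ v₇) ⊕ num 2 ≼ v₉ ∷ v₉ ⊕ (v₁₀ ⊕ v₁) ≼ num 1 ⊕ (v₀ ⊕ v₀) ∷ v₁ ≼ v₁₀ ∷ [])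
            (low (proj₁ wW) , low (proj₁ wW′) , clash-W sd wW wP wR , bound
              , #-pack (W ∩ P) (W ∩ Q) W proj₁ proj₁ (λ p q → apart (proj₂ p) (proj₂ q)) , count-H , size , δ≤φ , tt)

        #A≤ : ∀ {P Q} → Halves P Q → # A ≤ # (A ∩ P) + # (A ∩ Q)
        #A≤ {P} {Q} h = #-cover A (A ∩ P) (A ∩ Q) λ a → [ (λ p → inj₁ (a , p)) , (λ q → inj₂ (a , q)) ]′ (Halves.cover h (inj₁ a))

        module _ {b R} (sd : Side b R) where
          open Side sd

          private
            b∈H : b ∈ H
            b∈H = S⊆H (End⊆S end)

          clash-end : b ∉ X → clash b ⊆ (W ∩ R) ∪ A
          clash-end nb {v} c with real (inj₁ nb) c | place (inH {b} c)
          ... | e | inj₁ w = inj₁ (w , stays home (inj₁ w) e)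
          ... | e | inj₂ (inj₁ ve) with own ve (stays home (inj₂ ve) e)
          ... | refl = ⊥-elim (eirr G e)
          clash-end nb {v} c | e | inj₂ (inj₂ a) = inj₂ a

          clash-end-X : # (clash b) ≤ # (W ∩ R) + (# A + 1)
          clash-end-X = ≤-trans (#-cover₃ (clash b) (W ∩ R) A (Ends ∖ ⁅ b ⁆) into)
            (+-mono-≤ (≤-refl {# (W ∩ R)}) (+-mono-≤ (≤-refl {# A}) (≤-pred (≤-trans (#-remove Ends b end) #Ends≤))))
            where
            into : clash b ⊆ (W ∩ R) ∪ (A ∪ (Ends ∖ ⁅ b ⁆))
            into {v} c with place (inH {b} c)
            ... | inj₁ w = inj₁ (w , stays home (inj₁ w) (real (inj₂ (W∩X w)) c))
            ... | inj₂ (inj₁ e) = inj₂ (inj₂ (e , proj₁ (proj₂ (proj₂ c))))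
            ... | inj₂ (inj₂ a) = inj₂ (inj₁ a)

          -- A deficient end outside X is not adjacent to π, which makes up for the deficiency
          -- unless π is the other end.
          end-degree : b ∉ X → α ≤ # (W ∩ R) + # A ⊎ (δ ≡ 1 × 1 ≤ # B)
          end-degree nb = go (high b∈H)
            where
            all : # (clash b) ≤ # (W ∩ R) + # A
            all = #-cover (clash b) (W ∩ R) A (clash-end nb)
            go : α ≤ # (clash b) ⊎ (δ ≡ 1 × (π ∈ X × π ∈ H) × (b ≡ π ⊎ (b ∉ X × ¬ E G b π))) →
                 α ≤ # (W ∩ R) + # A ⊎ (δ ≡ 1 × 1 ≤ # B)
            go (inj₁ h) = inj₁ (≤-trans h all)
            go (inj₂ (_ , (πX , _) , inj₁ refl)) = ⊥-elim (nb πX)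
            go (inj₂ (δ1 , (πX , πH) , inj₂ (_ , miss))) with place πH
            ... | inj₁ w = ⊥-elim (W∩X w πX)
            ... | inj₂ (inj₁ e) = inj₂ (δ1 , #-one B π (e , πX))
            ... | inj₂ (inj₂ a) = inj₁ (≤-trans (low b∈H) (≤-trans (≤-reflexive (cong (_+ # (clash b)) δ1))
                    (≤-trans (#-suc (clash b) ((W ∩ R) ∪ A) π (λ c → miss (real (inj₁ nb) c)) (clash-end nb) (inj₂ a))
                             (#-cover ((W ∩ R) ∪ A) (W ∩ R) A id))))

        record Sides (R₁ R₂ : DSet n) : Set where
          field
            side₁ : Side b₁ R₁
            side₂ : Side b₂ R₂
            split : ∀ {v} → v ∈ W → v ∈ R₁ ⊎ v ∈ R₂
            apartʳ : ∀ {v} → v ∈ R₁ → v ∉ R₂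

        -- By `free-halves` one half, here P, is without free vertices. The bound `room` is what
        -- `size` leaves after H is split into W, both halves of A and the two ends.
        module Contradiction {P Q R₁ R₂ : DSet n} (h : Halves P Q) (s : Sides R₁ R₂) (W∩P : ∀ {v} → v ∈ W → v ∉ P) where
          open Halves h
          open Sides s
          private
            p q w₁ w₂ t β φ : ℕ
            p = # (A ∩ P)
            q = # (A ∩ Q)
            w₁ = # (W ∩ R₁)
            w₂ = # (W ∩ R₂)
            t = # ((A ∩ Q) ∩ X)
            β = # B
            φ = # (X ∩ H)

            W-split : w₁ + w₂ ≤ # W
            W-split = #-pack (W ∩ R₁) (W ∩ R₂) W proj₁ proj₁ λ a b → apartʳ (proj₂ a) (proj₂ b)

            room : 1 + (w₁ + w₂ + (p + q) + (φ + δ)) ≤ α + α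
            room = ≮⇒≥ λ bad → linarith (α ∷ δ ∷ # W ∷ p ∷ q ∷ # H ∷ φ ∷ w₁ ∷ w₂ ∷ [])
              (num 1 ⊕ (v₀ ⊕ v₀) ≼ num 1 ⊕ (v₇ ⊕ v₈ ⊕ (v₃ ⊕ v₄) ⊕ (v₆ ⊕ v₁)) ∷ v₇ ⊕ v₈ ≼ v₂ ∷
               v₂ ⊕ (v₃ ⊕ v₄) ⊕ num 2 ≼ v₅ ∷ v₅ ⊕ (v₆ ⊕ v₁) ≼ num 1 ⊕ (v₀ ⊕ v₀) ∷ [])
              (bad , W-split , count-H h , size , tt)

            full : 1 + (p + q) ≤ α
            full = count-S h

            t≤q : t ≤ q
            t≤q = #-mono ((A ∩ Q) ∩ X) (A ∩ Q) proj₁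

            -- Counted are the p - 1 other vertices of A ∩ P, the two ends, and the t terminals of
            -- Q, which clash with a terminal of P without being adjacent to it.
            clash-P : ∀ {a} → a ∈ A → a ∈ P → # (clash a) ≤ p + 1 + t
            clash-P {a} aA aP = ≮⇒≥ λ bad → linarith (# (clash a) ∷ p ∷ t ∷ # Ends ∷ # N ∷ [])
              (num 1 ⊕ (v₁ ⊕ num 1 ⊕ v₂) ≼ v₀ ∷ num 1 ⊕ v₀ ≼ v₄ ∷ v₄ ≼ v₁ ⊕ (v₃ ⊕ v₂) ∷ v₃ ≼ num 2 ∷ [])
              (bad , #-suc (clash a) N a self into (inj₁ (aA , aP)) , #-cover₃ N (A ∩ P) Ends ((A ∩ Q) ∩ X) id , #Ends≤ , tt)
              where
              N : DSet n
              N = (A ∩ P) ∪ (Ends ∪ ((A ∩ Q) ∩ X))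
              into : clash a ⊆ N
              into {v} c with place (inH {a} c)
              ... | inj₂ (inj₁ e) = inj₂ (inj₁ e)
              ... | inj₁ w = ⊥-elim ([ W∩P w , (λ vq → cut aP vq (real (inj₂ (W∩X w)) c)) ]′ (cover (inj₂ w)))
              ... | inj₂ (inj₂ vA) with cover (inj₁ vA) | c
              ... | inj₁ vP | _ = inj₁ (vA , vP)
              ... | inj₂ vQ | (_ , _ , _ , inj₁ e) = ⊥-elim (cut aP vQ e)
              ... | inj₂ vQ | (_ , _ , _ , inj₂ (_ , vX)) = inj₂ (inj₂ ((vA , vQ) , vX))

            clash-P-real : ∀ {a} → a ∉ X → a ∈ A → a ∈ P → clash a ⊆ (A ∩ P) ∪ Ends
            clash-P-real {a} na aA aP {v} c with real (inj₁ na) c | place (inH {a} c)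
            ... | e | inj₂ (inj₁ ve) = inj₂ ve
            ... | e | inj₁ w = ⊥-elim ([ W∩P w , (λ vq → cut aP vq e) ]′ (cover (inj₂ w)))
            ... | e | inj₂ (inj₂ vA) = [ (λ vP → inj₁ (vA , vP)) , (λ vQ → ⊥-elim (cut aP vQ e)) ]′ (cover (inj₁ vA))

            clash-W-side : ∀ {w b R} → Side b R → w ∈ W → w ∈ R → clash w ⊆ (W ∩ R) ∪ ((A ∩ Q) ∪ ⁅ b ⁆)
            clash-W-side {w} sd wW wR {v} c with real (inj₁ (W∩X wW)) c | place (inH {w} c)
            ... | e | inj₁ vW = inj₁ (vW , Side.stays sd wR (inj₁ vW) e)
            ... | e | inj₂ (inj₁ ve) = inj₂ (inj₂ (Side.own sd ve (Side.stays sd wR (inj₂ ve) e)))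
            ... | e | inj₂ (inj₂ vA) with cover (inj₁ vA) | cover (inj₂ wW)
            ... | inj₂ vQ | _ = inj₂ (inj₁ (vA , vQ))
            ... | inj₁ _ | inj₁ wP = ⊥-elim (W∩P wW wP)
            ... | inj₁ vP | inj₂ wQ = ⊥-elim (cut vP wQ (esym G e))

            two-ends : ∀ {u v} → u ∈ X → v ∈ X → End u → End v → u ≢ v → 2 ≤ β
            two-ends uX vX eu ev = #-pair B (eu , uX) (ev , vX)

          -- As A ∩ P consists of terminals, p enters `room′` twice: as part of A and as part of X ∩
          -- H.
          module Terminal (PX : ∀ {v} → v ∈ A → v ∈ P → v ∈ X) where
            private
              room′ : 1 + (w₁ + w₂ + (p + q) + (p + t + β + δ)) ≤ α + α
              room′ = ≮⇒≥ λ bad → linarith (α ∷ δ ∷ w₁ ∷ w₂ ∷ p ∷ q ∷ φ ∷ t ∷ β ∷ # ((A ∩ P) ∩ X) ∷ [])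
                (num 1 ⊕ (v₀ ⊕ v₀) ≼ num 1 ⊕ (v₂ ⊕ v₃ ⊕ (v₄ ⊕ v₅) ⊕ (v₄ ⊕ v₇ ⊕ v₈ ⊕ v₁)) ∷
                 num 1 ⊕ (v₂ ⊕ v₃ ⊕ (v₄ ⊕ v₅) ⊕ (v₆ ⊕ v₁)) ≼ v₀ ⊕ v₀ ∷ v₄ ≼ v₉ ∷ v₉ ⊕ (v₇ ⊕ v₈) ≼ v₆ ∷ [])
                (bad , room , #-mono (A ∩ P) ((A ∩ P) ∩ X) (λ a → a , PX (proj₁ a) (proj₂ a)) , count-φ h , tt)

            -- Full degree at a leaves one unit for w₁, w₂, β and δ together. Yet each end costs
            -- one: an end in X counts in β, and an end outside X needs a neighbour in W, since A
            -- has fewer than α vertices, or else δ and β are both positive.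
            replete : ∀ {a} → a ∈ A → a ∈ P → ¬ (α ≤ # (clash a))
            replete {a} aA aP le = finish (dec X b₁) (dec X b₂)
              where
              aq : α ≤ p + 1 + t
              aq = ≤-trans le (clash-P aA aP)
              slim : w₁ + w₂ + β + δ ≤ 1
              slim = ≮⇒≥ λ bad → linarith (α ∷ p ∷ q ∷ t ∷ w₁ ∷ w₂ ∷ β ∷ δ ∷ [])
                (num 2 ≼ v₄ ⊕ v₅ ⊕ v₆ ⊕ v₇ ∷ num 1 ⊕ (v₄ ⊕ v₅ ⊕ (v₁ ⊕ v₂) ⊕ (v₁ ⊕ v₃ ⊕ v₆ ⊕ v₇)) ≼ v₀ ⊕ v₀ ∷
                 (2 · v₀ ≼ v₁ ⊕ num 1 ⊕ v₃) ∷ v₃ ≼ v₂ ∷ [])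
                (bad , room′ , aq , t≤q , tt)
              occupied : ∀ {b R} → Side b R → # (W ∩ R) ≤ w₁ + w₂ → b ∉ X → 1 ≤ # (W ∩ R)
              occupied {b} {R} sd le′ nb with end-degree sd nb
              ... | inj₁ d = ≮⇒≥ λ bad → linarith (α ∷ p ∷ q ∷ # A ∷ # (W ∩ R) ∷ [])
                (num 1 ⊕ v₄ ≼ num 1 ∷ v₀ ≼ v₄ ⊕ v₃ ∷ v₃ ≼ v₁ ⊕ v₂ ∷ num 1 ⊕ (v₁ ⊕ v₂) ≼ v₀ ∷ [])
                (bad , d , #A≤ h , full , tt)
              ... | inj₂ (refl , β1) = ⊥-elim (linarith (w₁ ∷ w₂ ∷ β ∷ [])
                (v₀ ⊕ v₁ ⊕ v₂ ⊕ num 1 ≼ num 1 ∷ num 1 ≼ v₂ ∷ []) (slim , β1 , tt))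
              finish : Dec (b₁ ∈ X) → Dec (b₂ ∈ X) → ⊥
              finish (no n₁) (no n₂) = linarith (w₁ ∷ w₂ ∷ β ∷ δ ∷ [])
                (v₀ ⊕ v₁ ⊕ v₂ ⊕ v₃ ≼ num 1 ∷ num 1 ≼ v₀ ∷ num 1 ≼ v₁ ∷ [])
                (slim , occupied side₁ (m≤m+n w₁ w₂) n₁ , occupied side₂ (m≤n+m w₂ w₁) n₂ , tt)
              finish (no n₁) (yes x₂) = linarith (w₁ ∷ w₂ ∷ β ∷ δ ∷ [])
                (v₀ ⊕ v₁ ⊕ v₂ ⊕ v₃ ≼ num 1 ∷ num 1 ≼ v₀ ∷ num 1 ≼ v₂ ∷ [])
                (slim , occupied side₁ (m≤m+n w₁ w₂) n₁ , #-one B b₂ (inj₂ refl , x₂) , tt)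
              finish (yes x₁) (no n₂) = linarith (w₁ ∷ w₂ ∷ β ∷ δ ∷ [])
                (v₀ ⊕ v₁ ⊕ v₂ ⊕ v₃ ≼ num 1 ∷ num 1 ≼ v₁ ∷ num 1 ≼ v₂ ∷ [])
                (slim , occupied side₂ (m≤n+m w₂ w₁) n₂ , #-one B b₁ (inj₁ refl , x₁) , tt)
              finish (yes x₁) (yes x₂) = linarith (w₁ ∷ w₂ ∷ β ∷ δ ∷ [])
                (v₀ ⊕ v₁ ⊕ v₂ ⊕ v₃ ≼ num 1 ∷ num 2 ≼ v₂ ∷ [])
                (slim , two-ends x₁ x₂ (inj₁ refl) (inj₂ refl) b₁≢b₂ , tt)

            -- Only π can lack full degree in A ∩ P. If π is alone there, then p = 1 and α ≤ 3 + t,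
            -- and the degrees of the ends exceed the available room.
            terminal : ∀ {a} → a ∈ A → a ∈ P → ⊥
            terminal {a} aA aP with high (A⊆H aA)
            ... | inj₁ le = replete aA aP le
            ... | inj₂ (_ , _ , inj₂ (na , _)) = na (PX aA aP)
            ... | inj₂ (refl , (πX , πH) , inj₁ refl) with any-∈ ((A ∩ P) ∖ ⁅ a ⁆)
            ... | yes (a′ , (aA′ , aP′) , ne) with high (A⊆H aA′)
            ... | inj₁ le = replete aA′ aP′ le
            ... | inj₂ (_ , _ , inj₁ e) = ne e
            ... | inj₂ (_ , _ , inj₂ (na , _)) = na (PX aA′ aP′)
            terminal {a} aA aP | inj₂ (refl , (πX , πH) , inj₁ refl) | no none = finish (dec X b₁) (dec X b₂)
              where
              p≤1 : p ≤ 1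
              p≤1 = ≤-trans (#-mono (A ∩ P) ⁅ a ⁆ (∖-empty (A ∩ P) ⁅ a ⁆ none))
                            (≤-reflexive (#-⁅⁆ a))
              p≥1 : 1 ≤ p
              p≥1 = #-one (A ∩ P) a (aA , aP)
              few : α ≤ 3 + t
              few = ≮⇒≥ λ bad → linarith (α ∷ # (clash a) ∷ p ∷ t ∷ [])
                (num 1 ⊕ (num 3 ⊕ v₃) ≼ v₀ ∷ v₀ ≼ num 1 ⊕ v₁ ∷ v₁ ≼ v₂ ⊕ num 1 ⊕ v₃ ∷ v₂ ≼ num 1 ∷ [])
                (bad , low (A⊆H aA) , clash-P aA aP , p≤1 , tt)
              reach-end : ∀ {b R} → Side b R → b ∉ X → α ≤ # (W ∩ R) + # A
              reach-end {b} {R} sd nb with high (S⊆H (End⊆S (Side.end sd)))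
              ... | inj₁ le = ≤-trans le (#-cover (clash b) (W ∩ R) A (clash-end sd nb))
              ... | inj₂ (_ , _ , inj₁ refl) = ⊥-elim (nb πX)
              ... | inj₂ (_ , _ , inj₂ (_ , miss)) = ≤-trans (low (S⊆H (End⊆S (Side.end sd))))
                    (≤-trans (#-suc (clash b) ((W ∩ R) ∪ A) a (λ c → miss (real (inj₁ nb) c)) (clash-end sd nb) (inj₂ aA))
                             (#-cover ((W ∩ R) ∪ A) (W ∩ R) A id))
              one-end : ∀ w w′ → w + w′ ≤ w₁ + w₂ → α ≤ w + # A → 1 ≤ β → ⊥
              one-end w w′ ww d β1 = linarith (α ∷ p ∷ q ∷ # A ∷ w ∷ w′ ∷ w₁ ∷ w₂ ∷ t ∷ β ∷ [])
                (v₀ ≼ v₄ ⊕ v₃ ∷ v₃ ≼ v₁ ⊕ v₂ ∷ v₄ ⊕ v₅ ≼ v₆ ⊕ v₇ ∷ num 1 ≼ v₉ ∷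
                 num 1 ⊕ (v₆ ⊕ v₇ ⊕ (v₁ ⊕ v₂) ⊕ (v₁ ⊕ v₈ ⊕ v₉ ⊕ num 1)) ≼ v₀ ⊕ v₀ ∷ v₀ ≼ num 3 ⊕ v₈ ∷ num 1 ≼ v₁ ∷ [])
                (d , #A≤ h , ww , β1 , room′ , few , p≥1 , tt)
              finish : Dec (b₁ ∈ X) → Dec (b₂ ∈ X) → ⊥
              finish (no n₁) (no n₂) = linarith (α ∷ p ∷ q ∷ # A ∷ w₁ ∷ w₂ ∷ t ∷ β ∷ [])
                (v₀ ≼ v₄ ⊕ v₃ ∷ v₀ ≼ v₅ ⊕ v₃ ∷ (2 · v₃ ≼ v₁ ⊕ v₂) ∷
                 num 1 ⊕ (v₄ ⊕ v₅ ⊕ (v₁ ⊕ v₂) ⊕ (v₁ ⊕ v₆ ⊕ v₇ ⊕ num 1)) ≼ v₀ ⊕ v₀ ∷ v₀ ≼ num 3 ⊕ v₆ ∷ num 1 ⊕ (v₁ ⊕ v₂) ≼ v₀ ∷ num 1 ≼ v₁ ∷ [])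
                (reach-end side₁ n₁ , reach-end side₂ n₂ , #A≤ h , room′ , few , full , p≥1 , tt)
              finish (no n₁) (yes x₂) = one-end w₁ w₂ ≤-refl (reach-end side₁ n₁) (#-one B b₂ (inj₂ refl , x₂))
              finish (yes x₁) (no n₂) = one-end w₂ w₁ (≤-reflexive (+-comm w₂ w₁)) (reach-end side₂ n₂) (#-one B b₁ (inj₁ refl , x₁))
              finish (yes x₁) (yes x₂) with high (S⊆H b₁S)
              ... | inj₂ (_ , _ , inj₁ refl) = proj₂ aA (inj₁ refl)
              ... | inj₂ (_ , _ , inj₂ (na , _)) = na x₁
              ... | inj₁ le = linarith (α ∷ p ∷ q ∷ # A ∷ w₁ ∷ w₂ ∷ t ∷ β ∷ # (clash b₁) ∷ [])
                (v₀ ≼ v₈ ∷ v₈ ≼ v₄ ⊕ (v₃ ⊕ num 1) ∷ v₃ ≼ v₁ ⊕ v₂ ∷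
                 num 1 ⊕ (v₄ ⊕ v₅ ⊕ (v₁ ⊕ v₂) ⊕ (v₁ ⊕ v₆ ⊕ v₇ ⊕ num 1)) ≼ v₀ ⊕ v₀ ∷ v₀ ≼ num 3 ⊕ v₆ ∷ num 2 ≼ v₇ ∷ num 1 ≼ v₁ ∷ [])
                (le , clash-end-X side₁ , #A≤ h , room′ , few , two-ends x₁ x₂ (inj₁ refl) (inj₂ refl) b₁≢b₂ , p≥1 , tt)

          -- Here Q turns out to consist of the deficient vertex alone.
          lonely : ∀ {a a′} → a ∈ A → a ∈ P → a ∉ X → a′ ∈ A → a′ ∈ Q →
                   (∀ {v} → v ∈ W → v ∉ Q) × (∀ {v} → v ∈ A → v ∈ Q → v ∈ X)
          lonely {a} {a′} aA aP na aA′ aQ′ with high (A⊆H aA)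
          ... | inj₁ le = ⊥-elim (linarith (α ∷ p ∷ q ∷ # (clash a) ∷ # ((A ∩ P) ∪ Ends) ∷ # Ends ∷ [])
                  (v₀ ≼ v₃ ∷ num 1 ⊕ v₃ ≼ v₄ ∷ v₄ ≼ v₁ ⊕ v₅ ∷ v₅ ≼ num 2 ∷ num 1 ⊕ (v₁ ⊕ v₂) ≼ v₀ ∷ num 1 ≼ v₂ ∷ [])
                  (le , #-suc (clash a) ((A ∩ P) ∪ Ends) a self (clash-P-real na aA aP) (inj₁ (aA , aP))
                      , #-cover ((A ∩ P) ∪ Ends) (A ∩ P) Ends id , #Ends≤ , full , #-one (A ∩ Q) a′ (aA′ , aQ′) , tt))
          ... | inj₂ (_ , (πX , _) , inj₁ refl) = ⊥-elim (na πX)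
          ... | inj₂ (refl , (πX , πH) , inj₂ (_ , miss)) = no-free , λ {v} vA vQ → case v ≟ᶠ π of λ
                  { (yes refl) → πX
                  ; (no ne) → ⊥-elim (linarith (q ∷ []) (v₀ ≼ num 1 ∷ num 2 ≼ v₀ ∷ [])
                      (q≤1 , #-pair (A ∩ Q) (vA , vQ) π∈Q ne , tt)) }
            where
            V = (A ∩ P) ∪ Ends
            V≤ : # V ≤ p + 2
            V≤ = ≤-trans (#-cover V (A ∩ P) Ends id) (+-mono-≤ (≤-refl {p}) #Ends≤)
            a-low : α ≤ 1 + # (clash a)
            a-low = low (A⊆H aA)
            -- If π ∈ V, then a misses itself and π, so that α ≤ p + 1, while `full` and q ≥ 1 give
            -- α ≥ p + 2.
            π∉V : π ∉ V
            π∉V πV = linarith (α ∷ p ∷ q ∷ # (clash a) ∷ # (V ∖ ⁅ π ⁆) ∷ # V ∷ [])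
                  (v₀ ≼ num 1 ⊕ v₃ ∷ num 1 ⊕ v₃ ≼ v₄ ∷ num 1 ⊕ v₄ ≼ v₅ ∷ v₅ ≼ v₁ ⊕ num 2 ∷ num 1 ⊕ (v₁ ⊕ v₂) ≼ v₀ ∷ num 1 ≼ v₂ ∷ [])
                  (a-low , #-suc (clash a) (V ∖ ⁅ π ⁆) a self (λ c → clash-P-real na aA aP c , λ { refl → miss (real (inj₁ na) c) })
                                 (inj₁ (aA , aP) , λ { refl → na πX })
                         , #-remove V π πV , V≤ , full , #-one (A ∩ Q) a′ (aA′ , aQ′) , tt)
            π∈Q : π ∈ A ∩ Q
            π∈Q with place πH
            ... | inj₁ w = ⊥-elim (W∩X w πX)
            ... | inj₂ (inj₁ e) = ⊥-elim (π∉V (inj₂ e))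
            ... | inj₂ (inj₂ πA) with cover (inj₁ πA)
            ... | inj₁ πP = ⊥-elim (π∉V (inj₁ (πA , πP)))
            ... | inj₂ πQ = πA , πQ
            tight : α ≤ p + 2
            tight = ≤-trans a-low (≤-trans (#-suc (clash a) V a self (clash-P-real na aA aP) (inj₁ (aA , aP))) V≤)
            q≤1 : q ≤ 1
            q≤1 = ≮⇒≥ λ bad → linarith (α ∷ p ∷ q ∷ []) (num 2 ≼ v₂ ∷ v₀ ≼ v₁ ⊕ num 2 ∷ num 1 ⊕ (v₁ ⊕ v₂) ≼ v₀ ∷ []) (bad , tight , full , tt)
            -- A free vertex lies in Q and gives α ≤ |W ∩ R| + q. Together with α ≤ p + 2 this
            -- overruns `room`, where φ ≥ 1 because of π.
            side-free : ∀ {w b R} → Side b R → # (W ∩ R) ≤ w₁ + w₂ → w ∈ W → w ∈ R → ⊥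
            side-free {w} {b} {R} sd le wW wR = linarith (α ∷ p ∷ q ∷ w₁ ∷ w₂ ∷ φ ∷ # (W ∩ R) ∷ [])
              (v₀ ≼ v₆ ⊕ v₂ ∷ v₆ ≼ v₃ ⊕ v₄ ∷ num 1 ⊕ (v₃ ⊕ v₄ ⊕ (v₁ ⊕ v₂) ⊕ (v₅ ⊕ num 1)) ≼ v₀ ⊕ v₀ ∷ v₀ ≼ v₁ ⊕ num 2 ∷ num 1 ≼ v₅ ∷ [])
              (degree , le , room , tight , #-one (X ∩ H) π (πX , πH) , tt)
              where
              N = (W ∩ R) ∪ ((A ∩ Q) ∪ ⁅ b ⁆)
              N≤ : # N ≤ 1 + (# (W ∩ R) + q)
              N≤ = ≮⇒≥ λ bad → linarith (# N ∷ # (W ∩ R) ∷ # ⁅ b ⁆ ∷ q ∷ [])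
                (num 1 ⊕ (num 1 ⊕ (v₁ ⊕ v₃)) ≼ v₀ ∷ v₀ ≼ v₁ ⊕ (v₃ ⊕ v₂) ∷ v₂ ≼ num 1 ∷ [])
                (bad , #-cover₃ N (W ∩ R) (A ∩ Q) ⁅ b ⁆ id , ≤-reflexive (#-⁅⁆ b) , tt)
              degree : α ≤ # (W ∩ R) + q
              degree with high (proj₁ wW)
              ... | inj₁ d = ≤-pred (≤-trans (s≤s d) (≤-trans (#-suc (clash w) N w self (clash-W-side sd wW wR) (inj₁ (wW , wR))) N≤))
              ... | inj₂ (_ , _ , inj₁ refl) = ⊥-elim (W∩X wW πX)
              ... | inj₂ (_ , _ , inj₂ (_ , miss′)) = ≤-pred (≤-trans (s≤s (low (proj₁ wW)))
                    (≤-trans (s≤s (#-suc (clash w) (N ∖ ⁅ π ⁆) w self (λ c → clash-W-side sd wW wR c , λ { refl → miss′ (real (inj₁ (W∩X wW)) c) })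
                                       (inj₁ (wW , wR) , λ { refl → W∩X wW πX })))
                      (≤-trans (#-remove N π (inj₂ (inj₁ π∈Q))) N≤)))
            no-free : ∀ {v} → v ∈ W → v ∉ Q
            no-free w _ = [ side-free side₁ (m≤m+n w₁ w₂) w , side-free side₂ (m≤n+m w₂ w₁) w ]′ (split w)

        -- If A ∩ P has a vertex outside X, then by `lonely` the half Q is free of W and A ∩ Q
        -- consists of terminals, so the halves exchange roles.
        refuted : ∀ {P Q R₁ R₂ a a′} → Halves P Q → Sides R₁ R₂ → (∀ {v} → v ∈ W → v ∉ P) →
                  a ∈ A → a ∈ P → a′ ∈ A → a′ ∈ Q → ⊥
        refuted {P} {Q} h s W∩P aA aP aA′ aQ′ with any-∈ ((A ∩ P) ∖ X)
        ... | no none = Contradiction.Terminal.terminal h s W∩P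
                (λ vA vP → ∖-empty (A ∩ P) X none (vA , vP)) aA aP
        ... | yes (v , (vA , vP) , nx) with Contradiction.lonely h s W∩P vA vP nx aA′ aQ′
        ... | W∩Q , QX = Contradiction.Terminal.terminal (swapʰ h) s W∩Q QX aA′ aQ′

        inconsistent : ∀ {P Q R₁ R₂ a a′} → Halves P Q → Sides R₁ R₂ → a ∈ A → a ∈ P → a′ ∈ A → a′ ∈ Q → ⊥
        inconsistent {P} {Q} {R₁} {R₂} h s aA aP aA′ aQ′ with any-∈ (W ∩ P) | any-∈ (W ∩ Q)
        ... | no none | _ = refuted h s (λ w p → none (_ , w , p)) aA aP aA′ aQ′
        ... | yes _ | no none = refuted (swapʰ h) s (λ w q → none (_ , w , q)) aA′ aQ′ aA aP
        ... | yes (w , wW , wP) | yes (w′ , wW′ , wQ′) with Sides.split s wW | Sides.split s wW′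
        ... | inj₁ r | inj₁ r′ = free-halves h side₁ side₁ r r′ wW wP wW′ wQ′ (clash-W (swapʰ h) side₁ wW′ wQ′ r′)
          where open Sides s
        ... | inj₁ r | inj₂ r′ = free-halves h side₁ side₂ r r′ wW wP wW′ wQ′ (clash-W (swapʰ h) side₂ wW′ wQ′ r′)
          where open Sides s
        ... | inj₂ r | inj₁ r′ = free-halves h side₂ side₁ r r′ wW wP wW′ wQ′ (clash-W (swapʰ h) side₁ wW′ wQ′ r′)
          where open Sides s
        ... | inj₂ r | inj₂ r′ = free-halves h side₂ side₂ r r′ wW wP wW′ wQ′ (clash-W (swapʰ h) side₂ wW′ wQ′ r′)
          where open Sides s

      rigid-neighbourhood : Rigid (⁅ y ⁆ ∪ H) G S
      rigid-neighbourhood f (b₁ , b₂ , lab) = colour-by (dec F b₁) (dec F b₂) (b₁ ≟ᶠ b₂)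
        where
        N = ⁅ y ⁆ ∪ H
        F : DSet n
        F = dset (λ v → v ∈ S × f v ≡ false) (λ v → dec S v ×-dec f v ≟ᵇ false)
        y∉H : y ∉ H
        y∉H p = eirr G (proj₂ p)
        paint : ∀ Q → Q ⊆ N → F ⊆ Q → (∀ {v} → v ∈ S → f v ≡ true → v ∉ Q) → (∀ {a b} → a ∈ F → b ∈ F → Walk G Q a b) →
                (∀ {a b} → a ∈ S → b ∈ S → f a ≡ true → f b ≡ true → Walk G (N ∖ Q) a b) → Sol N G S f
        paint Q qn fq out joinF joinT = solution (outside Q) (agr , joined)
          where
          agr : ∀ v → v ∈ S → outside Q v ≡ f v
          agr v p with f v in e
          ... | true = outside-true Q (out p e)
          ... | false = outside-false Q (fq (p , e))
          joined : ∀ a b → a ∈ S → b ∈ S → f a ≡ f b → Walk G (class N (outside Q) (f a)) a b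
          joined a b p q e with f a in ea
          ... | true = walk-⊆ (λ r → proj₁ r , outside-true Q (proj₂ r)) (joinT p q ea (sym e))
          ... | false = walk-⊆ (λ r → qn r , outside-false Q r) (joinF (p , ea) (q , sym e))
        hub : ∀ Q → y ∉ Q → (∀ {v} → v ∈ S → f v ≡ true → v ∉ Q) →
              ∀ {a b} → a ∈ S → b ∈ S → f a ≡ true → f b ≡ true → Walk G (N ∖ Q) a b
        hub Q nq out p q ea eb = step (inj₂ (S⊆H p) , out p ea) (esym G (proj₂ (S⊆H p)))
          (edge (inj₁ refl , nq) (inj₂ (S⊆H q) , out q eb) (proj₂ (S⊆H q)))
        clean : ∀ {v} → f v ≡ true → f v ≡ false → ⊥
        clean e e′ with () ← trans (sym e) e′
        lone : ∀ b → (∀ {v} → v ∈ F → v ≡ b) → Sol N G S f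
        lone b h = paint F (λ p → inj₂ (S⊆H (proj₁ p))) id (λ _ e r → clean e (proj₂ r))
          (λ { p q → subst (Walk G F _) (trans (h p) (sym (h q))) (here p) })
          (hub F (λ p → y∉H (S⊆H (proj₁ p))) λ _ e r → clean e (proj₂ r))
        double : b₁ ∈ F → b₂ ∈ F → b₁ ≢ b₂ → Sol N G S f
        double (s₁ , f₁) (s₂ , f₂) ne = through (walk? G (W ∪ Ends) b₁ b₂)
          where
          open Counting b₁ b₂ s₁ s₂ ne
          Ends-false : ∀ {v} → End v → f v ≡ false
          Ends-false (inj₁ refl) = f₁
          Ends-false (inj₂ refl) = f₂
          Ends⊆H : ∀ {v} → End v → v ∈ H
          Ends⊆H e = S⊆H (End⊆S e)
          Q₀ = ⁅ y ⁆ ∪ Ends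
          out₀ : ∀ {v} → v ∈ S → f v ≡ true → v ∉ Q₀
          out₀ p e (inj₁ refl) = y∉H (S⊆H p)
          out₀ p e (inj₂ r) = clean e (Ends-false r)
          paint₀ : (∀ {a b} → a ∈ A → b ∈ A → Walk G (A ∪ W) a b) → Sol N G S f
          paint₀ j = paint Q₀ [ inj₁ , (λ e → inj₂ (Ends⊆H e)) ]′ (λ p → inj₂ (lab (proj₁ p) (proj₂ p))) out₀
            (λ p q → step (inj₂ (lab (proj₁ p) (proj₂ p))) (esym G (proj₂ (S⊆H (proj₁ p))))
                       (edge (inj₁ refl) (inj₂ (lab (proj₁ q) (proj₂ q))) (proj₂ (S⊆H (proj₁ q)))))
            (λ p q ea eb → walk-⊆ (λ { (inj₁ a) → inj₂ (A⊆H a) , (λ { (inj₁ refl) → y∉H (A⊆H a) ; (inj₂ r) → proj₂ a r })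
                                     ; (inj₂ w) → inj₂ (proj₁ w) , (λ { (inj₁ refl) → y∉H (proj₁ w) ; (inj₂ r) → proj₂ w (End⊆S r) }) })
                             (j (p , λ r → clean ea (Ends-false r)) (q , λ r → clean eb (Ends-false r))))
          through : Dec (Walk G (W ∪ Ends) b₁ b₂) → Sol N G S f
          through (yes w) = paint (W ∪ Ends) (λ p → inj₂ ([ proj₁ , Ends⊆H ]′ p)) (λ p → inj₂ (lab (proj₁ p) (proj₂ p))) out
            (λ p q → to-b₁ (lab (proj₁ p) (proj₂ p)) ++ʷ reverseʷ (to-b₁ (lab (proj₁ q) (proj₂ q))))
            (hub (W ∪ Ends) (λ p → y∉H ([ proj₁ , Ends⊆H ]′ p)) out)
            where
            out : ∀ {v} → v ∈ S → f v ≡ true → v ∉ W ∪ Ends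
            out p e (inj₁ r) = proj₂ r p
            out p e (inj₂ r) = clean e (Ends-false r)
            to-b₁ : ∀ {v} → End v → Walk G (W ∪ Ends) v b₁
            to-b₁ (inj₁ refl) = here (inj₂ (inj₁ refl))
            to-b₁ (inj₂ refl) = reverseʷ w
          through (no nw) with any-∈ A
          ... | no none = paint₀ λ p _ → ⊥-elim (none (_ , p))
          ... | yes (a , aA) with any-∈ (A ∖ reach G (A ∪ W) a)
          ... | no none = paint₀ λ p q → reverseʷ (∖-empty A (reach G (A ∪ W) a) none p) ++ʷ ∖-empty A (reach G (A ∪ W) a) none q
          ... | yes (a′ , aA′ , nr) = ⊥-elim (inconsistent halves sides aA (here (inj₁ aA)) aA′ (inj₁ aA′ , nr))
            where
            P R : DSet n
            P = reach G (A ∪ W) a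
            R = reach G (W ∪ Ends) b₁
            halves : Halves P ((A ∪ W) ∖ P)
            halves = record
              { cover = λ {v} p → case dec P v of λ { (yes r) → inj₁ r ; (no r) → inj₂ (p , r) }
              ; apart = λ p q → proj₂ q p
              ; cut = λ p q e → proj₂ q (p ++ʷ edge (walk-end p) (proj₁ q) e) }
            sides : Sides R ((W ∪ Ends) ∖ R)
            sides = record
              { side₁ = record { end = inj₁ refl ; own = λ { (inj₁ e) _ → e ; (inj₂ refl) r → ⊥-elim (nw r) }
                               ; home = here (inj₂ (inj₁ refl)) ; stays = λ r p e → r ++ʷ edge (walk-end r) p e }
              ; side₂ = record { end = inj₂ refl ; own = λ { (inj₁ refl) r → ⊥-elim (proj₂ r (here (inj₂ (inj₁ refl)))) ; (inj₂ e) _ → e }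
                               ; home = inj₂ (inj₂ refl) , nw ; stays = λ r p e → p , λ v → proj₂ r (v ++ʷ edge (walk-end v) (proj₁ r) (esym G e)) }
              ; split = λ {v} w → case dec R v of λ { (yes r) → inj₁ r ; (no r) → inj₂ (inj₁ w , r) }
              ; apartʳ = λ r q → proj₂ q r }
        colour-by : Dec (b₁ ∈ F) → Dec (b₂ ∈ F) → Dec (b₁ ≡ b₂) → Sol N G S f
        colour-by (no n₁) _ _ = lone b₂ λ p → [ (λ { refl → ⊥-elim (n₁ p) }) , id ]′ (lab (proj₁ p) (proj₂ p))
        colour-by (yes _) (no n₂) _ = lone b₁ λ p → [ id , (λ { refl → ⊥-elim (n₂ p) }) ]′ (lab (proj₁ p) (proj₂ p))
        colour-by (yes _) (yes _) (yes refl) = lone b₁ λ p → [ id , id ]′ (lab (proj₁ p) (proj₂ p))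
        colour-by (yes p₁) (yes p₂) (no ne) = double p₁ p₂ ne

-- Massed graphs have solutions

module _ {n : ℕ} where

  -- Each hub takes one colour and joins its class by a star. The colour κ is left open because in
  -- the joint case the label of u decides which hub serves which class.
  two-hubs : ∀ {U : DSet n} {G X f y₁ y₂} → X ⊆ U → y₁ ∈ U ∖ X → y₂ ∈ U ∖ X → y₁ ≢ y₂ → ∀ κ →
             (∀ {x} → x ∈ X → f x ≡ κ → E G y₁ x) → (∀ {x} → x ∈ X → f x ≢ κ → E G y₂ x) → Sol U G X f
  two-hubs {U} {G} {X} {f} {y₁} {y₂} xu (u₁ , n₁) (u₂ , n₂) ne κ h₁ h₂ = solution c (agr , joined)
    where
    c₀ c : Fin n → Bool
    c₀ = updateAt f y₂ (λ _ → not κ)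
    c = updateAt c₀ y₁ (λ _ → κ)
    c₁ : c y₁ ≡ κ
    c₁ = updateAt-updates y₁ c₀
    c₂ : c y₂ ≡ not κ
    c₂ = trans (updateAt-minimal y₂ y₁ c₀ λ e → ne (sym e)) (updateAt-updates y₂ f)
    agr : ∀ x → x ∈ X → c x ≡ f x
    agr x p = trans (updateAt-minimal x y₁ c₀ λ { refl → n₁ p }) (updateAt-minimal x y₂ f λ { refl → n₂ p })
    other : ∀ {a b} → a ≢ b → not b ≡ a
    other {false} {false} n = ⊥-elim (n refl)
    other {false} {true} n = refl
    other {true} {false} n = refl
    other {true} {true} n = ⊥-elim (n refl)
    joined : ∀ a b → a ∈ X → b ∈ X → f a ≡ f b → Walk G (class U c (f a)) a b
    joined a b p q e with f a ≟ᵇ κ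
    ... | yes k = step (xu p , agr a p) (esym G (h₁ p k))
                    (edge (u₁ , trans c₁ (sym k)) (xu q , trans (agr b q) (sym e)) (h₁ q (trans (sym e) k)))
    ... | no nk = step (xu p , agr a p) (esym G (h₂ p nk))
                    (edge (u₂ , trans c₂ (other nk)) (xu q , trans (agr b q) (sym e)) (h₂ q λ k → nk (trans e k)))

  pair-exhausts : ∀ (Z : DSet n) {p q r} → # Z ≤ 2 → p ∈ Z → q ∈ Z → p ≢ q → r ∈ Z → r ≡ p ⊎ r ≡ q
  pair-exhausts Z {p} {q} {r} z2 pZ qZ ne rZ with r ≟ᶠ p | r ≟ᶠ q
  ... | yes e | _ = inj₁ e
  ... | no _ | yes e = inj₂ e
  ... | no np | no nq = ⊥-elim (<⇒≱ (≤-trans (s≤s (≤-trans (s≤s (#-one (Z ∖ ⁅ p ⁆ ∖ ⁅ q ⁆) r ((rZ , np) , nq)))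
        (#-remove (Z ∖ ⁅ p ⁆) q (qZ , λ e → ne (sym e))))) (#-remove Z p pZ)) z2)

  module _ (α : ℕ) {U : DSet n} {G X f} (M : Massed α U G X f) (ih : Hypothesis α U)
           (ih₂ : ∀ G′ → ρ U G′ (U ∖ X) < ρ U G (U ∖ X) → Massed α U G′ X f → Sol U G′ X f)
           (fail : ¬ Sol U G X f) where
    open Massed M
    private
      Z = U ∖ X
      e = ρ U G Z
      N : Fin n → DSet n
      N y = nbr G U y
      open Neighbourhood α U G X using (Dense)

      -- The sum over Z is 2e by `ρ-degrees`; neighbours in X count twice, as edges to them have
      -- only one end in Z.
      weight : Fin n → ℕ
      weight y = # (N y) + # (nbr G (U ∖ Z) y)

      doubled : e + e ≡ sum (λ y → χ# Z y * weight y)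
      doubled = ρ-degrees U G Z proj₁

      φ≤ : ∀ y → # (X ∩ N y) ≤ # (nbr G (U ∖ Z) y)
      φ≤ y = #-mono (X ∩ N y) (nbr G (U ∖ Z) y) λ { (x , (u , a)) → (u , λ z → proj₂ z x) , a }

      ≤φ : ∀ y → # (nbr G (U ∖ Z) y) ≤ # (X ∩ N y)
      ≤φ y = #-mono (nbr G (U ∖ Z) y) (X ∩ N y) λ { {v} ((u , nz) , a) → (case dec X v of λ { (yes x) → x ; (no nx) → ⊥-elim (nz (u , nx)) }) , u , a }

      light : ∀ b → b * # Z ≤ e + e ⊎ (∃ λ y → y ∈ Z × weight y < b)
      light b with any? (λ y → dec Z y ×-dec (weight y <? b))
      ... | yes r = inj₂ r
      ... | no none = inj₁ (≤-trans (≤-reflexive (sym (sum-* b (χ# Z)))) (≤-trans (sum-mono λ y → row y (dec Z y)) (≤-reflexive (sym doubled))))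
        where
        row : ∀ y (d : Dec (y ∈ Z)) → b * χ d ≤ χ d * weight y
        row y (no _) = ≤-reflexive (*-zeroʳ b)
        row y (yes z) = ≤-trans (≤-reflexive (*-identityʳ b)) (≤-trans (≮⇒≥ λ l → none (y , z , l)) (≤-reflexive (sym (+-identityʳ _))))

      few-light : ∀ {b} → (∀ {y} → y ∈ Z → weight y ≤ b) → e + e ≤ b * # Z
      few-light {b} h = ≤-trans (≤-reflexive doubled) (≤-trans (sum-mono λ y → row y (dec Z y)) (≤-reflexive (sum-* b (χ# Z))))
        where
        row : ∀ y (d : Dec (y ∈ Z)) → χ d * weight y ≤ b * χ d
        row y (no _) = z≤n
        row y (yes z) = ≤-trans (≤-reflexive (+-identityʳ _)) (≤-trans (h z) (≤-reflexive (sym (*-identityʳ b))))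

      stuck : ∀ {δ π y} → y ∈ Z → Dense y δ π → ⊥
      stuck {y = y} (yU , yX) D = no-rigid-linked α M ih fail ⁅ y ⁆ (N y) record
          { Z⊆U = λ { refl → yU } ; S⊆U = proj₁ ; Z∩S = λ { refl p → eirr G (proj₂ p) }
          ; X∩Z = λ { x refl → yX x } ; closed = λ { refl w a → inj₂ (w , a) } }
        (y , refl) λ S h sz hx → Neighbourhood.rigid-neighbourhood α U G X y D S h (≤-trans sz order) hx

      Clash : Fin n → Fin n → DSet n
      Clash y x = Neighbourhood.clash α U G X y x

      uncontractible : ∀ {y x} → y ∈ Z → x ∈ N y → # (Clash y x) < α →
                       Slack α (U ∖ ⁅ y ⁆) (Contraction.G/ G x y) X f → ⊥
      uncontractible yZ (xU , a) = no-contraction α M ih fail xU yZ (esym G a)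

      stuck-full : (∀ {y x} → y ∈ Z → x ∈ N y → # (Clash y x) < α → Slack α (U ∖ ⁅ y ⁆) (Contraction.G/ G x y) X f) →
                   ∀ {y} → y ∈ Z → weight y ≤ 1 + (α + α) → ⊥
      -- With δ = 0 there is no deficient vertex, and y fills the place of π.
      stuck-full sl {y} yZ w = stuck {0} {y} yZ record
        { low = λ p → ≮⇒≥ λ l → uncontractible yZ p l (sl yZ p l)
        ; high = λ p → inj₁ (≮⇒≥ λ l → uncontractible yZ p l (sl yZ p l))
        ; size = ≤-trans (+-mono-≤ (≤-refl {# (N y)}) (≤-trans (≤-reflexive (+-identityʳ _)) (φ≤ y))) w
        ; δ≤φ = z≤n }

      Inner : Set
      Inner = ∃ λ p → p ∈ Z × (∃ λ q → q ∈ Z × E G p q)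

      inner? : Dec Inner
      inner? = any? λ p → dec Z p ×-dec any? λ q → dec Z q ×-dec E? G p q

      outer : ¬ Inner → ∀ {y} → y ∈ Z → # (N y) ≤ # (X ∩ N y)
      outer ni {y} yZ = #-mono (N y) (X ∩ N y) λ { {v} (u , a) →
        (case dec X v of λ { (yes x) → x ; (no nx) → ⊥-elim (ni (y , yZ , v , (u , nx) , a)) }) , u , a }

      Z-inhabited : ∃ λ y → y ∈ Z
      Z-inhabited with any-∈ Z
      ... | yes r = r
      ... | no none = ⊥-elim (<⇒≱ (≤-trans (s≤s z≤n) dense) (≤-reflexive (ρ-none U G Z λ v z → none (v , z))))

      double-α : α * # Z + α * # Z ≡ (α + α) * # Z
      double-α = sym (*-distribʳ-+ (# Z) α α)

      -- Weights of at least c + 2α make e large, while the bound on e says that hardly an edge can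
      -- be spared; so Z has at most 2d / c vertices.
      crowded : ∀ c d → (c + (α + α)) * # Z ≤ e + e → e ≤ d + α * # Z → c * # Z ≤ d + d
      crowded c d heavy bound = ≮⇒≥ λ bad → linarith (e ∷ d ∷ α * # Z ∷ c * # Z ∷ (α + α) * # Z ∷ (c + (α + α)) * # Z ∷ [])
        (num 1 ⊕ (v₁ ⊕ v₁) ≼ v₃ ∷ v₅ ≼ v₀ ⊕ v₀ ∷ (2 · v₀ ≼ v₁ ⊕ v₂) ∷ v₃ ⊕ v₄ ≼ v₅ ∷ v₂ ⊕ v₂ ≼ v₄ ∷ [])
        (bad , heavy , bound , ≤-reflexive (sym (*-distribʳ-+ (# Z) c (α + α))) , ≤-reflexive double-α , tt)

      near-full : ∀ {y z} → (∀ {r} → r ∈ Z → r ≡ y ⊎ r ≡ z) → weight y ≤ 1 + (# (X ∩ N y) + # (X ∩ N y))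
      near-full {y} {z} pair = ≤-trans (+-mono-≤ (≤-trans (#-mono (N y) ((X ∩ N y) ∪ ⁅ z ⁆) into) (#-insert (X ∩ N y) z)) (≤φ y)) ≤-refl
        where
        into : N y ⊆ (X ∩ N y) ∪ ⁅ z ⁆
        into {v} (u , a) with dec X v
        ... | yes x = inj₁ (x , u , a)
        ... | no nx with pair (u , nx)
        ... | inj₁ refl = ⊥-elim (eirr G a)
        ... | inj₂ eq = inj₂ eq

      saturated : ∀ {y} (Q : DSet n) → (∀ {v} → v ∈ X → v ∈ N y → v ∈ Q) → # Q ≤ # (X ∩ N y) → ∀ {x} → x ∈ Q → E G y x
      saturated {y} Q h le q = proj₂ (proj₂ (#-subset (X ∩ N y) Q (λ p → h (proj₁ p) (proj₂ p)) le q))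

      -- An edge inside Z could be deleted unless e ≤ 1 + α |Z|, which makes the average weight
      -- small. If there is no such edge, every weight is at most 2 |X|. Either way some weight is
      -- at most 2α + 1.
      small-order : # X ≤ α → ⊥
      small-order le with inner?
      ... | no ni = stuck-full (λ _ _ _ → inj₁ le) (proj₂ Z-inhabited)
            (≤-trans (+-mono-≤ (≤-trans (outer ni (proj₂ Z-inhabited)) bound) (≤-trans (≤φ _) bound)) (n≤1+n _))
        where
        bound : ∀ {y} → # (X ∩ N y) ≤ α
        bound {y} = ≤-trans (#-mono (X ∩ N y) X proj₁) le
      ... | yes (p , pZ , q , qZ , a) with light (2 + (α + α))
      ... | inj₂ (y , yZ , w) = stuck-full (λ _ _ _ → inj₁ le) yZ (≤-pred w)
      ... | inj₁ heavy = linarith (# Z ∷ []) (2 ⊛ v₀ ≼ num 2 ∷ (2 · num 2 ≼ v₀) ∷ [])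
            (crowded 2 1 heavy tight , #-pair Z pZ qZ (λ { refl → eirr G a }) , tt)
        where
        tight : e ≤ 1 + α * # Z
        tight = ≮⇒≥ λ big → no-inner-edge α M ih fail pZ qZ a ih₂ (deletion-dense α M ih fail pZ qZ a 1 big) (inj₁ le)

      full-row : ∀ {y} → ¬ (weight y < 2 + (α + α)) → weight y ≤ 1 + (# (X ∩ N y) + # (X ∩ N y)) → ∀ {x} → x ∈ X → E G y x
      full-row {y} nw le = saturated {y} X (λ x _ → x) (≮⇒≥ λ bad → linarith (α ∷ # X ∷ # (X ∩ N y) ∷ weight y ∷ [])
        ((2 · num 1 ⊕ v₂ ≼ v₁) ∷ (2 · v₁ ≼ num 1 ⊕ v₀) ∷ num 2 ⊕ (v₀ ⊕ v₀) ≼ v₃ ∷ v₃ ≼ num 1 ⊕ (v₂ ⊕ v₂) ∷ [])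
        (bad , order , ≮⇒≥ nw , le , tt))

      -- Contractions with few clashes keep the surplus 2, so a vertex of weight at most 2α + 1 is
      -- stuck. If all weights are larger, two vertices adjacent to all of X are found; a single
      -- vertex would meet at most α + 1 edges.
      double-slack : 2 + α * # Z ≤ e → ⊥
      double-slack two with any? (λ y → dec Z y ×-dec (weight y <? 2 + (α + α)))
      ... | yes (y , yZ , w) = stuck-full (λ { yZ (xU , b) l →
              inj₂ (inj₁ (contraction-dense α M ih fail xU yZ (esym G b) 2 2 two (s≤s (s≤s l)))) }) yZ (≤-pred w)
      ... | no none with inner?
      ... | yes (p , pZ , q , qZ , a) with light (2 + (α + α))
      ... | inj₂ r = none r
      ... | inj₁ heavy = fail (two-hubs X⊆U pZ qZ p≢q true
            (λ x _ → full-row (λ w → none (p , pZ , w)) (near-full {p} {q} pair) x)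
            (λ x _ → full-row (λ w → none (q , qZ , w)) (near-full {q} {p} (λ r → [ inj₂ , inj₁ ]′ (pair r))) x))
        where
        p≢q : p ≢ q
        p≢q refl = eirr G a
        tight : e ≤ 2 + α * # Z
        tight = ≮⇒≥ λ big → no-inner-edge α M ih fail pZ qZ a ih₂
          (≤-trans (n≤1+n _) (deletion-dense α M ih fail pZ qZ a 2 big)) (inj₂ (inj₁ (deletion-dense α M ih fail pZ qZ a 2 big)))
        pair : ∀ {r} → r ∈ Z → r ≡ p ⊎ r ≡ q
        pair = pair-exhausts Z (≮⇒≥ λ bad → linarith (# Z ∷ []) (2 ⊛ v₀ ≼ num 4 ∷ (2 · num 3 ≼ v₀) ∷ [])
                 (crowded 2 2 heavy tight , bad , tt)) pZ qZ p≢q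
      double-slack two | no none | no ni with any-∈ (Z ∖ ⁅ proj₁ Z-inhabited ⁆)
      ... | yes (z , zZ , ne) = fail (two-hubs X⊆U zZ (proj₂ Z-inhabited) ne true (λ x _ → all zZ x) (λ x _ → all (proj₂ Z-inhabited) x))
        where
        all : ∀ {y} → y ∈ Z → ∀ {x} → x ∈ X → E G y x
        all {y} yZ = full-row (λ l → none (y , yZ , l)) (≤-trans (+-mono-≤ (outer ni yZ) (≤φ y)) (n≤1+n _))
      ... | no alone = linarith (α ∷ e ∷ # Z ∷ α * # Z ∷ (2 + (α + α)) * # Z ∷ (α + α) * # Z ∷ [])
            ((2 · num 2 ⊕ v₃ ≼ v₁) ∷ v₁ ⊕ v₁ ≼ v₄ ∷ v₄ ≼ 2 ⊛ v₂ ⊕ v₅ ∷ v₅ ≼ v₃ ⊕ v₃ ∷ (2 · v₂ ≼ num 1) ∷ [])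
            (two , few-light (λ {y} yZ → ≤-trans (+-mono-≤ (≤-trans (outer ni yZ) (φX y)) (≤-trans (≤φ y) (φX y))) (≤-reflexive (cong suc (+-suc α α))))
              , ≤-reflexive (*-distribʳ-+ (# Z) 2 (α + α)) , ≤-reflexive (sym double-α)
              , ≤-trans (#-mono Z ⁅ proj₁ Z-inhabited ⁆ (∖-empty Z ⁅ proj₁ Z-inhabited ⁆ alone)) (≤-reflexive (#-⁅⁆ (proj₁ Z-inhabited))) , tt)
        where
        φX : ∀ y → # (X ∩ N y) ≤ 1 + α
        φX y = ≤-trans (#-mono (X ∩ N y) X proj₁) order

      -- Otherwise X ∖ ⁅ u ⁆ would be a smaller boundary of Z, and Z is too dense for that.
      detached : ∀ u → u ∈ X → (∀ z → z ∈ Z → ¬ E G z u) → ⊥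
      detached u uX none = <⇒≱ dense (sparse Z (X ∖ ⁅ u ⁆) record
          { Z⊆U = proj₁ ; S⊆U = λ p → X⊆U (proj₁ p) ; Z∩S = λ z s → proj₂ z (proj₁ s) ; X∩Z = λ x z → proj₂ z x ; closed = cl }
        (#-remove X u uX))
        where
        cl : ∀ {z w} → z ∈ Z → w ∈ U → E G z w → w ∈ Z ⊎ w ∈ X ∖ ⁅ u ⁆
        cl {z} {w} zZ wU a with dec X w | w ≟ᶠ u
        ... | no nx | _ = inj₁ (wU , nx)
        ... | yes _ | yes refl = ⊥-elim (none z zZ a)
        ... | yes x | no ne = inj₂ (x , ne)

      attached : ∀ u → u ∈ X → ((∃ λ z → z ∈ Z × E G z u) → ⊥) → ⊥
      attached u uX k = detached u uX λ z zZ a → k (z , zZ , a)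

      module _ (u v : Fin n) (uX : u ∈ X) (vX : v ∈ X) (fuv : f u ≢ f v) (free : ∀ {z} → z ∈ Z → E G z u → E G z v → ⊥)
               (tight : e ≤ 1 + α * # Z) where

        Deficient : Fin n → Fin n → Fin n → Set
        Deficient y x π = E G y π × (x ≡ π ⊎ (x ∉ X × ¬ E G x π))

        -- The contraction must give u and v a common neighbour z. Then x is u or v, or z is x,
        -- adjacent to one of them and inheriting the other from y. As u and v have no common
        -- neighbour in G, x misses the inherited one.
        deficient : ∀ {y x} → y ∈ Z → x ∈ N y → # (Clash y x) < α → Deficient y x u ⊎ Deficient y x v
        deficient {y} {x} yZ (xU , a) few with any? (λ z → dec (U ∖ ⁅ y ⁆ ∖ X) z ×-dec E? G/ z u ×-dec E? G/ z v)
          where G/ = Contraction.G/ G x y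
        ... | no none = ⊥-elim (uncontractible yZ (xU , a) few (inj₂ (inj₂ (u , v , uX , vX , fuv , λ {z} zZ p q → none (z , zZ , p , q)))))
        ... | yes (z , ((zU , _) , nz) , p , q) = sort p q
          where
          sort : E (Contraction.G/ G x y) z u → E (Contraction.G/ G x y) z v → Deficient y x u ⊎ Deficient y x v
          sort (inj₁ zu) (inj₁ zv) = ⊥-elim (free (zU , nz) zu zv)
          sort (inj₂ (inj₂ (refl , yz , ne))) _ = inj₁ (a , inj₁ refl)
          sort _ (inj₂ (inj₂ (refl , yz , ne))) = inj₂ (a , inj₁ refl)
          sort (inj₂ (inj₁ (refl , yu , _))) (inj₂ (inj₁ (_ , yv , _))) = ⊥-elim (free yZ yu yv)
          sort (inj₂ (inj₁ (refl , yu , _))) (inj₁ zv) = inj₁ (yu , inj₂ (nz , λ zu → free (zU , nz) zu zv))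
          sort (inj₁ zu) (inj₂ (inj₁ (refl , yv , _))) = inj₂ (yv , inj₂ (nz , λ zv → free (zU , nz) zu zv))

        -- With fewer than α - 1 clashes the contraction would raise the surplus from 1 to 2, which
        -- is slack again.
        almost : ∀ {y x} → y ∈ Z → x ∈ N y → α ≤ 1 + # (Clash y x)
        almost {y} {x} yZ (xU , a) = ≮⇒≥ λ l → uncontractible yZ (xU , a) (≤-trans (n≤1+n _) l)
          (inj₂ (inj₁ (contraction-dense α M ih fail xU yZ (esym G a) 1 2 dense (s≤s l))))

        module OneDeficient {y} (yZ : y ∈ Z) (w : weight y ≤ α + α) where
          one-deficient : ∀ π → π ∈ X → E G y π → (∀ {x} → x ∈ N y → # (Clash y x) < α → Deficient y x π) → ⊥
          one-deficient π πX yπ d = stuck {1} {π} yZ record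
            { low = almost yZ
            ; high = λ {x} p → case α ≤? # (Clash y x) of λ
                { (yes le) → inj₁ le ; (no l) → inj₂ (refl , (πX , X⊆U πX , yπ) , proj₂ (d p (≰⇒> l))) }
            ; size = ≤-trans (≤-reflexive (trans (cong (# (N y) +_) (+-comm (# (X ∩ N y)) 1)) (+-suc (# (N y)) _)))
                       (s≤s (≤-trans (+-mono-≤ (≤-refl {# (N y)}) (φ≤ y)) w))
            ; δ≤φ = #-one (X ∩ N y) π (πX , X⊆U πX , yπ) }

        -- As y is adjacent to at most one of u and v, all deficiencies refer to the same π.
        stuck-joint : ∀ {y} → y ∈ Z → weight y ≤ α + α → ⊥
        stuck-joint {y} yZ w with E? G y u | E? G y v
        ... | yes yu | yes yv = free yZ yu yv
        ... | no nu | no nv = stuck {0} {y} yZ record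
          { low = full ; high = λ p → inj₁ (full p)
          ; size = ≤-trans (+-mono-≤ (≤-refl {# (N y)}) (≤-trans (≤-reflexive (+-identityʳ _)) (φ≤ y))) (≤-trans w (n≤1+n _)) ; δ≤φ = z≤n }
          where
          full : ∀ {x} → x ∈ N y → α ≤ # (Clash y x)
          full p = ≮⇒≥ λ l → [ (λ d → nu (proj₁ d)) , (λ d → nv (proj₁ d)) ]′ (deficient yZ p l)
        ... | yes yu | no nv = one-deficient u uX yu (λ p l → [ id , (λ d → ⊥-elim (nv (proj₁ d))) ]′ (deficient yZ p l))
          where open OneDeficient yZ w
        ... | no nu | yes yv = one-deficient v vX yv (λ p l → [ (λ d → ⊥-elim (nu (proj₁ d))) , id ]′ (deficient yZ p l))
          where open OneDeficient yZ w

        joint-terminals : ⊥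
        joint-terminals with light (1 + (α + α))
        ... | inj₂ (y , yZ , w) = stuck-joint yZ (≤-pred w)
        -- Now Z consists of a neighbour p of u and a neighbour q of v. Their weights make p
        -- adjacent to all of X except v, and q to all except u.
        ... | inj₁ heavy = attached u uX λ { (p , pZ , pu) → attached v vX λ { (q , qZ , qv) →
            go pZ qZ pu qv (λ { refl → free pZ pu qv }) (weight p <? 1 + (α + α)) (weight q <? 1 + (α + α)) } }
          where
          Z≤2 : # Z ≤ 2
          Z≤2 = ≤-trans (≤-reflexive (sym (+-identityʳ _))) (crowded 1 1 heavy tight)
          all-but : ∀ {y} t → t ∈ X → ¬ E G y t → ¬ (weight y < 1 + (α + α)) → weight y ≤ 1 + (# (X ∩ N y) + # (X ∩ N y)) →
                    ∀ {x} → x ∈ X → x ≢ t → E G y x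
          all-but {y} t tX nt nw le xX ne = saturated {y} (X ∖ ⁅ t ⁆) (λ { x a → x , λ { refl → nt (proj₂ a) } })
            (≮⇒≥ λ bad → linarith (α ∷ # X ∷ # (X ∩ N y) ∷ weight y ∷ # (X ∖ ⁅ t ⁆) ∷ [])
              ((2 · num 1 ⊕ v₂ ≼ v₄) ∷ (2 · num 1 ⊕ v₄ ≼ v₁) ∷ (2 · v₁ ≼ num 1 ⊕ v₀) ∷ num 1 ⊕ (v₀ ⊕ v₀) ≼ v₃ ∷ v₃ ≼ num 1 ⊕ (v₂ ⊕ v₂) ∷ [])
              (bad , #-remove X t tX , order , ≮⇒≥ nw , le , tt)) (xX , ne)
          go : ∀ {p q} → p ∈ Z → q ∈ Z → E G p u → E G q v → p ≢ q →
               Dec (weight p < 1 + (α + α)) → Dec (weight q < 1 + (α + α)) → ⊥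
          go pZ qZ pu qv ne (yes w) _ = stuck-joint pZ (≤-pred w)
          go pZ qZ pu qv ne (no _) (yes w) = stuck-joint qZ (≤-pred w)
          go {p} {q} pZ qZ pu qv ne (no wp) (no wq) = fail (two-hubs X⊆U pZ qZ ne (f u)
            (λ x k → all-but v vX (free pZ pu) wp (near-full {p} {q} (pair-exhausts Z Z≤2 pZ qZ ne)) x λ { refl → fuv (sym k) })
            (λ x nk → all-but u uX (λ r → free qZ r qv) wq (near-full {q} {p} (λ r → [ inj₂ , inj₁ ]′ (pair-exhausts Z Z≤2 pZ qZ ne r))) x λ { refl → nk refl }))

    impossible : ⊥
    impossible with slack
    ... | inj₁ le = small-order le
    ... | inj₂ (inj₁ two) = double-slack two
    ... | inj₂ (inj₂ (u , v , uX , vX , ne , free)) with 2 + α * # (U ∖ X) ≤? ρ U G (U ∖ X)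
    ... | yes two = double-slack two
    ... | no l = joint-terminals u v uX vX ne free (≤-pred (≰⇒> l))

  -- Lexicographic induction on |U| and the number of edges that meet U ∖ X. Deciding `Sol` first
  -- turns the refuted counterexample into a solution.
  massed-solvable : ∀ α {U : DSet n} {G X f} → Massed α U G X f → Sol U G X f
  massed-solvable α {U} {G} {X} M = go (# U) (ρ U G (U ∖ X)) ≤-refl ≤-refl M
    where
    go : ∀ k r {U G X f} → # U ≤ k → ρ U G (U ∖ X) ≤ r → Massed α U G X f → Sol U G X f
    smaller : ∀ k {U} → # U ≤ k → Hypothesis α U
    smaller zero le U′ G′ X′ f′ lt _ = ⊥-elim (<⇒≱ (≤-trans (s≤s z≤n) lt) le)
    smaller (suc k) le U′ G′ X′ f′ lt M′ = go k (ρ U′ G′ (U′ ∖ X′)) (≤-pred (≤-trans lt le)) ≤-refl M′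
    sparser : ∀ k r {U G X f} → # U ≤ k → ρ U G (U ∖ X) ≤ r →
              ∀ G′ → ρ U G′ (U ∖ X) < ρ U G (U ∖ X) → Massed α U G′ X f → Sol U G′ X f
    sparser k zero le lr G′ lt _ = ⊥-elim (<⇒≱ (≤-trans (s≤s z≤n) lt) lr)
    sparser k (suc r) le lr G′ lt M′ = go k r le (≤-pred (≤-trans lt lr)) M′
    go k r {U} {G} {X} {f} le lr M with Sol? U G X f
    ... | yes s = s
    ... | no fail = ⊥-elim (impossible α M (smaller k le) (sparser k r {U} {G} {X} {f} le lr) fail)

-- Highly connected graphs

module _ {n : ℕ} where

  ∁ : DSet n → DSet n
  ∁ T = dset (λ v → ¬ v ∈ T) (λ v → ¬? (dec T v))

  Connected : ℕ → Gr n → Set₁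
  Connected k G = ∀ T → # T < k → ∀ u v → u ∉ T → v ∉ T → Walk G (∁ T) u v

  members : DSet n → List (Fin n)
  members T = filter (dec T) (allFin n)

  length-members : ∀ T → length (members T) ≡ # T
  length-members T = go (dec T) id
    where
    go : ∀ {m} {P : Fin n → Set} (P? : ∀ v → Dec (P v)) (f : Fin m → Fin n) →
         length (filter P? (List.tabulate f)) ≡ sum (λ i → χ (P? (f i)))
    go {zero} P? f = refl
    go {suc m} P? f with P? (f zero)
    ... | yes _ = cong suc (go P? (f ∘ suc))
    ... | no _ = go P? (f ∘ suc)

  -- Adjacency in a graph need not be decidable, but finitely many of its edges,
  -- those used by the walks that witness k-connectedness, already form a
  -- k-connected graph.
  module Extraction (𝔾 : Graph n) where
    open Graph 𝔾 using (Adj; irrefl) renaming (sym to adj-sym)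

    Edge : Set
    Edge = Σ (Fin n) λ u → Σ (Fin n) λ w → Adj u w

    Joins : Fin n → Fin n → Edge → Set
    Joins a b (u , w , _) = (u ≡ a × w ≡ b) ⊎ (u ≡ b × w ≡ a)

    joins-adj : ∀ {a b} L → Any (Joins a b) L → Adj a b
    joins-adj ((_ , _ , e) ∷ L) (here (inj₁ (refl , refl))) = e
    joins-adj ((_ , _ , e) ∷ L) (here (inj₂ (refl , refl))) = adj-sym e
    joins-adj (_ ∷ L) (there p) = joins-adj L p

    spanned : List Edge → Gr n
    spanned L = record
      { E = λ a b → Any (Joins a b) L
      ; E? = λ a b → Any.any? (λ { (u , w , _) → (u ≟ᶠ a ×-dec w ≟ᶠ b) ⊎-dec (u ≟ᶠ b ×-dec w ≟ᶠ a) }) L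
      ; esym = Any.map λ { (inj₁ p) → inj₂ p ; (inj₂ p) → inj₁ p }
      ; eirr = λ p → irrefl _ (joins-adj L p) }

    Monotone : (List Edge → Set) → Set
    Monotone Q = ∀ L L′ → (Q L → Q (L ++ L′)) × (Q L′ → Q (L ++ L′))

    collect-Fin : ∀ {k} (Q : Fin k → List Edge → Set) → (∀ i → Monotone (Q i)) → (∀ i → ∃ (Q i)) → ∃ λ L → ∀ i → Q i L
    collect-Fin {zero} Q mono h = [] , λ ()
    collect-Fin {suc k} Q mono h with h zero | collect-Fin (Q ∘ suc) (mono ∘ suc) (h ∘ suc)
    ... | L , q | L′ , qs = L ++ L′ , λ { zero → proj₁ (mono zero L L′) q ; (suc i) → proj₂ (mono (suc i) L L′) (qs i) }

    collect-Subset : ∀ {k} (Q : Subset k → List Edge → Set) → (∀ s → Monotone (Q s)) → (∀ s → ∃ (Q s)) → ∃ λ L → ∀ s → Q s L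
    collect-Subset {zero} Q mono h = proj₁ (h []) , λ { [] → proj₂ (h []) }
    collect-Subset {suc k} Q mono h
      with collect-Subset (λ s → Q (true ∷ s)) (λ s → mono (true ∷ s)) (λ s → h (true ∷ s))
         | collect-Subset (λ s → Q (false ∷ s)) (λ s → mono (false ∷ s)) (λ s → h (false ∷ s))
    ... | L , q | L′ , q′ = L ++ L′ , λ { (true ∷ s) → proj₁ (mono (true ∷ s) L L′) (q s) ; (false ∷ s) → proj₂ (mono (false ∷ s) L L′) (q′ s) }

    walk-mono : ∀ {P x y} → Monotone (λ L → Walk (spanned L) P x y)
    walk-mono L L′ = walk-bind id (λ p q e → edge p q (++⁺ˡ e)) , walk-bind id (λ p q e → edge p q (++⁺ʳ L e))

    mono-Π : {I : Set} {Q : I → List Edge → Set} → (∀ i → Monotone (Q i)) → Monotone (λ L → ∀ i → Q i L)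
    mono-Π m L L′ = (λ q i → proj₁ (m i L L′) (q i)) , λ q i → proj₂ (m i L L′) (q i)

    toSet : Subset n → DSet n
    toSet s = dset (λ v → lookup s v ≡ true) (λ v → lookup s v ≟ᵇ true)

    fromReach : ∀ {T x y} {S : List (Fin n)} → (∀ {v} → v ∉ˡ S → v ∉ T) → Reach 𝔾 (_∈ˡ S) x y → x ∉ T → ∃ λ L → Walk (spanned L) (∁ T) x y
    fromReach h here nx = [] , here nx
    fromReach {T} {y = y} h (step {u} {w} a nw r) nx with fromReach {T} h r (h nw)
    ... | L , v = (u , w , a) ∷ L , step nx (here (inj₁ (refl , refl))) (proj₂ (walk-mono {∁ T} {w} {y} ((u , w , a) ∷ []) L) v)

    -- `Connected` speaks of all decidable sets, but each has the same members as one of finitely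
    -- many bit vectors, so one list of edges serves them all.
    extract : ∀ k → KConnected 𝔾 k → Σ (Gr n) λ G → (∀ {a b} → E G a b → Adj a b) × Connected k G
    extract k (_ , conn) = spanned L , joins-adj L , λ T lt u v nu nv → walk-⊆ (λ q p → q (into T p))
        (ok (code T) u v (≤-trans (s≤s (#-mono (toSet (code T)) T (out T))) lt) (λ p → nu (out T p)) (λ p → nv (out T p)))
      where
      Q : Subset n → List Edge → Set
      Q s L = ∀ u v → # (toSet s) < k → u ∉ toSet s → v ∉ toSet s → Walk (spanned L) (∁ (toSet s)) u v
      Q₁ : Subset n → Fin n → Fin n → List Edge → Set
      Q₁ s u v L = # (toSet s) < k → u ∉ toSet s → v ∉ toSet s → Walk (spanned L) (∁ (toSet s)) u v
      one : ∀ s u v → ∃ (Q₁ s u v)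
      one s u v with # (toSet s) <? k | dec (toSet s) u | dec (toSet s) v
      ... | no nl | _ | _ = [] , λ l → ⊥-elim (nl l)
      ... | yes _ | yes p | _ = [] , λ _ np → ⊥-elim (np p)
      ... | yes _ | no _ | yes p = [] , λ _ _ np → ⊥-elim (np p)
      ... | yes l | no nu | no nv with fromReach {toSet s} {u} {v} {members (toSet s)} (λ {w} ns t → ns (∈-filter⁺ (dec (toSet s)) (∈-allFin w) t))
              (conn (members (toSet s)) (≤-trans (s≤s (≤-reflexive (length-members (toSet s)))) l) u v
                (λ p → nu (proj₂ (∈-filter⁻ (dec (toSet s)) {xs = allFin n} p))) (λ p → nv (proj₂ (∈-filter⁻ (dec (toSet s)) {xs = allFin n} p)))) nu
      ... | L , w = L , λ _ _ _ → w
      mono₁ : ∀ s u v → Monotone (Q₁ s u v)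
      mono₁ s u v = mono-Π λ _ → mono-Π λ _ → mono-Π λ _ → walk-mono
      each : ∀ s → ∃ (Q s)
      each s = collect-Fin (λ u L → ∀ v → Q₁ s u v L) (λ u → mono-Π (mono₁ s u)) λ u → collect-Fin (Q₁ s u) (mono₁ s u) (one s u)
      all-of : ∃ λ L → ∀ s → Q s L
      all-of = collect-Subset Q (λ s → mono-Π λ u → mono-Π (mono₁ s u)) each
      L = proj₁ all-of
      ok = proj₂ all-of
      code : DSet n → Subset n
      code T = tabulate (λ v → does (dec T v))
      out : ∀ T {v} → v ∈ toSet (code T) → v ∈ T
      out T {v} p with dec T v | trans (sym (lookup∘tabulate (λ v → does (dec T v)) v)) p
      ... | yes t | _ = t
      into : ∀ T {v} → v ∈ T → v ∈ toSet (code T)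
      into T {v} t = trans (lookup∘tabulate (λ v → does (dec T v)) v) (aux (dec T v))
        where
        aux : (d : Dec (v ∈ T)) → does d ≡ true
        aux (yes _) = refl
        aux (no nt) = ⊥-elim (nt t)

  #-image : ∀ {m} (a : Fin m → Fin n) → # (dset (λ v → ∃ λ i → a i ≡ v) (λ v → any? λ i → a i ≟ᶠ v)) ≤ m
  #-image {m} a = ≤-trans (sum-mono λ v → cell v (any? λ i → a i ≟ᶠ v))
      (≤-trans (≤-reflexive (∑-comm (λ v i → χ (a i ≟ᶠ v)))) (≤-reflexive (trans (sum-cong-≗ one) (ones m))))
    where
    cell : ∀ v (d : Dec (∃ λ i → a i ≡ v)) → χ d ≤ sum (λ i → χ (a i ≟ᶠ v))
    cell v (no _) = z≤n
    cell v (yes (i , e)) = ≤-trans (≤-reflexive (sym (χ-yes (a i ≟ᶠ v) e))) (sum-≥ (λ i → χ (a i ≟ᶠ v)) i)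
    one : ∀ i → sum (λ v → χ (a i ≟ᶠ v)) ≡ 1
    one i = sum-δ (a i) (λ _ → 1) (λ v → χ (a i ≟ᶠ v)) (χ-yes (a i ≟ᶠ a i) refl) λ v ne → χ-no (a i ≟ᶠ v) λ e → ne (sym e)
    ones : ∀ m → sum {m} (λ _ → 1) ≡ m
    ones zero = refl
    ones (suc m) = cong suc (ones m)

  whole : DSet n
  whole = dset (λ _ → ⊤) (λ _ → yes tt)

  #-whole : # whole ≡ n
  #-whole = go n
    where
    go : ∀ m → sum {m} (λ _ → 1) ≡ m
    go zero = refl
    go (suc m) = cong suc (go m)

  -- Fewer than k neighbours would separate v from a further vertex, which exists because k < n.
  degree : ∀ {k} {G : Gr n} → k < n → Connected k G → ∀ v → k ≤ # (nbr G whole v)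
  degree {k} {G} kn conn v = ≮⇒≥ small
    where
    B = nbr G whole v
    small : # B < k → ⊥
    small lt with any-∈ (∁ (B ∪ ⁅ v ⁆))
    ... | no none = <⇒≱ kn (≤-trans (≤-reflexive (sym #-whole)) (≤-trans (#-mono whole (B ∪ ⁅ v ⁆) λ _ → ∖-empty whole (B ∪ ⁅ v ⁆) (λ { (w , _ , np) → none (w , np) }) tt)
                     (≤-trans (#-insert B v) lt)))
    ... | yes (w , nw) with conn B lt v w (λ p → eirr G (proj₂ p)) (λ p → nw (inj₁ p))
    ... | here _ = nw (inj₂ refl)
    ... | step _ e r = walk-start r (tt , e)

  module Initial {m : ℕ} (1≤m : 1 ≤ m) {G : Gr n} (kn : 2 * m + 2 < n) (conn : Connected (2 * m + 2) G)
                 (a : Fin m → Fin n) {b₁ b₂ : Fin n} (b₁≢b₂ : b₁ ≢ b₂) (a≢b₁ : ∀ i → a i ≢ b₁) (a≢b₂ : ∀ i → a i ≢ b₂) where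
    α = suc m
    Ends As X Z : DSet n
    Ends = ⁅ b₁ ⁆ ∪ ⁅ b₂ ⁆
    As = dset (λ v → ∃ λ i → a i ≡ v) (λ v → any? λ i → a i ≟ᶠ v)
    X = As ∪ ⁅ b₁ ⁆ ∪ ⁅ b₂ ⁆
    Z = whole ∖ X

    label : Fin n → Bool
    label = outside Ends

    order : # X ≤ 1 + α
    order = ≤-trans (#-insert (As ∪ ⁅ b₁ ⁆) b₂) (s≤s (≤-trans (#-insert As b₁) (s≤s (#-image a))))

    2α≡k : α + α ≡ 2 * m + 2
    2α≡k = solve 1 (λ m → (con 1 :+ m) :+ (con 1 :+ m) := con 2 :* m :+ con 2) refl m

    degrees : ∀ v → α + α ≤ # (nbr G whole v)
    degrees v = ≤-trans (≤-reflexive 2α≡k) (degree kn conn v)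

    -- Of at least 2m + 2 neighbours at most m + 1 lie in X, and m ≥ 1 leaves two outside.
    outward : ∀ {b} → b ∈ X → 2 ≤ # (nbr G Z b)
    outward {b} bX = ≮⇒≥ λ bad → linarith (m ∷ # (nbr G Z b) ∷ # (nbr G whole b) ∷ # (X ∖ ⁅ b ⁆) ∷ # X ∷ [])
      (num 1 ⊕ v₁ ≼ num 2 ∷ num 1 ⊕ v₀ ⊕ (num 1 ⊕ v₀) ≼ v₂ ∷ v₂ ≼ v₁ ⊕ v₃ ∷ num 1 ⊕ v₃ ≼ v₄ ∷ v₄ ≼ num 2 ⊕ v₀ ∷ num 1 ≼ v₀ ∷ [])
      (bad , degrees b , #-cover (nbr G whole b) (nbr G Z b) (X ∖ ⁅ b ⁆) sort , #-remove X b bX , order , 1≤m , tt)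
      where
      sort : nbr G whole b ⊆ nbr G Z b ∪ (X ∖ ⁅ b ⁆)
      sort {v} (_ , e) with dec X v
      ... | yes x = inj₂ (x , λ { refl → eirr G e })
      ... | no nx = inj₁ ((tt , nx) , e)

    -- Degrees of at least 2α contribute 2α |Z| to twice the density. The edges from b₁ and b₂ to Z
    -- are counted a second time and add at least 4.
    double-slack : 2 + α * # Z ≤ ρ whole G Z
    double-slack = ≮⇒≥ λ bad → linarith (α * # Z ∷ ρ whole G Z ∷ sum inner ∷ sum outer ∷ (α + α) * # Z ∷ # (nbr G Z b₁) ∷ # (nbr G Z b₂) ∷ [])
      ((2 · num 1 ⊕ v₁ ≼ num 2 ⊕ v₀) ∷ v₂ ⊕ v₃ ≼ v₁ ⊕ v₁ ∷ v₄ ≼ v₂ ∷ v₅ ⊕ v₆ ≼ v₃ ∷ num 2 ≼ v₅ ∷ num 2 ≼ v₆ ∷ v₀ ⊕ v₀ ≼ v₄ ∷ [])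
      (bad , ≤-reflexive total , inner≥ , outer≥ , outward (inj₁ (inj₂ refl)) , outward (inj₂ refl)
           , ≤-reflexive (sym (*-distribʳ-+ (# Z) α α)) , tt)
      where
      inner outer : Fin n → ℕ
      inner z = χ# Z z * # (nbr G whole z)
      outer z = χ# Z z * # (nbr G (whole ∖ Z) z)
      total : sum inner + sum outer ≡ ρ whole G Z + ρ whole G Z
      total = trans (sym (∑-distrib-+ inner outer)) (trans (sum-cong-≗ λ z → sym (*-distribˡ-+ (χ# Z z) (# (nbr G whole z)) (# (nbr G (whole ∖ Z) z))))
                (sym (ρ-degrees whole G Z (λ _ → tt))))
      inner≥ : (α + α) * # Z ≤ sum inner
      inner≥ = ≤-trans (≤-reflexive (sym (sum-* (α + α) (χ# Z)))) (sum-mono λ z → ≤-trans (≤-reflexive (*-comm (α + α) (χ# Z z))) (*-monoʳ-≤ (χ# Z z) (degrees z)))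
      outer≥ : # (nbr G Z b₁) + # (nbr G Z b₂) ≤ sum outer
      outer≥ = ≤-trans (≤-reflexive (sym (∑-distrib-+ (χ# (nbr G Z b₁)) (χ# (nbr G Z b₂))))) (sum-mono cell)
        where
        back : ∀ {b} z → b ∈ X → E G b z → b ∈ nbr G (whole ∖ Z) z
        back z bX e = (tt , λ p → proj₂ p bX) , esym G e
        cell : ∀ z → χ# (nbr G Z b₁) z + χ# (nbr G Z b₂) z ≤ outer z
        cell z = go (dec Z z) (dec (nbr G Z b₁) z) (dec (nbr G Z b₂) z)
          where
          go : (d : Dec (z ∈ Z)) (d₁ : Dec (z ∈ nbr G Z b₁)) (d₂ : Dec (z ∈ nbr G Z b₂)) → χ d₁ + χ d₂ ≤ χ d * # (nbr G (whole ∖ Z) z)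
          go (no nz) (yes p) _ = ⊥-elim (nz (proj₁ p))
          go (no nz) (no _) (yes p) = ⊥-elim (nz (proj₁ p))
          go _ (no _) (no _) = z≤n
          go (yes _) (yes p) (no _) = ≤-trans (#-one (nbr G (whole ∖ Z) z) b₁ (back z (inj₁ (inj₂ refl)) (proj₂ p))) (≤-reflexive (sym (+-identityʳ _)))
          go (yes _) (no _) (yes p) = ≤-trans (#-one (nbr G (whole ∖ Z) z) b₂ (back z (inj₂ refl) (proj₂ p))) (≤-reflexive (sym (+-identityʳ _)))
          go (yes _) (yes p) (yes q) = ≤-trans (#-pair (nbr G (whole ∖ Z) z) (back z (inj₁ (inj₂ refl)) (proj₂ p)) (back z (inj₂ refl) (proj₂ q)) b₁≢b₂)
              (≤-reflexive (sym (+-identityʳ _)))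

    massed : Massed α whole G X label
    massed = record
      { X⊆U = λ _ → tt ; order = order
      ; lab = b₁ , b₂ , λ _ e → outside-false⁻ Ends e
      ; dense = ≤-trans (n≤1+n _) double-slack
      ; slack = inj₂ (inj₁ double-slack)
      ; sparse = sparse }
      where
      sparse : Sparse α whole G X
      -- Since |S| < |X| ≤ m + 2 ≤ 2m + 2, deleting S leaves the graph connected, so only the empty
      -- set lies behind S.
      sparse Z′ S sep lt with any-∈ Z′
      ... | no none = ≤-trans (≤-reflexive (ρ-none whole G Z′ λ v z → none (v , z))) z≤n
      ... | yes (z , zZ) with any-∈ (X ∖ S)
      ... | no none = ⊥-elim (<⇒≱ lt (#-mono X S (∖-empty X S none)))
      ... | yes (x , xX , nxS) = ⊥-elim (X∩Z xX (proj₂ (walk-end (walk-closed Z′ stay zZ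
              (conn S (≤-trans lt (≤-trans order (≤-trans few (≤-reflexive 2α≡k)))) z x (Z∩S zZ) nxS)))))
        where
        open Separation sep
        few : 1 + α ≤ α + α
        few = +-mono-≤ {1} {α} {α} {α} (s≤s z≤n) ≤-refl
        stay : ∀ {a b} → a ∈ Z′ → b ∈ ∁ S → E G a b → b ∈ Z′
        stay az nb e = [ id , (λ s → ⊥-elim (nb s)) ]′ (closed az tt e)

-- Nonseparating paths

module _ {n : ℕ} (G : Gr n) where

  data Trail : Fin n → Fin n → List (Fin n) → Set where
    stop : ∀ {x} → Trail x x (x ∷ [])
    move : ∀ {x z y vs} → E G x z → Trail z y vs → Trail x y (x ∷ vs)

  simple-trail : ∀ k P x y → # P ≤ k → Walk G P x y → ∃ λ vs → Trail x y vs × Unique vs × All (_∈ P) vs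
  simple-trail k P x y le w with walk-unfold w
  ... | inj₁ refl = x ∷ [] , stop , [] ∷ [] , walk-start w ∷ []
  simple-trail zero P x y le w | inj₂ _ = ⊥-elim (<⇒≱ (#-one P x (walk-start w)) le)
  simple-trail (suc k) P x y le w | inj₂ (z , e , w′)
    with simple-trail k (P ∖ ⁅ x ⁆) z y (≤-pred (≤-trans (#-remove P x (walk-start w)) le)) w′
  ... | vs , t , u , a = x ∷ vs , move e t , All.map (λ p eq → proj₂ p (sym eq)) a ∷ u , walk-start w ∷ All.map proj₁ a

  trail-walk : ∀ {x y vs P} → Trail x y vs → All (_∈ P) vs → Walk G P x y
  trail-walk stop (p ∷ []) = here p
  trail-walk (move e t) (p ∷ ps) = step p e (trail-walk t ps)

  module Separating {b₁ b₂ : Fin n} (root : Fin n) where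

    record Core (C : DSet n) : Set where
      field
        rooted : ∀ {v} → v ∈ C → Walk G C root v
        linked : Walk G (∁ C) b₁ b₂

    Maximal : DSet n → Set
    Maximal C = ∀ {c p} → c ∈ C → p ∉ C → E G c p → ¬ Walk G (∁ C ∖ ⁅ p ⁆) b₁ b₂

    enlarge : ∀ k C → # (∁ C) ≤ k → Core C → Σ (DSet n) λ C′ → C ⊆ C′ × Core C′ × Maximal C′
    enlarge k C le core with any? (λ p → dec (∁ C) p ×-dec any? (λ c → dec C c ×-dec E? G c p) ×-dec walk? G (∁ C ∖ ⁅ p ⁆) b₁ b₂)
    ... | no none = C , id , core , λ {c} {p} cC np e w → none (p , np , (c , cC , e) , w)
    enlarge zero C le core | yes (p , np , _) = ⊥-elim (<⇒≱ (#-one (∁ C) p np) le)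
    enlarge (suc k) C le core | yes (p , np , (c , cC , e) , w)
      with enlarge k (C ∪ ⁅ p ⁆) (≤-pred (≤-trans (#-strict (∁ (C ∪ ⁅ p ⁆)) (∁ C) p (λ q r → q (inj₁ r)) np λ q → q (inj₂ refl)) le)) core′
      where
      open Core core
      core′ : Core (C ∪ ⁅ p ⁆)
      core′ = record
        { rooted = λ { (inj₁ v) → walk-⊆ inj₁ (rooted v) ; (inj₂ refl) → walk-⊆ inj₁ (rooted cC) ++ʷ edge (inj₁ cC) (inj₂ refl) e }
        ; linked = walk-⊆ (λ { (q , ne) (inj₁ r) → q r ; (q , ne) (inj₂ r) → ne r }) w }
    ... | C′ , h , core″ , mx = C′ , (λ v → h (inj₁ v)) , core″ , mx

    -- When C is maximal, a vertex z outside C which does not separate b₁ from b₂ outside C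
    -- has no neighbour in C, and the component D of such vertices containing z is attached
    -- to at most two separating vertices: one between two others could be bypassed via D.
    no-bypass : ∀ {C} → Connected 3 G → root ∈ C → Core C → Maximal C → ∀ {z} → z ∉ C → ¬ Walk G (∁ C ∖ ⁅ z ⁆) b₁ b₂
    no-bypass {C} conn root∈ core mx {z} nz wz = finish (first-hit M linked) (last-exit M linked)
      where
      open Core core
      K D M : DSet n
      K = dset (λ v → v ∉ C × Walk G (∁ C ∖ ⁅ v ⁆) b₁ b₂) (λ v → ¬? (dec C v) ×-dec walk? G (∁ C ∖ ⁅ v ⁆) b₁ b₂)
      D = reach G K z
      z∈D : z ∈ D
      z∈D = here (nz , wz)
      M = dset (λ s → (s ∉ C × s ∉ K) × ∃ λ d → d ∈ D × E G d s)
               (λ s → (¬? (dec C s) ×-dec ¬? (dec K s)) ×-dec any? (λ d → dec D d ×-dec E? G d s))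
      D⊆K : D ⊆ K
      D⊆K d = walk-end d
      join : ∀ {d d′} → d ∈ D → d′ ∈ D → Walk G D d d′
      join p q = reverseʷ (inside p) ++ʷ inside q
        where
        inside : ∀ {d} → d ∈ D → Walk G D z d
        inside w = walk-⊆ proj₂ (walk-closed D (λ a b e → a ++ʷ edge (walk-end a) b e) z∈D w)
      separator : ∀ {s} → s ∈ M → ¬ Walk G (∁ C ∖ ⁅ s ⁆) b₁ b₂
      separator ((nc , nk) , _) w = nk (nc , w)
      -- By maximality no vertex of D has a neighbour in C, so deleting a set that covers M cuts D
      -- off from the root.
      isolated : ∀ B → # B < 3 → z ∉ B → root ∉ B → M ⊆ B → ⊥
      isolated B lt nzB nrB mb = proj₁ (D⊆K (proj₂ (walk-end (walk-closed D stay z∈D (conn B lt z root nzB nrB))))) root∈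
        where
        stay : ∀ {d v} → d ∈ D → v ∈ ∁ B → E G d v → v ∈ D
        stay {d} {v} dD nv e with dec C v | dec K v
        ... | yes vC | _ = ⊥-elim (mx vC (proj₁ (D⊆K dD)) (esym G e) (proj₂ (D⊆K dD)))
        ... | no _ | yes k = dD ++ʷ edge (D⊆K dD) k e
        ... | no nc | no nk = ⊥-elim (nv (mb ((nc , nk) , d , dD , e)))
      two : ∀ {s t} → s ∈ M → t ∈ M → Walk G (∁ C ∖ M ∪ ⁅ s ⁆) b₁ s → Walk G (∁ C ∖ M ∪ ⁅ t ⁆) t b₂ → ⊥
      two {s} {t} sM@((nsC , _) , d , dD , ds) tM@((ntC , _) , d′ , dD′ , dt) pre post =
        isolated (⁅ s ⁆ ∪ ⁅ t ⁆) (s≤s (≤-trans (#-insert ⁅ s ⁆ t) (s≤s (≤-reflexive (#-⁅⁆ s)))))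
          (λ { (inj₁ refl) → proj₂ (proj₁ sM) (nz , wz) ; (inj₂ refl) → proj₂ (proj₁ tM) (nz , wz) })
          (λ { (inj₁ refl) → nsC root∈ ; (inj₂ refl) → ntC root∈ }) bypassed
        where
        -- The walk from b₁ to b₂ meets M first in s and last in t. Any other r in M would be
        -- bypassed by going from s to t through D, although r separates.
        bypassed : M ⊆ ⁅ s ⁆ ∪ ⁅ t ⁆
        bypassed {r} rM with r ≟ᶠ s | r ≟ᶠ t
        ... | yes e | _ = inj₁ e
        ... | no _ | yes e = inj₂ e
        ... | no ns | no nt = ⊥-elim (separator rM
              (walk-⊆ (λ { (inj₁ p) → proj₁ p , (λ { refl → proj₂ p rM }) ; (inj₂ refl) → nsC , λ e → ns (sym e) }) pre ++ʷ
               step (nsC , λ e → ns (sym e)) (esym G ds) (walk-⊆ {P = D} inD (join dD dD′) ++ʷ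
               edge (inD dD′) (ntC , λ e → nt (sym e)) dt) ++ʷ
               walk-⊆ (λ { (inj₁ p) → proj₁ p , (λ { refl → proj₂ p rM }) ; (inj₂ refl) → ntC , λ e → nt (sym e) }) post))
          where
          inD : D ⊆ ∁ C ∖ ⁅ r ⁆
          inD p = proj₁ (D⊆K p) , λ { refl → proj₂ (proj₁ rM) (D⊆K p) }
      -- Each vertex of M separates, so M is empty; the empty set is written `∁ whole`.
      avoiding : Walk G (∁ C ∖ M) b₁ b₂ → ⊥
      avoiding w = isolated (∁ whole) (s≤s (≤-trans (≤-reflexive (#-none (∁ (whole {n})) λ v p → p tt)) z≤n)) (λ p → p tt) (λ p → p tt)
        λ rM → ⊥-elim (separator rM (walk-⊆ {P = ∁ C ∖ M} (λ p → proj₁ p , λ { refl → proj₂ p rM }) w))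
      finish : Walk G (∁ C ∖ M) b₁ b₂ ⊎ (b₁ ∈ M ⊎ (∃ λ a → ∃ λ s → Walk G (∁ C ∖ M) b₁ a × E G a s × s ∈ M × s ∈ ∁ C)) →
               Walk G (∁ C ∖ M) b₁ b₂ ⊎ (∃ λ t → t ∈ M × Walk G (∁ C ∖ M ∪ ⁅ t ⁆) t b₂ × t ∈ ∁ C) → ⊥
      finish (inj₁ w) _ = avoiding w
      finish _ (inj₁ w) = avoiding w
      finish (inj₂ (inj₁ bM)) (inj₂ (t , tM , post , _)) = two bM tM (here (inj₂ refl)) post
      finish (inj₂ (inj₂ (a , s , w , e , sM , _))) (inj₂ (t , tM , post , _)) =
        two sM tM (walk-⊆ inj₁ w ++ʷ edge (inj₁ (walk-end w)) (inj₂ refl) e) post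

  module _ (𝔾 : Graph n) (sub : ∀ {a b} → E G a b → Graph.Adj 𝔾 a b) (conn : Connected 3 G) {b₁ b₂ root : Fin n} where
    open Separating {b₁} {b₂} root

    Nonseparating : DSet n → Set
    Nonseparating C = Σ (List (Fin n)) λ P →
      IsWalk 𝔾 b₁ b₂ P × Unique P × (∀ {v} → v ∈ C → v ∉ˡ P) × ConnectedMinus 𝔾 (_∈ˡ P)

    isWalk : ∀ {x y us} → Trail x y us → IsWalk 𝔾 x y us
    isWalk stop = single
    isWalk (move e t) = cons (sub e) (isWalk t)

    -- A vertex outside C and off the path would not separate b₁ from b₂. So the path covers the
    -- complement of C and leaves exactly the connected set C.
    complementary-path : ∀ C → root ∈ C → Core C → Maximal C → Nonseparating C
    complementary-path C root∈ core mx with simple-trail (# (∁ C)) (∁ C) b₁ b₂ ≤-refl (Core.linked core)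
    ... | vs , trail , unique , avoids = vs , isWalk trail , unique , (λ p q → All.lookup avoids q p) ,
      λ u v nu nv → toReach (reverseʷ (Core.rooted core (covered nu)) ++ʷ Core.rooted core (covered nv))
      where
      covered : ∀ {v} → v ∉ˡ vs → v ∈ C
      covered {v} nv with dec C v
      ... | yes p = p
      ... | no np = ⊥-elim (no-bypass conn root∈ core mx np
            (trail-walk trail (All.tabulate λ {u} p → All.lookup avoids p , λ { refl → nv p })))
      toReach : ∀ {x y} → Walk G C x y → Reach 𝔾 (_∈ˡ vs) x y
      toReach (here _) = here
      toReach (step _ e w) = step (sub e) (λ p → All.lookup avoids p (walk-start w)) (toReach w)

    nonseparating-path : ∀ C → root ∈ C → Core C → Nonseparating C
    nonseparating-path C root∈ core with enlarge (# (∁ C)) C ≤-refl core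
    ... | C′ , h , core′ , mx with complementary-path C′ (h root∈) core′ mx
    ... | P , w , u , avoid , c = P , w , u , (λ p → avoid (h p)) , c

  -- C is the component of the root in the class `true`: it contains the terminals with this label
  -- and misses the class that joins b₁ to b₂.
  colour-core : ∀ {B S f b₁ b₂ root} → Sol B G S f → root ∈ S → b₁ ∈ S → b₂ ∈ S →
                f root ≡ true → f b₁ ≡ false → f b₂ ≡ false →
                Σ (DSet n) λ C → Separating.Core {b₁} {b₂} root C × (∀ {v} → v ∈ S → f v ≡ true → v ∈ C)
  colour-core {B} {S} {f} {b₁} {b₂} {root} (solution c (_ , joins)) rS s₁ s₂ fr f₁ f₂ = C , core , (λ p e → inC p e)
    where
    C : DSet n
    C = reach G (class B c true) root
    inC : ∀ {v} → v ∈ S → f v ≡ true → v ∈ C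
    inC {v} p e = subst (λ β → Walk G (class B c β) root v) fr (joins root v rS p (trans fr (sym e)))
    clash : true ≡ false → ⊥
    clash ()
    core : Separating.Core root C
    core = record
      { rooted = λ w → walk-⊆ proj₂ (walk-closed C (λ u v e → u ++ʷ edge (walk-end u) v e) (inC rS fr) w)
      ; linked = walk-⊆ (λ { (_ , k) w → clash (trans (sym (proj₂ (walk-end w))) k) })
          (subst (λ β → Walk G (class B c β) b₁ b₂) f₁ (joins b₁ b₂ s₁ s₂ (trans f₁ (sym f₂)))) }

theorem1p5 : (m : ℕ) → 1 ≤ m →
    (n : ℕ) (G : Graph n) → KConnected G (2 * m + 2) →
    (a : Fin m → Fin n) → Injective _≡_ _≡_ a →
    (b₁ b₂ : Fin n) → b₁ ≢ b₂ → (∀ i → a i ≢ b₁) → (∀ i → a i ≢ b₂) →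
    Σ (List (Fin n)) (λ P →
    IsWalk G b₁ b₂ P × Unique P × (∀ i → a i ∉ˡ P) × ConnectedMinus G (_∈ˡ P))
-- A positive number of aᵢ provides `a zero` as the root. Here m is one less than that number, so α
-- is `suc (suc m)`.
theorem1p5 (suc m) 1≤m n G kc a _ b₁ b₂ b₁≢b₂ a≢b₁ a≢b₂ with Extraction.extract G (2 * suc m + 2) kc
... | H , sub , conn = conclude (colour-core H (massed-solvable (suc (suc m)) massed) (terminal zero) (inj₁ (inj₂ refl)) (inj₂ refl)
        (kept zero) (outside-false Ends (inj₁ refl)) (outside-false Ends (inj₂ refl)))
  where
  open Initial 1≤m {H} (proj₁ kc) conn a b₁≢b₂ a≢b₁ a≢b₂
  terminal : ∀ i → a i ∈ X
  terminal i = inj₁ (inj₁ (i , refl))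
  kept : ∀ i → label (a i) ≡ true
  kept i = outside-true Ends [ a≢b₁ i , a≢b₂ i ]′
  three : Connected 3 H
  three B lt = conn B (≤-trans lt (+-mono-≤ {1} {_} {2} {2} (≤-trans 1≤m (m≤m+n (suc m) _)) ≤-refl))
  conclude : (Σ (DSet n) λ C → Separating.Core H {b₁} {b₂} (a zero) C × (∀ {v} → v ∈ X → label v ≡ true → v ∈ C)) →
    Σ (List (Fin n)) (λ P → IsWalk G b₁ b₂ P × Unique P × (∀ i → a i ∉ˡ P) × ConnectedMinus G (_∈ˡ P))
  conclude (C , core , inC) with nonseparating-path H G sub three C (inC (terminal zero) (kept zero)) core
  ... | P , w , u , avoid , c = P , w , u , (λ i → avoid (inC (terminal i) (kept i))) , c
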